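{- Let $\ell(k) := \lim_{n\to\infty} P(2n-1-|S-S| = k)$, where $S$ is a uniformly random subset of $[n]=\{0,\dots,n-1\}$ (this limit exists for every $k\ge 0$). Then \[ \begin{aligned} &0.12165 < \ell(0) < 0.12255, && 0.18434 < \ell(2) < 0.18614, && 0.18713 < \ell(4) < 0.18959,\\ &0.15728 < \ell(6) < 0.16019, && 0.11801 < \ell(8) < 0.12119, && 0.08188 < \ell(10) < 0.08523,\\ &0.05355 < \ell(12) < 0.05700, && 0.03334 < \ell(14) < 0.03685, && 0.01981 < \ell(16) < 0.02335,\\ &0.01115 < \ell(18) < 0.01471, && 0.00580 < \ell(20) < 0.00937. && \end{aligned} \]
   Context: For a positive integer $n$, $[n] := \{0,1,\dots,n-1\}$, and $S$ is chosen uniformly at random among all $2^n$ subsets of $[n]$. The difference set is $S-S := \{x-y : x,y \in S\}$. -}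

module Defs where

open import Data.Bool using (Bool; true; false)
open import Data.Nat as ℕ using (ℕ; zero; suc; _∸_; _^_)
open import Data.Nat.Properties using (m^n≢0)
open import Data.Integer as ℤ using (ℤ; +_)
open import Data.List using (List; []; _∷_; map; length; filter; deduplicate; concatMap; upTo)
open import Data.Product using (Σ; _×_; ∃; _,_)
open import Data.Rational as ℚ using (ℚ; 0ℚ)
open import Relation.Binary.PropositionalEquality using (_≡_)

-- All subsets of [n] = {0,…,n-1}, encoded as characteristic lists of
-- length n (entry i says whether i ∈ S). There are exactly 2^n of them.
subsets : ℕ → List (List Bool)
subsets zero    = [] ∷ []
subsets (suc n) = concatMap (λ s → (false ∷ s) ∷ (true ∷ s) ∷ []) (subsets n)

elemsFrom : ℕ → List Bool → List ℕ
elemsFrom i []           = []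
elemsFrom i (false ∷ bs) = elemsFrom (suc i) bs
elemsFrom i (true  ∷ bs) = i ∷ elemsFrom (suc i) bs

elems : List Bool → List ℕ
elems = elemsFrom 0

diffSet : List Bool → List ℤ
diffSet s = deduplicate ℤ._≟_
  (concatMap (λ x → map (λ y → (+ x) ℤ.- (+ y)) (elems s)) (elems s))

diffCard : List Bool → ℕ
diffCard s = length (diffSet s)

count : ℕ → ℕ → ℕ
count n k = length (filter (λ s → (2 ℕ.* n ∸ 1 ∸ diffCard s) ℕ.≟ k) (subsets n))

prob : ℕ → ℕ → ℚ
prob n k = (+ count n k) ℚ./ (2 ^ n)
  where instance _ = m^n≢0 2 n

Converges : (ℕ → ℚ) → Set
Converges a = (ε : ℚ) → 0ℚ ℚ.< ε →
  ∃ λ N → (m n : ℕ) → N ℕ.≤ m → N ℕ.≤ n → ℚ.∣ a m ℚ.- a n ∣ ℚ.< ε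

-- For a convergent sequence a, "lo < lim a < hi" holds iff a is eventually
-- inside some closed interval [lo' , hi'] with lo < lo' and hi' < hi.
LimitBetween : ℚ → (ℕ → ℚ) → ℚ → Set
LimitBetween lo a hi = Σ ℚ λ lo' → Σ ℚ λ hi' →
  lo ℚ.< lo' × hi' ℚ.< hi ×
  ∃ λ N → (n : ℕ) → N ℕ.≤ n → (lo' ℚ.≤ a n × a n ℚ.≤ hi')

dec : ℕ → ℚ
dec m = (+ m) ℚ./ 100000

ℓBetween : ℕ → ℕ → ℕ → Set
ℓBetween lo k hi = LimitBetween (dec lo) (λ n → prob n k) (dec hi)

{-# OPTIONS --safe #-}
-- Reflecting the upper end of S turns the missing differences n - 1 - s (s small) into the numbers s that are not
-- of the form x + y with x ∈ A, y ∈ B, for two independent random sets A, B.  Large s contribute little, since the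
-- pairs {x , x + d} contain at least (n - d)/2 disjoint ones: this gives convergence, with explicit error.
-- If i = min A, j = min B, the number of missing sums is i + j + N′, where N′ belongs to shifted sets containing 0;
-- so ℓ(2x) is an expectation of f(x + 1, N′), where f varies slowly.  Prefixes of (A , B) of length t are enumerated;
-- once a prefix is long enough, the missing sums below 2t - 1 are treated exactly by inclusion–exclusion, and the later
-- ones by a union bound, which moves f by at most a slope times their expected number.
module Submission where

open import Defs
open import Data.Bool using (Bool; true; false; not; _∧_; _∨_; if_then_else_) renaming (T to IsTrue)
open import Data.Bool.Properties using (T-≡; ∧-zeroʳ)
open import Data.Integer as ℤ using (ℤ; +_; -[1+_]; 0ℤ; 1ℤ; +≤+; +<+; NonZero; Positive; positive; nonPositive; nonNegative; _+_; _*_; _-_; -_; _^_; _≤_; _<_; _≤ᵇ_)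
open import Data.Integer.Properties
open import Data.Integer.Tactic.RingSolver using (solve-∀)
open import Data.List using (List; []; _∷_; _++_; length; take; drop; map; concatMap; filter)
open import Data.List.Membership.Propositional using (_∈_; find; lose)
open import Data.List.Membership.Propositional.Properties
  using (∈-map⁺; ∈-map⁻; ∈-++⁺ˡ; ∈-++⁺ʳ; ∈-++⁻; ∈-concatMap⁺; ∈-concatMap⁻; ∈-deduplicate⁺; ∈-deduplicate⁻)
open import Data.List.Membership.Propositional.Properties.WithK using (unique∧set⇒bag)
open import Data.List.Properties using (++-assoc; length-++; length-map; take++drop≡id)
open import Data.List.Relation.Binary.BagAndSetEquality using (∼bag⇒↭)
open import Data.List.Relation.Binary.Permutation.Propositional.Properties using (↭-length)
open import Data.List.Relation.Unary.All as All using (All; []; _∷_)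
open import Data.List.Relation.Unary.AllPairs using ([]; _∷_)
open import Data.List.Relation.Unary.Any using (here; there)
open import Data.List.Relation.Unary.Unique.DecPropositional.Properties ℤ._≟_ using (deduplicate-!)
open import Data.List.Relation.Unary.Unique.Propositional using (Unique)
import Data.List.Relation.Unary.Unique.Propositional.Properties as Uniqueₚ
open import Data.Nat as ℕ using (ℕ; zero; suc; _∸_; z≤n; s≤s)
import Data.Nat.Properties as ℕₚ
open import Data.Nat.Tactic.RingSolver using () renaming (solve-∀ to solve-∀ₙ)
open import Data.Product using (Σ; _×_; ∃; _,_; proj₁; proj₂)
open import Data.Rational as ℚ using (ℚ; 0ℚ)
import Data.Rational.Properties as ℚₚ
open import Data.Rational.Unnormalised as ℚᵘ using (mkℚᵘ)
import Data.Rational.Unnormalised.Properties as ℚᵘₚ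
open import Data.Sum using (_⊎_; inj₁; inj₂)
open import Data.Unit using (⊤; tt)
open import Function.Bundles using (mk⇔; Equivalence)
open import Relation.Binary.Definitions using (tri<; tri≈; tri>)
open import Relation.Binary.PropositionalEquality
  using (_≡_; _≢_; refl; sym; trans; cong; cong₂; subst; subst₂; module ≡-Reasoning)
open import Relation.Nullary using (Dec; yes; no; does; ¬_; contradiction)
open import Relation.Nullary.Decidable using (dec-false)
open import Algebra.Properties.Group ℚₚ.+-0-group using (⁻¹-involutive)

-- In every pair x + y below 2t - 1 at least one index lies in the prefix. Given the prefix, missing
-- such a sum therefore means that certain bits of the later digits are zero. Conjunctions of such
-- events are of the same kind, with a power of two as probability, so inclusion-exclusion can be
-- carried out with integer weights. From 2t on, two unknown digits can meet and only an upper bound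
-- is cheap. That bound is poor when the prefix has few ones. A leaf is therefore accepted according
-- to its weighted error, which is proportional to 4^-t 2^-v for v ones, and sparse prefixes are
-- pursued further than dense ones. Averaging over min A and min B also smooths the quantity to be
-- estimated. Instead of the indicator of a number of missing sums one has `f`, which in units of
-- probability rises by at most 1/16 and falls by at most 1/4 with each further missing sum; this
-- damps the error of the union bound. The enumeration does not involve x: rows keep binomial
-- moments, and `f` is applied to them only at the end. One table thus serves all eleven limits.

-- Integer inequalities, powers and indicators.

≤-by : ∀ {a b} d → 0ℤ ≤ d → b ≡ a + d → a ≤ b
≤-by {a} d 0≤d refl = ≤-trans (≤-reflexive (sym (+-identityʳ a))) (+-monoʳ-≤ a 0≤d)

0≤+ : ∀ {n} → 0ℤ ≤ + n
0≤+ = +≤+ z≤n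

*-monoˡ : ∀ c {a b} → 0ℤ ≤ c → a ≤ b → c * a ≤ c * b
*-monoˡ (+ n) 0≤c a≤b = *-monoˡ-≤-nonNeg (+ n) a≤b

0≤* : ∀ {a b} → 0ℤ ≤ a → 0ℤ ≤ b → 0ℤ ≤ a * b
0≤* {a} 0≤a 0≤b = ≤-trans (≤-reflexive (sym (*-zeroʳ a))) (*-monoˡ a 0≤a 0≤b)

*-mono : ∀ {a b c d} → 0ℤ ≤ a → 0ℤ ≤ d → a ≤ b → c ≤ d → a * c ≤ b * d
*-mono {a} {b} {c} {d} 0≤a 0≤d a≤b c≤d =
  ≤-trans (*-monoˡ a 0≤a c≤d)
    (≤-trans (≤-reflexive (*-comm a d)) (≤-trans (*-monoˡ d 0≤d a≤b) (≤-reflexive (*-comm d b))))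

0≤^ : ∀ n k → 0ℤ ≤ (+ n) ^ k
0≤^ n zero = 0≤+
0≤^ n (suc k) = 0≤* {+ n} 0≤+ (0≤^ n k)

^-+ : ∀ x m n → x ^ (m ℕ.+ n) ≡ x ^ m * x ^ n
^-+ x zero n = sym (*-identityˡ _)
^-+ x (suc m) n = trans (cong (x *_) (^-+ x m n)) (sym (*-assoc x _ _))

pos-^ : ∀ x n → + (x ℕ.^ n) ≡ (+ x) ^ n
pos-^ x zero = refl
pos-^ x (suc n) = trans (pos-* x (x ℕ.^ n)) (cong ((+ x) *_) (pos-^ x n))

^-nonZero : ∀ x k .{{_ : ℕ.NonZero x}} → NonZero ((+ x) ^ k)
^-nonZero x k = subst NonZero (pos-^ x k) (ℕₚ.m^n≢0 x k)

^-positive : ∀ x k .{{_ : ℕ.NonZero x}} → Positive ((+ x) ^ k)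
^-positive x k = subst Positive (pos-^ x k) (positive (+<+ (ℕ.>-nonZero⁻¹ _ {{ℕₚ.m^n≢0 x k}})))

𝟙 : Bool → ℤ
𝟙 false = 0ℤ
𝟙 true = 1ℤ

0≤𝟙 : ∀ b → 0ℤ ≤ 𝟙 b
0≤𝟙 false = 0≤+
0≤𝟙 true = 0≤+

𝟙≤1 : ∀ b → 𝟙 b ≤ 1ℤ
𝟙≤1 false = 0≤+
𝟙≤1 true = ≤-refl

𝟙-mono : ∀ {a b} → (a ≡ true → b ≡ true) → 𝟙 a ≤ 𝟙 b
𝟙-mono {false} {b} h = 0≤𝟙 b
𝟙-mono {true} h rewrite h refl = ≤-refl

𝟙-∧ : ∀ a b → 𝟙 (a ∧ b) ≡ 𝟙 a * 𝟙 b
𝟙-∧ false b = sym (*-zeroˡ (𝟙 b))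
𝟙-∧ true b = sym (*-identityˡ (𝟙 b))

iff⇒≡ : ∀ {a b} → (a ≡ true → b ≡ true) → (b ≡ true → a ≡ true) → a ≡ b
iff⇒≡ {true} f g = sym (f refl)
iff⇒≡ {false} {false} f g = refl
iff⇒≡ {false} {true} f g = g refl

∧-true : ∀ {a b} → a ∧ b ≡ true → a ≡ true × b ≡ true
∧-true {true} {true} _ = refl , refl

not-true : ∀ {a} → not a ≡ true → a ≡ false
not-true {false} _ = refl

-- Sums over the words of a given length.

module _ {X : Set} where

  sumL : List X → (X → ℤ) → ℤ
  sumL [] φ = 0ℤ
  sumL (x ∷ xs) φ = φ x + sumL xs φ

  sumL-cong : ∀ xs {φ ψ} → (∀ x → φ x ≡ ψ x) → sumL xs φ ≡ sumL xs ψ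
  sumL-cong [] h = refl
  sumL-cong (x ∷ xs) h = cong₂ _+_ (h x) (sumL-cong xs h)

  sumL-mono : ∀ xs {φ ψ} → (∀ x → φ x ≤ ψ x) → sumL xs φ ≤ sumL xs ψ
  sumL-mono [] h = ≤-refl
  sumL-mono (x ∷ xs) h = +-mono-≤ (h x) (sumL-mono xs h)

  sumL-+ : ∀ xs φ ψ → sumL xs (λ x → φ x + ψ x) ≡ sumL xs φ + sumL xs ψ
  sumL-+ [] φ ψ = refl
  sumL-+ (x ∷ xs) φ ψ = trans (cong (λ z → φ x + ψ x + z) (sumL-+ xs φ ψ)) (four (φ x) (ψ x) _ _)
    where
    four : ∀ a b c d → a + b + (c + d) ≡ a + c + (b + d)
    four = solve-∀

  sumL-* : ∀ xs c φ → sumL xs (λ x → c * φ x) ≡ c * sumL xs φ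
  sumL-* [] c φ = sym (*-zeroʳ c)
  sumL-* (x ∷ xs) c φ = trans (cong (λ z → c * φ x + z) (sumL-* xs c φ)) (sym (*-distribˡ-+ c _ _))

module Words {A : Set} (letters : List A) where

  sumW : ℕ → (List A → ℤ) → ℤ
  sumW zero F = F []
  sumW (suc n) F = sumL letters (λ a → sumW n (λ w → F (a ∷ w)))

  sumW-cong : ∀ n {F G} → (∀ w → length w ≡ n → F w ≡ G w) → sumW n F ≡ sumW n G
  sumW-cong zero h = h [] refl
  sumW-cong (suc n) h = sumL-cong letters λ a → sumW-cong n λ w e → h (a ∷ w) (cong suc e)

  sumW-mono : ∀ n {F G} → (∀ w → length w ≡ n → F w ≤ G w) → sumW n F ≤ sumW n G
  sumW-mono zero h = h [] refl
  sumW-mono (suc n) h = sumL-mono letters λ a → sumW-mono n λ w e → h (a ∷ w) (cong suc e)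

  sumW-+ : ∀ n F G → sumW n (λ w → F w + G w) ≡ sumW n F + sumW n G
  sumW-+ zero F G = refl
  sumW-+ (suc n) F G = trans (sumL-cong letters λ a → sumW-+ n _ _) (sumL-+ letters _ _)

  sumW-* : ∀ n c F → sumW n (λ w → c * F w) ≡ c * sumW n F
  sumW-* zero c F = refl
  sumW-* (suc n) c F = trans (sumL-cong letters λ a → sumW-* n c _) (sumL-* letters c _)

  sumW-*ʳ : ∀ n c F → sumW n (λ w → F w * c) ≡ sumW n F * c
  sumW-*ʳ n c F = trans (sumW-cong n λ w _ → *-comm (F w) c) (trans (sumW-* n c F) (*-comm c _))

  size : ℤ
  size = sumL letters (λ _ → 1ℤ)

  sumW-const : ∀ n c → sumW n (λ _ → c) ≡ size ^ n * c
  sumW-const zero c = sym (*-identityˡ c)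
  sumW-const (suc n) c = begin
    sumL letters (λ _ → sumW n (λ _ → c))  ≡⟨ sumL-cong letters (λ _ → trans (sumW-const n c) (sym (*-identityʳ _))) ⟩
    sumL letters (λ _ → size ^ n * c * 1ℤ) ≡⟨ sumL-* letters (size ^ n * c) (λ _ → 1ℤ) ⟩
    size ^ n * c * size                    ≡⟨ rot (size ^ n) c size ⟩
    size * size ^ n * c                    ∎
    where
    open ≡-Reasoning
    rot : ∀ x y z → x * y * z ≡ z * x * y
    rot = solve-∀

  sumW-zero : ∀ n → sumW n (λ _ → 0ℤ) ≡ 0ℤ
  sumW-zero n = trans (sumW-const n 0ℤ) (*-zeroʳ (size ^ n))

  sumW-0≤ : ∀ n F → (∀ w → 0ℤ ≤ F w) → 0ℤ ≤ sumW n F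
  sumW-0≤ n F h = ≤-trans (≤-reflexive (sym (sumW-zero n))) (sumW-mono n λ w _ → h w)

  sumW-++ : ∀ m n F → sumW (m ℕ.+ n) F ≡ sumW m (λ u → sumW n (λ v → F (u ++ v)))
  sumW-++ zero n F = refl
  sumW-++ (suc m) n F = sumL-cong letters λ a → sumW-++ m n (λ w → F (a ∷ w))

  sumW-∷ʳ : ∀ n F → sumW (suc n) F ≡ sumW n (λ u → sumL letters (λ a → F (u ++ a ∷ [])))
  sumW-∷ʳ n F = trans (cong (λ k → sumW k F) (ℕₚ.+-comm 1 n)) (sumW-++ n 1 F)

  sumW-sumL : ∀ {X : Set} n (xs : List X) (F : X → List A → ℤ) →
    sumW n (λ w → sumL xs (λ x → F x w)) ≡ sumL xs (λ x → sumW n (F x))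
  sumW-sumL n [] F = sumW-zero n
  sumW-sumL n (x ∷ xs) F = trans (sumW-+ n _ _) (cong (λ z → sumW n (F x) + z) (sumW-sumL n xs F))

-- Counting, quantifying and summing below a bound.

count< : (ℕ → Bool) → ℕ → ℕ
count< p zero = 0
count< p (suc k) = (if p 0 then 1 else 0) ℕ.+ count< (λ i → p (suc i)) k

count<-cong : ∀ {p q} k → (∀ i → i ℕ.< k → p i ≡ q i) → count< p k ≡ count< q k
count<-cong zero h = refl
count<-cong (suc k) h = cong₂ (λ b m → (if b then 1 else 0) ℕ.+ m) (h 0 (s≤s z≤n))
  (count<-cong k λ i i<k → h (suc i) (s≤s i<k))

count<-+ : ∀ p k l → count< p (k ℕ.+ l) ≡ count< p k ℕ.+ count< (λ i → p (k ℕ.+ i)) l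
count<-+ p zero l = refl
count<-+ p (suc k) l = trans (cong (_ ℕ.+_) (count<-+ (λ i → p (suc i)) k l))
  (sym (ℕₚ.+-assoc (if p 0 then 1 else 0) _ _))

count<-last : ∀ p k → count< p (suc k) ≡ (if p k then 1 else 0) ℕ.+ count< p k
count<-last p k = trans (cong (count< p) (ℕₚ.+-comm 1 k)) (trans (count<-+ p k 1)
  (trans (ℕₚ.+-comm (count< p k) _) (cong (ℕ._+ count< p k)
    (trans (ℕₚ.+-identityʳ _) (cong (λ j → if p j then 1 else 0) (ℕₚ.+-identityʳ k))))))

count<-reverse : ∀ p k → count< (λ i → p (k ∸ suc i)) k ≡ count< p k
count<-reverse p zero = refl
count<-reverse p (suc k) = trans (cong ((if p k then 1 else 0) ℕ.+_) (count<-reverse p k)) (sym (count<-last p k))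

count<-all : ∀ p k → (∀ i → i ℕ.< k → p i ≡ true) → count< p k ≡ k
count<-all p zero h = refl
count<-all p (suc k) h rewrite h 0 (s≤s z≤n) = cong suc (count<-all _ k λ i i<k → h (suc i) (s≤s i<k))

all< : (ℕ → Bool) → ℕ → Bool
all< p zero = true
all< p (suc k) = p 0 ∧ all< (λ i → p (suc i)) k

all<-elim : ∀ p k → all< p k ≡ true → ∀ i → i ℕ.< k → p i ≡ true
all<-elim p (suc k) h zero _ = proj₁ (∧-true h)
all<-elim p (suc k) h (suc i) (s≤s i<k) = all<-elim _ k (proj₂ (∧-true {p 0} h)) i i<k

all<-intro : ∀ p k → (∀ i → i ℕ.< k → p i ≡ true) → all< p k ≡ true
all<-intro p zero h = refl
all<-intro p (suc k) h rewrite h 0 (s≤s z≤n) = all<-intro _ k λ i i<k → h (suc i) (s≤s i<k)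

sum< : (ℕ → ℤ) → ℕ → ℤ
sum< φ zero = 0ℤ
sum< φ (suc k) = sum< φ k + φ k

sum<-mono : ∀ {φ ψ} k → (∀ i → i ℕ.< k → φ i ≤ ψ i) → sum< φ k ≤ sum< ψ k
sum<-mono zero h = ≤-refl
sum<-mono (suc k) h = +-mono-≤ (sum<-mono k λ i i<k → h i (ℕₚ.m≤n⇒m≤1+n i<k)) (h k ℕₚ.≤-refl)

sum<-* : ∀ c φ k → sum< (λ i → c * φ i) k ≡ c * sum< φ k
sum<-* c φ zero = sym (*-zeroʳ c)
sum<-* c φ (suc k) = trans (cong (_+ c * φ k) (sum<-* c φ k)) (sym (*-distribˡ-+ c _ _))

+count< : ∀ p k → + count< p k ≡ sum< (λ i → 𝟙 (p i)) k
+count< p zero = refl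
+count< p (suc k) = trans (cong +_ (count<-last p k)) (trans (bit (p k)) (cong (_+ 𝟙 (p k)) (+count< p k)))
  where
  bit : ∀ b → + ((if b then 1 else 0) ℕ.+ count< p k) ≡ + count< p k + 𝟙 b
  bit false = sym (+-identityʳ _)
  bit true = +-comm 1ℤ (+ count< p k)

module _ {A : Set} (letters : List A) where
  open Words letters

  sumW-sum< : ∀ n k (F : ℕ → List A → ℤ) →
    sumW n (λ w → sum< (λ i → F i w) k) ≡ sum< (λ i → sumW n (F i)) k
  sumW-sum< n zero F = sumW-zero n
  sumW-sum< n (suc k) F = trans (sumW-+ n _ _) (cong (_+ sumW n (F k)) (sumW-sum< n k F))

-- Digits, and the events that a word of digits avoids a mask.

-- A digit is a pair (aₓ , bₓ): is x ∈ S, and is n - 1 - x ∈ S.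
data Digit : Set where
  oo oi io ii : Digit

left right : Digit → Bool
left oo = false
left oi = false
left io = true
left ii = true
right oo = false
right oi = true
right io = false
right ii = true

swap : Digit → Digit
swap oo = oo
swap oi = io
swap io = oi
swap ii = ii

-- Some coordinate is set in both digits. Together with `swap` this becomes the relation used for
-- sums: `hit (swap d) e` says that digits d at x and e at y realise x + y, with either of the two
-- on the A side.
hit : Digit → Digit → Bool
hit oo _ = false
hit oi oo = false
hit oi oi = true
hit oi io = false
hit oi ii = true
hit io oo = false
hit io oi = false
hit io io = true
hit io ii = true
hit ii oo = false
hit ii oi = true
hit ii io = true
hit ii ii = true

join : Digit → Digit → Digit
join oo e = e
join ii e = ii
join oi oo = oi
join oi oi = oi
join oi io = ii
join oi ii = ii
join io oo = io
join io oi = ii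
join io io = io
join io ii = ii

-- The number of bits that stay undetermined in a digit that must avoid the given one.
free : Digit → ℕ
free oo = 2
free oi = 1
free io = 1
free ii = 0

opaque
  digits : List Digit
  digits = oo ∷ oi ∷ io ∷ ii ∷ []

open Words digits using () renaming
  (sumW to sumD; sumW-cong to sumD-cong; sumW-mono to sumD-mono; sumW-+ to sumD-+; sumW-* to sumD-*;
   sumW-*ʳ to sumD-*ʳ; sumW-const to sumD-const; sumW-zero to sumD-zero; sumW-0≤ to sumD-0≤; sumW-++ to sumD-++;
   sumW-∷ʳ to sumD-∷ʳ; sumW-sumL to sumD-sumL) public

join-hit : ∀ d e x → not (hit (join d e) x) ≡ not (hit d x) ∧ not (hit e x)
join-hit oo e x = refl
join-hit oi oo oo = refl
join-hit oi oo oi = refl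
join-hit oi oo io = refl
join-hit oi oo ii = refl
join-hit oi oi oo = refl
join-hit oi oi oi = refl
join-hit oi oi io = refl
join-hit oi oi ii = refl
join-hit oi io oo = refl
join-hit oi io oi = refl
join-hit oi io io = refl
join-hit oi io ii = refl
join-hit oi ii oo = refl
join-hit oi ii oi = refl
join-hit oi ii io = refl
join-hit oi ii ii = refl
join-hit io oo oo = refl
join-hit io oo oi = refl
join-hit io oo io = refl
join-hit io oo ii = refl
join-hit io oi oo = refl
join-hit io oi oi = refl
join-hit io oi io = refl
join-hit io oi ii = refl
join-hit io io oo = refl
join-hit io io oi = refl
join-hit io io io = refl
join-hit io io ii = refl
join-hit io ii oo = refl
join-hit io ii oi = refl
join-hit io ii io = refl
join-hit io ii ii = refl
join-hit ii oo oo = refl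
join-hit ii oi oo = refl
join-hit ii io oo = refl
join-hit ii ii oo = refl
join-hit ii e oi = refl
join-hit ii e io = refl
join-hit ii e ii = refl

avoid : List Digit → List Digit → Bool
avoid [] α = true
avoid (z ∷ Z) [] = true
avoid (z ∷ Z) (d ∷ α) = not (hit z d) ∧ avoid Z α

-- The second argument fixes the length, so that masks of various lengths can be merged into a word
-- that covers all later digits in question.
union : List Digit → List Digit → List Digit
union [] Z = Z
union (m ∷ M) [] = []
union (m ∷ M) (z ∷ Z) = join m z ∷ union M Z

length-union : ∀ M Z → length (union M Z) ≡ length Z
length-union [] Z = refl
length-union (m ∷ M) [] = refl
length-union (m ∷ M) (z ∷ Z) = cong suc (length-union M Z)

-- This closure under conjunction is what inclusion-exclusion rests on: an intersection of avoidance
-- events is again one such event, whose size `sumD-avoid` reads off the free bits.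
avoid-union : ∀ M Z α → length α ≡ length Z → avoid (union M Z) α ≡ avoid M α ∧ avoid Z α
avoid-union [] Z α e = refl
avoid-union (m ∷ M) [] [] e = refl
avoid-union (m ∷ M) (z ∷ Z) (d ∷ α) e
  rewrite join-hit m z d | avoid-union M Z α (ℕₚ.suc-injective e) = ∧-four (not (hit m d)) (not (hit z d)) (avoid M α) (avoid Z α)
  where
  ∧-four : ∀ a b c d → (a ∧ b) ∧ (c ∧ d) ≡ (a ∧ c) ∧ (b ∧ d)
  ∧-four true true c d = refl
  ∧-four true false true d = refl
  ∧-four true false false d = refl
  ∧-four false b c d = refl

frees : List Digit → ℕ
frees [] = 0
frees (z ∷ Z) = free z ℕ.+ frees Z

private
  two : ℤ
  two = + 2

opaque
  unfolding digits

  sum-avoid₁ : ∀ z → sumL digits (λ d → 𝟙 (not (hit z d))) ≡ two ^ free z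
  sum-avoid₁ oo = refl
  sum-avoid₁ oi = refl
  sum-avoid₁ io = refl
  sum-avoid₁ ii = refl

  sum-avoid₂ : sumL digits (λ d → sumL digits (λ e → 𝟙 (not (hit (swap d) e)))) ≡ + 9
  sum-avoid₂ = refl

  sumL-digits : ∀ φ → sumL digits φ ≡ φ oo + (φ oi + (φ io + (φ ii + 0ℤ)))
  sumL-digits φ = refl

sumD-avoid : ∀ Z → sumD (length Z) (λ α → 𝟙 (avoid Z α)) ≡ two ^ frees Z
sumD-avoid [] = refl
sumD-avoid (z ∷ Z) = begin
  sumL digits (λ d → sumD (length Z) (λ α → 𝟙 (not (hit z d) ∧ avoid Z α)))
    ≡⟨ sumL-cong digits (λ d → trans (sumD-cong (length Z) λ α _ → 𝟙-∧ (not (hit z d)) (avoid Z α))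
         (trans (sumD-* (length Z) (𝟙 (not (hit z d))) _) (*-comm (𝟙 (not (hit z d))) S))) ⟩
  sumL digits (λ d → S * 𝟙 (not (hit z d))) ≡⟨ sumL-* digits S (λ d → 𝟙 (not (hit z d))) ⟩
  S * sumL digits (λ d → 𝟙 (not (hit z d))) ≡⟨ cong₂ _*_ (sumD-avoid Z) (sum-avoid₁ z) ⟩
  two ^ frees Z * two ^ free z              ≡⟨ *-comm (two ^ frees Z) _ ⟩
  two ^ free z * two ^ frees Z              ≡⟨ sym (^-+ two (free z) (frees Z)) ⟩
  two ^ (free z ℕ.+ frees Z)                ∎
  where
  open ≡-Reasoning
  S = sumD (length Z) (λ α → 𝟙 (avoid Z α))

-- Weights are lists w, w/2, w/4, …, so that each new forced zero drops the head.

hd : List ℕ → ℕ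
hd [] = 0
hd (w ∷ ws) = w

tl : List ℕ → List ℕ
tl [] = []
tl (w ∷ ws) = ws

halve : Digit → Digit → List ℕ → List ℕ
halve oo z ws = ws
halve oi oo ws = tl ws
halve oi io ws = tl ws
halve oi oi ws = ws
halve oi ii ws = ws
halve io oo ws = tl ws
halve io oi ws = tl ws
halve io io ws = ws
halve io ii ws = ws
halve ii oo ws = tl (tl ws)
halve ii oi ws = tl ws
halve ii io ws = tl ws
halve ii ii ws = ws

halves : List Digit → List Digit → List ℕ → List ℕ
halves [] Z ws = ws
halves (m ∷ M) [] ws = ws
halves (m ∷ M) (z ∷ Z) ws = halves M Z (halve m z ws)

Halving : ℕ → List ℕ → Set
Halving zero ws = ⊤
Halving (suc k) ws = hd ws ≡ 2 ℕ.* hd (tl ws) × Halving k (tl ws)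

Halving-≤ : ∀ k l ws → Halving (k ℕ.+ l) ws → Halving k ws
Halving-≤ zero l ws h = tt
Halving-≤ (suc k) l ws (e , h) = e , Halving-≤ k l (tl ws) h

halve-spec : ∀ m z k ws → Halving (free z ℕ.+ k) ws →
  Halving (free (join m z) ℕ.+ k) (halve m z ws) ×
  + hd ws * two ^ free (join m z) ≡ + hd (halve m z ws) * two ^ free z
halve-spec m z k ws h = go m z h
  where
  step₁ : ∀ us j → hd us ≡ 2 ℕ.* hd (tl us) → + hd us * two ^ j ≡ + hd (tl us) * two ^ suc j
  step₁ us j e = trans (cong (λ a → + a * two ^ j) e)
    (trans (cong (_* two ^ j) (pos-* 2 (hd (tl us)))) (rot (+ hd (tl us)) (two ^ j)))
    where
    rot : ∀ b x → + 2 * b * x ≡ b * (+ 2 * x)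
    rot = solve-∀
  go : ∀ m z → Halving (free z ℕ.+ k) ws →
    Halving (free (join m z) ℕ.+ k) (halve m z ws) ×
    + hd ws * two ^ free (join m z) ≡ + hd (halve m z ws) * two ^ free z
  go oo z h = h , refl
  go oi oo (e , h) = h , step₁ ws 1 e
  go oi oi h = h , refl
  go oi io (e , h) = h , step₁ ws 0 e
  go oi ii h = h , refl
  go io oo (e , h) = h , step₁ ws 1 e
  go io oi (e , h) = h , step₁ ws 0 e
  go io io h = h , refl
  go io ii h = h , refl
  go ii oo (e , e′ , h) = h , trans (step₁ ws 0 e) (step₁ (tl ws) 1 e′)
  go ii oi (e , h) = h , step₁ ws 0 e
  go ii io (e , h) = h , step₁ ws 0 e
  go ii ii h = h , refl

-- The offset k carries the positions of Z that were already passed.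
halves-spec′ : ∀ M Z k ws → Halving (frees Z ℕ.+ k) ws →
  Halving (frees (union M Z) ℕ.+ k) (halves M Z ws) ×
  + hd ws * two ^ frees (union M Z) ≡ + hd (halves M Z ws) * two ^ frees Z
halves-spec′ [] Z k ws h = h , refl
halves-spec′ (m ∷ M) [] k ws h = h , refl
halves-spec′ (m ∷ M) (z ∷ Z) k ws h = subst (λ i → Halving i (halves M Z ws′)) p (proj₁ ih) , eq
  where
  open ≡-Reasoning
  j = join m z
  ws′ = halve m z ws
  one = halve-spec m z (frees Z ℕ.+ k) ws (subst (λ j → Halving j ws) (ℕₚ.+-assoc (free z) (frees Z) k) h)
  swp : ∀ a b c → a ℕ.+ (b ℕ.+ c) ≡ b ℕ.+ (a ℕ.+ c)
  swp a b c = trans (sym (ℕₚ.+-assoc a b c)) (trans (cong (ℕ._+ c) (ℕₚ.+-comm a b)) (ℕₚ.+-assoc b a c))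
  ih = halves-spec′ M Z (free j ℕ.+ k) ws′ (subst (λ i → Halving i ws′) (swp (free j) (frees Z) k) (proj₁ one))
  p : frees (union M Z) ℕ.+ (free j ℕ.+ k) ≡ free j ℕ.+ frees (union M Z) ℕ.+ k
  p = trans (swp (frees (union M Z)) (free j) k) (sym (ℕₚ.+-assoc (free j) (frees (union M Z)) k))
  w = + hd ws
  w′ = + hd ws′
  w″ = + hd (halves M Z ws′)
  u = two ^ frees (union M Z)
  swpᶻ : ∀ a b c → a * b * c ≡ a * c * b
  swpᶻ = solve-∀
  eq : w * two ^ (free j ℕ.+ frees (union M Z)) ≡ w″ * two ^ (free z ℕ.+ frees Z)
  eq = begin
    w * two ^ (free j ℕ.+ frees (union M Z)) ≡⟨ cong (w *_) (^-+ two (free j) _) ⟩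
    w * (two ^ free j * u)                   ≡⟨ sym (*-assoc w _ u) ⟩
    w * two ^ free j * u                     ≡⟨ cong (_* u) (proj₂ one) ⟩
    w′ * two ^ free z * u                    ≡⟨ swpᶻ w′ (two ^ free z) u ⟩
    w′ * u * two ^ free z                    ≡⟨ cong (_* two ^ free z) (proj₂ ih) ⟩
    w″ * two ^ frees Z * two ^ free z        ≡⟨ *-assoc w″ _ _ ⟩
    w″ * (two ^ frees Z * two ^ free z)      ≡⟨ cong (w″ *_) (*-comm (two ^ frees Z) _) ⟩
    w″ * (two ^ free z * two ^ frees Z)      ≡⟨ cong (w″ *_) (sym (^-+ two (free z) (frees Z))) ⟩
    w″ * two ^ (free z ℕ.+ frees Z)          ∎

-- In terms of probability: the new head is the old one times the chance that a uniform word
-- avoiding Z also avoids M. `Halving` guarantees that this product is an integer found in the list.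
halves-spec : ∀ M Z ws → Halving (frees Z) ws →
  Halving (frees (union M Z)) (halves M Z ws) ×
  + hd ws * two ^ frees (union M Z) ≡ + hd (halves M Z ws) * two ^ frees Z
halves-spec M Z ws h with halves-spec′ M Z 0 ws (subst (λ j → Halving j ws) (sym (ℕₚ.+-identityʳ _)) h)
... | h′ , e = subst (λ j → Halving j (halves M Z ws)) (ℕₚ.+-identityʳ _) h′ , e

-- Binomial moments by inclusion–exclusion; Newton's forward difference formula turns them into expectations.

addP : List ℕ → List ℕ → List ℕ
addP [] ys = ys
addP (x ∷ xs) [] = x ∷ xs
addP (x ∷ xs) (y ∷ ys) = (x ℕ.+ y) ∷ addP xs ys

-- Entry j is the weight `hd ws` times the mean of the binomial coefficient (N choose j), where N is
-- the number of masks in Ms avoided by a uniform word that avoids Z. Every mask doubles the work.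
moments : List (List Digit) → List Digit → List ℕ → List ℕ
moments [] Z ws = hd ws ∷ []
moments (M ∷ Ms) Z ws = addP (moments Ms Z ws) (0 ∷ moments Ms (union M Z) (halves M Z ws))

Δ : (ℕ → ℤ) → ℕ → ℤ
Δ f j = f (suc j) - f j

newton : List ℕ → (ℕ → ℤ) → ℤ
newton [] f = 0ℤ
newton (x ∷ xs) f = + x * f 0 + newton xs (Δ f)

newton-addP : ∀ xs ys f → newton (addP xs ys) f ≡ newton xs f + newton ys f
newton-addP [] ys f = sym (+-identityˡ _)
newton-addP (x ∷ xs) [] f = sym (+-identityʳ _)
newton-addP (x ∷ xs) (y ∷ ys) f =
  trans (cong₂ _+_ (cong (_* f 0) (pos-+ x y)) (newton-addP xs ys (Δ f))) (four (+ x) (+ y) (f 0) _ _)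
  where
  four : ∀ x y a p q → (x + y) * a + (p + q) ≡ x * a + p + (y * a + q)
  four = solve-∀

avoided : List (List Digit) → List Digit → ℕ
avoided [] α = 0
avoided (M ∷ Ms) α = (if avoid M α then 1 else 0) ℕ.+ avoided Ms α

avoided-≤ : ∀ Ms α → avoided Ms α ℕ.≤ length Ms
avoided-≤ [] α = z≤n
avoided-≤ (M ∷ Ms) α with avoid M α
... | true = s≤s (avoided-≤ Ms α)
... | false = ℕₚ.m≤n⇒m≤1+n (avoided-≤ Ms α)

-- Induction on the masks, by f (N + 1_M) = f N + 1_M (f (N + 1) - f N), where 1_M indicates that M
-- is avoided. In the second term 1_M is absorbed into Z, and `halves` adjusts the weight by the
-- conditional probability.
moments-spec : ∀ Ms Z ws f → Halving (frees Z) ws →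
  newton (moments Ms Z ws) f * two ^ frees Z
    ≡ + hd ws * sumD (length Z) (λ α → 𝟙 (avoid Z α) * f (avoided Ms α))
moments-spec [] Z ws f h = begin
  (+ w * f 0 + 0ℤ) * two ^ frees Z ≡⟨ rot (+ w) (f 0) (two ^ frees Z) ⟩
  + w * (two ^ frees Z * f 0)      ≡⟨ cong (λ x → + w * (x * f 0)) (sym (sumD-avoid Z)) ⟩
  + w * (S * f 0)                  ≡⟨ cong (+ w *_) (sym (sumD-*ʳ (length Z) (f 0) _)) ⟩
  + w * sumD (length Z) (λ α → 𝟙 (avoid Z α) * f 0) ∎
  where
  open ≡-Reasoning
  w = hd ws
  S = sumD (length Z) (λ α → 𝟙 (avoid Z α))
  rot : ∀ x y z → (x * y + 0ℤ) * z ≡ x * (z * y)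
  rot = solve-∀
moments-spec (M ∷ Ms) Z ws f h = begin
  newton (addP (moments Ms Z ws) (0 ∷ m′)) f * P
    ≡⟨ cong (_* P) (newton-addP (moments Ms Z ws) (0 ∷ m′) f) ⟩
  (newton (moments Ms Z ws) f + (0ℤ * f 0 + newton m′ (Δ f))) * P
    ≡⟨ expand (newton (moments Ms Z ws) f) (f 0) (newton m′ (Δ f)) P ⟩
  newton (moments Ms Z ws) f * P + newton m′ (Δ f) * P
    ≡⟨ cong₂ _+_ (moments-spec Ms Z ws f h) second ⟩
  + hd ws * S₁ + + hd ws * S₂ ≡⟨ sym (*-distribˡ-+ (+ hd ws) S₁ S₂) ⟩
  + hd ws * (S₁ + S₂)         ≡⟨ cong (+ hd ws *_) (sym (trans (sumD-cong ℓ split) (sumD-+ ℓ _ _))) ⟩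
  + hd ws * sumD ℓ (λ α → 𝟙 (avoid Z α) * f (avoided (M ∷ Ms) α)) ∎
  where
  open ≡-Reasoning
  ℓ = length Z
  Z′ = union M Z
  ws′ = halves M Z ws
  m′ = moments Ms Z′ ws′
  P = two ^ frees Z
  P′ = two ^ frees Z′
  S₁ = sumD ℓ (λ α → 𝟙 (avoid Z α) * f (avoided Ms α))
  S₂ = sumD ℓ (λ α → 𝟙 (avoid Z′ α) * Δ f (avoided Ms α))
  expand : ∀ a b c p → (a + (0ℤ * b + c)) * p ≡ a * p + c * p
  expand = solve-∀
  swp : ∀ x y z → x * y * z ≡ x * z * y
  swp = solve-∀
  hs = halves-spec M Z ws h
  instance
    P′≢0 : _
    P′≢0 = ^-nonZero 2 (frees Z′)
  second : newton m′ (Δ f) * P ≡ + hd ws * S₂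
  second = *-cancelʳ-≡ _ _ P′ (begin
    newton m′ (Δ f) * P * P′   ≡⟨ swp (newton m′ (Δ f)) P P′ ⟩
    newton m′ (Δ f) * P′ * P   ≡⟨ cong (_* P) (moments-spec Ms Z′ ws′ (Δ f) (proj₁ hs)) ⟩
    + hd ws′ * sumD (length Z′) _ * P ≡⟨ cong (λ k → + hd ws′ * sumD k (λ α → 𝟙 (avoid Z′ α) * Δ f (avoided Ms α)) * P) (length-union M Z) ⟩
    + hd ws′ * S₂ * P          ≡⟨ swp (+ hd ws′) S₂ P ⟩
    + hd ws′ * P * S₂          ≡⟨ cong (_* S₂) (sym (proj₂ hs)) ⟩
    + hd ws * P′ * S₂          ≡⟨ swp (+ hd ws) P′ S₂ ⟩
    + hd ws * S₂ * P′          ∎)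
  split : ∀ α → length α ≡ ℓ → 𝟙 (avoid Z α) * f (avoided (M ∷ Ms) α)
    ≡ 𝟙 (avoid Z α) * f (avoided Ms α) + 𝟙 (avoid Z′ α) * Δ f (avoided Ms α)
  split α e rewrite avoid-union M Z α e with avoid M α | avoid Z α
  ... | false | z = lem (𝟙 z) (f (avoided Ms α)) (Δ f (avoided Ms α))
    where
    lem : ∀ z a b → z * a ≡ z * a + 0ℤ * b
    lem = solve-∀
  ... | true | z = lem (𝟙 z) (f (avoided Ms α)) (f (suc (avoided Ms α)))
    where
    lem : ∀ z a b → z * b ≡ z * a + z * (b - a)
    lem = solve-∀

-- Digits by position, and the missing sums of a word.

infixl 25 _!_

_!_ : List Digit → ℕ → Digit
[] ! x = oo
(d ∷ ω) ! zero = d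
(d ∷ ω) ! suc x = ω ! x

!-++ˡ : ∀ P {α x} → x ℕ.< length P → (P ++ α) ! x ≡ P ! x
!-++ˡ (p ∷ P) {x = zero} _ = refl
!-++ˡ (p ∷ P) {x = suc x} (s≤s x<) = !-++ˡ P x<

!-++ʳ : ∀ P {α} x → (P ++ α) ! (length P ℕ.+ x) ≡ α ! x
!-++ʳ [] x = refl
!-++ʳ (p ∷ P) x = !-++ʳ P x

!-beyond : ∀ P {x} → length P ℕ.≤ x → P ! x ≡ oo
!-beyond [] _ = refl
!-beyond (p ∷ P) (s≤s h) = !-beyond P h

hit-oo : ∀ d → hit d oo ≡ false
hit-oo oo = refl
hit-oo oi = refl
hit-oo io = refl
hit-oo ii = refl

hit-swap : ∀ d e → hit (swap d) e ≡ hit (swap e) d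
hit-swap oo e = sym (hit-oo (swap e))
hit-swap oi oo = refl
hit-swap oi oi = refl
hit-swap oi io = refl
hit-swap oi ii = refl
hit-swap io oo = refl
hit-swap io oi = refl
hit-swap io io = refl
hit-swap io ii = refl
hit-swap ii oo = refl
hit-swap ii oi = refl
hit-swap ii io = refl
hit-swap ii ii = refl

split : ∀ k x → x ℕ.< k ⊎ ∃ λ q → x ≡ k ℕ.+ q
split k x with k ℕₚ.≤? x
... | yes k≤x = inj₂ (x ∸ k , sym (ℕₚ.m+[n∸m]≡n k≤x))
... | no k≰x = inj₁ (ℕₚ.≰⇒> k≰x)

-- conv ω k: no x + y = k - 1 has aₓ and b_y both set; in the paper's terms, the difference n - k is missing.
opaque
  conv : List Digit → ℕ → Bool
  conv ω k = all< (λ x → not (hit (swap (ω ! x)) (ω ! (k ∸ suc x)))) k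

Conv : List Digit → ℕ → Set
Conv ω k = ∀ x y → suc (x ℕ.+ y) ≡ k → hit (swap (ω ! x)) (ω ! y) ≡ false

opaque
  unfolding conv

  conv-elim : ∀ ω k → conv ω k ≡ true → Conv ω k
  conv-elim ω k h x y refl = trans (cong (λ z → hit (swap (ω ! x)) (ω ! z)) (sym (ℕₚ.m+n∸m≡n (suc x) y)))
    (not-true (all<-elim (λ x → not (hit (swap (ω ! x)) (ω ! (k ∸ suc x)))) k h x (s≤s (ℕₚ.m≤m+n x y))))

  conv-intro : ∀ ω k → Conv ω k → conv ω k ≡ true
  conv-intro ω k h = all<-intro _ k λ x x<k → cong not (h x _ (ℕₚ.m+[n∸m]≡n x<k))

conv-cong : ∀ ω ω′ k → (∀ x → x ℕ.< k → ω ! x ≡ ω′ ! x) → conv ω k ≡ conv ω′ k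
conv-cong ω ω′ k h = iff⇒≡ (λ c → conv-intro ω′ k (go ω ω′ h (conv-elim ω k c)))
                           (λ c → conv-intro ω k (go ω′ ω (λ x x<k → sym (h x x<k)) (conv-elim ω′ k c)))
  where
  go : ∀ ω ω′ → (∀ x → x ℕ.< k → ω ! x ≡ ω′ ! x) → Conv ω k → Conv ω′ k
  go ω ω′ h c x y refl rewrite sym (h x (s≤s (ℕₚ.m≤m+n x y))) | sym (h y (s≤s (ℕₚ.m≤n+m y x))) = c x y refl

Avoid : List Digit → List Digit → Set
Avoid Z α = ∀ q → hit (Z ! q) (α ! q) ≡ false

avoid-elim : ∀ Z α → avoid Z α ≡ true → Avoid Z α
avoid-elim [] α h q = refl
avoid-elim (z ∷ Z) [] h q = hit-oo _
avoid-elim (z ∷ Z) (d ∷ α) h zero = not-true (proj₁ (∧-true h))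
avoid-elim (z ∷ Z) (d ∷ α) h (suc q) = avoid-elim Z α (proj₂ (∧-true {not (hit z d)} h)) q

avoid-intro : ∀ Z α → Avoid Z α → avoid Z α ≡ true
avoid-intro [] α h = refl
avoid-intro (z ∷ Z) [] h = refl
avoid-intro (z ∷ Z) (d ∷ α) h rewrite h 0 = avoid-intro Z α (λ q → h (suc q))

-- Peeling off both ends of the word splits the pairs x + y = k - 1 into independent ones.
sumD-conv : ∀ k → sumD k (λ ω → 𝟙 (conv ω k)) ≤ (+ 3) ^ k
sumD-conv zero = 𝟙≤1 (conv [] 0)
sumD-conv (suc zero) = ≤-trans (sumL-mono digits λ d → 𝟙-mono λ h → cong not (conv-elim (d ∷ []) 1 h 0 0 refl)) three
  where
  opaque
    unfolding digits
    three : sumL digits (λ d → 𝟙 (not (hit (swap d) d))) ≤ (+ 3) ^ 1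
    three = ≤-refl
sumD-conv (suc (suc k)) = begin
  sumL digits (λ d → sumD (suc k) (λ ω → 𝟙 (conv (d ∷ ω) (2 ℕ.+ k))))
    ≡⟨ sumL-cong digits (λ d → trans (sumD-∷ʳ k (λ ω → 𝟙 (conv (d ∷ ω) (2 ℕ.+ k))))
         (sumD-sumL k digits (λ e ω → 𝟙 (conv (d ∷ ω ++ e ∷ []) (2 ℕ.+ k))))) ⟩
  sumL digits (λ d → sumL digits (λ e → sumD k (λ ω → 𝟙 (conv (d ∷ ω ++ e ∷ []) (2 ℕ.+ k)))))
    ≤⟨ sumL-mono digits (λ d → sumL-mono digits λ e → inner d e) ⟩
  sumL digits (λ d → sumL digits (λ e → (+ 3) ^ k * 𝟙 (not (hit (swap d) e))))
    ≡⟨ sumL-cong digits (λ d → sumL-* digits ((+ 3) ^ k) (λ e → 𝟙 (not (hit (swap d) e)))) ⟩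
  sumL digits (λ d → (+ 3) ^ k * sumL digits (λ e → 𝟙 (not (hit (swap d) e))))
    ≡⟨ sumL-* digits ((+ 3) ^ k) (λ d → sumL digits (λ e → 𝟙 (not (hit (swap d) e)))) ⟩
  (+ 3) ^ k * sumL digits (λ d → sumL digits (λ e → 𝟙 (not (hit (swap d) e))))
    ≡⟨ cong ((+ 3) ^ k *_) sum-avoid₂ ⟩
  (+ 3) ^ k * (+ 9) ≡⟨ nine ((+ 3) ^ k) ⟩
  (+ 3) ^ (2 ℕ.+ k) ∎
  where
  open ≤-Reasoning
  nine : ∀ x → x * + 9 ≡ + 3 * (+ 3 * x)
  nine = solve-∀
  ends : ∀ d e ω → length ω ≡ k → conv (d ∷ ω ++ e ∷ []) (2 ℕ.+ k) ≡ true → not (hit (swap d) e) ∧ conv ω k ≡ true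
  ends d e ω refl h = cong₂ _∧_ (cong not (trans (cong (hit (swap d)) (sym at-end)) (c 0 (suc k) refl)))
      (conv-intro ω k λ x y x+y → trans (cong₂ (λ u v → hit (swap u) v) (sym (at x (s≤s (ℕₚ.m≤m+n x y)) x+y)) (sym (at y (s≤s (ℕₚ.m≤n+m y x)) x+y)))
         (c (suc x) (suc y) (cong suc (trans (cong suc (ℕₚ.+-suc x y)) (cong suc x+y)))))
    where
    c = conv-elim (d ∷ ω ++ e ∷ []) (2 ℕ.+ k) h
    at-end : (ω ++ e ∷ []) ! k ≡ e
    at-end = trans (cong ((ω ++ e ∷ []) !_) (sym (ℕₚ.+-identityʳ k))) (!-++ʳ ω 0)
    at : ∀ z {j} → z ℕ.< suc j → suc j ≡ k → (ω ++ e ∷ []) ! z ≡ ω ! z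
    at z z< eq = !-++ˡ ω (subst (z ℕ.<_) eq z<)
  inner : ∀ d e → sumD k (λ ω → 𝟙 (conv (d ∷ ω ++ e ∷ []) (2 ℕ.+ k))) ≤ (+ 3) ^ k * 𝟙 (not (hit (swap d) e))
  inner d e = begin
    sumD k (λ ω → 𝟙 (conv (d ∷ ω ++ e ∷ []) (2 ℕ.+ k)))
      ≤⟨ sumD-mono k (λ ω l → 𝟙-mono (ends d e ω l)) ⟩
    sumD k (λ ω → 𝟙 (not (hit (swap d) e) ∧ conv ω k))
      ≡⟨ trans (sumD-cong k λ ω _ → 𝟙-∧ (not (hit (swap d) e)) (conv ω k)) (sumD-* k b (λ ω → 𝟙 (conv ω k))) ⟩
    b * sumD k (λ ω → 𝟙 (conv ω k)) ≤⟨ *-monoˡ b (0≤𝟙 _) (sumD-conv k) ⟩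
    b * (+ 3) ^ k                   ≡⟨ *-comm b ((+ 3) ^ k) ⟩
    (+ 3) ^ k * b                   ∎
    where b = 𝟙 (not (hit (swap d) e))

infixl 25 _‼_

_‼_ : List Bool → ℕ → Bool
[] ‼ i = false
(c ∷ C) ‼ zero = c
(c ∷ C) ‼ suc i = C ‼ i

‼-beyond : ∀ C {i} → length C ℕ.≤ i → C ‼ i ≡ false
‼-beyond [] _ = refl
‼-beyond (c ∷ C) (s≤s h) = ‼-beyond C h

-- The branch-and-bound evaluator.  At a node, P is the known prefix of t digits and C tells which of the
-- positions t, …, 2t - 2 are already sums x + y with x, y < t, aₓ = b_y = 1.

cover : Digit → List Digit → List Bool → List Bool
cover e [] C = []
cover e (p ∷ P) [] = hit e p ∷ cover e P []
cover e (p ∷ P) (c ∷ C) = (c ∨ hit e p) ∷ cover e P C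

revswap : List Digit → List Digit → List Digit
revswap [] M = M
revswap (p ∷ P) M = revswap P (swap p ∷ M)

-- The sum t + i needs a later index t + q together with the prefix index i - q. Hence the mask of
-- an uncovered position is the swapped prefix up to i in reverse order, which is what the
-- accumulator M holds.
masks : List Digit → List Bool → List Digit → List (List Digit) → List (List Digit)
masks (p ∷ P) (true ∷ C) M Ms = masks P C (swap p ∷ M) Ms
masks (p ∷ P) (false ∷ C) M Ms = masks P C (swap p ∷ M) ((swap p ∷ M) ∷ Ms)
masks _ _ _ Ms = Ms

zeros : ∀ {X : Set} → List X → List Digit
zeros = map (λ _ → oo)

-- Row c of a table serves the leaves whose prefix misses c sums: their binomial moments and, in position u,
-- the error mass of the leaves with u masks.
Row : Set
Row = List ℕ × List ℕ

addRows : List Row → List Row → List Row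
addRows [] ss = ss
addRows (r ∷ rs) [] = r ∷ rs
addRows ((m , e) ∷ rs) ((m′ , e′) ∷ ss) = (addP m m′ , addP e e′) ∷ addRows rs ss

errorRow : ℕ → ℕ → List ℕ
errorRow zero e = e ∷ []
errorRow (suc u) e = 0 ∷ errorRow u e

-- For v ones in P, avoiding the whole prefix has probability 2^-v, and the i digits in front of the
-- avoiding ones contribute at most (3/4)^i. Since the powers of 3/4 add up to 4, the expected
-- number of missing sums from 2t - 1 on is at most 4 · 2^-v. The mass is filed under the number of
-- masks because `slope` depends on how large the exact part of the count can be.
leaf : List (List Digit) → List Digit → List Bool → List ℕ → Row
leaf Ms P C ws = moments Ms (zeros C) ws , errorRow (length Ms) (4 ℕ.* hd (halves (revswap P []) (zeros P) ws))

leafAt : List Digit → List Bool → List ℕ → Row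
leafAt P C ws = leaf (masks P C [] []) P C ws

-- The error mass of a leaf is proportional to 4^-t 2^-v. A digit divides it by four, and each of
-- its ones by two more; the cost is the exponent. A common budget thus gives all leaves errors of
-- about the same size.
cost : Digit → ℕ
cost oo = 2
cost oi = 3
cost io = 3
cost ii = 4

uncovered : List Bool → ℕ
uncovered [] = 0
uncovered (true ∷ C) = uncovered C
uncovered (false ∷ C) = suc (uncovered C)

-- Leaves with many masks are expensive, so the search stops there one unit of budget earlier.
stop : ℕ → List Bool → Bool
stop zero C = true
stop (suc zero) C = 7 ℕ.≤ᵇ uncovered C
stop (suc (suc b)) C = false

-- `cap` bounds the arguments k at which the rows will be evaluated. A missing sum lowers k by one,
-- and `f` 1 vanishes at all positive counts, so `settle` may drop a branch with a missing sum once
-- `cap` is at most 1.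
search : (fuel cap budget : ℕ) → List Digit → List Bool → List ℕ → List Row
branch : (fuel cap budget : ℕ) → List Digit → List Bool → List ℕ → List Row
extend : (fuel cap budget : ℕ) → List Digit → List Bool → List ℕ → Digit → List Row
settle : (fuel cap budget : ℕ) → List Digit → List Bool → List ℕ → List Row
search zero cap b P C ws = leafAt P C ws ∷ []
search (suc n) cap b P C ws = if stop b C then leafAt P C ws ∷ [] else branch n cap b P C (tl (tl ws))
branch n cap b P C ws =
  addRows (extend n cap b P C ws oo) (addRows (extend n cap b P C ws oi)
    (addRows (extend n cap b P C ws io) (extend n cap b P C ws ii)))
extend n cap b P C ws d = settle n cap (b ∸ cost d) (P ++ d ∷ []) (cover (swap d) (P ++ d ∷ []) C) ws
settle n cap b P [] ws = []
settle n cap b P (true ∷ C) ws = search n cap b P C ws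
settle n zero b P (false ∷ C) ws = []
settle n (suc zero) b P (false ∷ C) ws = []
settle n (suc (suc cap)) b P (false ∷ C) ws = ([] , []) ∷ search n (suc cap) b P C ws

-- f k j / 2¹² is the probability that two independent geometric variables (P(i) = 2^-(i+1)) add up to k - 1 - j.
f : ℕ → ℕ → ℤ
f k j = + ((k ∸ j) ℕ.* 2 ℕ.^ (11 ∸ (k ∸ j)))

-- With G i = i · 2^(11 - i) one has f k j = G (k - j). Lowering i by τ lowers G by at most τ ·
-- 2^(11 - i), as only the linear factor decreases. Over all counts j ≤ u the factor 2^(11 - i) is
-- largest at j = u.
slope : ℕ → ℕ → ℤ
slope zero u = 0ℤ
slope (suc k) u = - + (2 ℕ.^ (10 ∸ (k ∸ u)))

-- The values of G from 0 on are 0, 1024, 1024, 768, 512, 320, ...: going down by one index gains at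
-- most 256. Up to index 2 there is no gain at all, which gives 0 for k ≤ 2.
rise : ℕ → ℕ → ℤ
rise (suc (suc (suc k))) u = + 256
rise _ u = 0ℤ

weigh : List ℕ → (ℕ → ℤ) → ℤ
weigh [] φ = 0ℤ
weigh (e ∷ es) φ = + e * φ 0 + weigh es (λ u → φ (suc u))

-- Row c is read at k - c, since its prefixes already miss c sums. With `slope` for φ the value is a
-- lower bound, with `rise` an upper one.
value : (ℕ → ℕ → ℤ) → ℕ → List Row → ℤ
value φ k [] = 0ℤ
value φ k ((m , e) ∷ rs) = newton m (f k) + weigh e (φ k) + value φ (k ∸ 1) rs

halvings : ℕ → List ℕ
halvings zero = 1 ∷ []
halvings (suc n) = 2 ℕ.^ suc n ∷ halvings n

-- How `f` changes with the number of missing sums.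

weight-bound : ∀ i τ → i ℕ.* 2 ℕ.^ (11 ∸ i) ℕ.≤ (i ∸ τ) ℕ.* 2 ℕ.^ (11 ∸ (i ∸ τ)) ℕ.+ τ ℕ.* 2 ℕ.^ (11 ∸ i)
weight-bound i τ with ℕₚ.≤-total τ i
... | inj₁ τ≤i = begin
  i ℕ.* X                         ≡⟨ cong (ℕ._* X) (sym (ℕₚ.m∸n+n≡m τ≤i)) ⟩
  (i ∸ τ ℕ.+ τ) ℕ.* X             ≡⟨ ℕₚ.*-distribʳ-+ X (i ∸ τ) τ ⟩
  (i ∸ τ) ℕ.* X ℕ.+ τ ℕ.* X       ≤⟨ ℕₚ.+-monoˡ-≤ (τ ℕ.* X) (ℕₚ.*-monoʳ-≤ (i ∸ τ)
                                       (ℕₚ.^-monoʳ-≤ 2 (ℕₚ.∸-monoʳ-≤ 11 (ℕₚ.m∸n≤m i τ)))) ⟩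
  (i ∸ τ) ℕ.* 2 ℕ.^ (11 ∸ (i ∸ τ)) ℕ.+ τ ℕ.* X ∎
  where
  open ℕₚ.≤-Reasoning
  X = 2 ℕ.^ (11 ∸ i)
... | inj₂ i≤τ = ℕₚ.≤-trans (ℕₚ.*-monoˡ-≤ (2 ℕ.^ (11 ∸ i)) i≤τ) (ℕₚ.m≤n+m _ _)

f-slope : ∀ k u j τ → j ℕ.≤ u → f k j + + τ * slope k u ≤ f k (j ℕ.+ τ)
f-slope zero u j τ j≤u rewrite ℕₚ.0∸n≡0 j | ℕₚ.0∸n≡0 (j ℕ.+ τ) = ≤-reflexive (trans (+-identityˡ _) (*-zeroʳ (+ τ)))
f-slope (suc k) u j τ j≤u rewrite sym (ℕₚ.∸-+-assoc (suc k) j τ) = begin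
  + G i + + τ * - + X                      ≤⟨ +-monoˡ-≤ (+ τ * - + X) (+≤+ (main (ℕₚ.≤-total j k))) ⟩
  + (G (i ∸ τ) ℕ.+ τ ℕ.* X) + + τ * - + X  ≡⟨ cong (_+ + τ * - + X) (trans (pos-+ (G (i ∸ τ)) (τ ℕ.* X)) (cong (λ z → + G (i ∸ τ) + z) (pos-* τ X))) ⟩
  + G (i ∸ τ) + + τ * + X + + τ * - + X    ≡⟨ lem (+ G (i ∸ τ)) (+ τ) (+ X) ⟩
  + G (i ∸ τ)                              ∎
  where
  open ≤-Reasoning
  G : ℕ → ℕ
  G i = i ℕ.* 2 ℕ.^ (11 ∸ i)
  i = suc k ∸ j
  X = 2 ℕ.^ (10 ∸ (k ∸ u))
  lem : ∀ a t x → a + t * x + t * - x ≡ a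
  lem = solve-∀
  main : j ℕ.≤ k ⊎ k ℕ.≤ j → G i ℕ.≤ G (i ∸ τ) ℕ.+ τ ℕ.* X
  main (inj₁ j≤k) = ℕₚ.≤-trans (weight-bound i τ) (ℕₚ.+-monoʳ-≤ (G (i ∸ τ)) (ℕₚ.*-monoʳ-≤ τ (ℕₚ.^-monoʳ-≤ 2
    (subst (λ m → 11 ∸ m ℕ.≤ 10 ∸ (k ∸ u)) (sym (ℕₚ.+-∸-assoc 1 j≤k)) (ℕₚ.∸-monoʳ-≤ 10 (ℕₚ.∸-monoʳ-≤ k j≤u))))))
  main (inj₂ k≤j) with ℕₚ.m≤n⇒m<n∨m≡n k≤j
  ... | inj₁ k<j rewrite ℕₚ.m≤n⇒m∸n≡0 k<j = z≤n
  ... | inj₂ refl = main (inj₁ ℕₚ.≤-refl)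

f-step : ∀ k j → f k (suc j) ≤ f k j + rise k 0
f-step k j = subst (λ i → + G i ≤ + G (k ∸ j) + rise k 0) (trans (ℕₚ.∸-+-assoc k j 1) (cong (k ∸_) (ℕₚ.+-comm j 1)))
  (go k (k ∸ j) (ℕₚ.m∸n≤m k j))
  where
  G : ℕ → ℕ
  G i = i ℕ.* 2 ℕ.^ (11 ∸ i)
  small : ∀ i → G (i ∸ 1) ℕ.≤ G i ℕ.+ 256
  small 0 = z≤n
  small 1 = z≤n
  small 2 = ℕₚ.≤ᵇ⇒≤ _ _ tt
  small 3 = ℕₚ.≤ᵇ⇒≤ _ _ tt
  small 4 = ℕₚ.≤ᵇ⇒≤ _ _ tt
  small 5 = ℕₚ.≤ᵇ⇒≤ _ _ tt
  small 6 = ℕₚ.≤ᵇ⇒≤ _ _ tt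
  small 7 = ℕₚ.≤ᵇ⇒≤ _ _ tt
  small 8 = ℕₚ.≤ᵇ⇒≤ _ _ tt
  small 9 = ℕₚ.≤ᵇ⇒≤ _ _ tt
  small 10 = ℕₚ.≤ᵇ⇒≤ _ _ tt
  small 11 = ℕₚ.≤ᵇ⇒≤ _ _ tt
  -- From 12 on the truncated exponents are 0, so that G is the identity.
  small (suc (suc (suc (suc (suc (suc (suc (suc (suc (suc (suc (suc n)))))))))))) rewrite ℕₚ.0∸n≡0 n =
    ℕₚ.≤-trans (ℕₚ.*-monoˡ-≤ 1 (ℕₚ.n≤1+n (11 ℕ.+ n))) (ℕₚ.m≤m+n _ 256)
  go : ∀ k i → i ℕ.≤ k → + G (i ∸ 1) ≤ + G i + rise k 0
  go zero zero _ = 0≤+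
  go (suc zero) zero _ = 0≤+
  go (suc zero) (suc zero) _ = 0≤+
  go (suc (suc zero)) zero _ = 0≤+
  go (suc (suc zero)) (suc zero) _ = 0≤+
  go (suc (suc zero)) (suc (suc zero)) _ = ≤-refl
  go (suc zero) (suc (suc i)) (s≤s ())
  go (suc (suc zero)) (suc (suc (suc i))) (s≤s (s≤s ()))
  go (suc (suc (suc k))) i _ = ≤-trans (+≤+ (small i)) (≤-reflexive (pos-+ (G i) 256))

rise-const : ∀ k u → rise k u ≡ rise k 0
rise-const zero u = refl
rise-const (suc zero) u = refl
rise-const (suc (suc zero)) u = refl
rise-const (suc (suc (suc k))) u = refl

f-rise : ∀ k u j τ → f k (j ℕ.+ τ) ≤ f k j + + τ * rise k u
f-rise k u j zero rewrite ℕₚ.+-identityʳ j = ≤-reflexive (sym (trans (cong (λ z → f k j + z) (*-zeroˡ (rise k u))) (+-identityʳ (f k j))))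
f-rise k u j (suc τ) rewrite ℕₚ.+-suc j τ = begin
  f k (suc (j ℕ.+ τ))                ≤⟨ f-step k (j ℕ.+ τ) ⟩
  f k (j ℕ.+ τ) + rise k 0           ≡⟨ cong (λ z → f k (j ℕ.+ τ) + z) (sym (rise-const k u)) ⟩
  f k (j ℕ.+ τ) + rise k u           ≤⟨ +-monoˡ-≤ (rise k u) (f-rise k u j τ) ⟩
  f k j + + τ * rise k u + rise k u  ≡⟨ lem (f k j) (+ τ) (rise k u) ⟩
  f k j + (+ 1 + + τ) * rise k u     ∎
  where
  open ≤-Reasoning
  lem : ∀ a t r → a + t * r + r ≡ a + (+ 1 + t) * r
  lem = solve-∀

f-shift : ∀ k j → f k (suc j) ≡ f (k ∸ 1) j
f-shift k j = cong (λ i → + (i ℕ.* 2 ℕ.^ (11 ∸ i))) (sym (ℕₚ.∸-+-assoc k 1 j))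

slope≤0 : ∀ k u → slope k u ≤ 0ℤ
slope≤0 zero u = ≤-refl
slope≤0 (suc k) u = neg-mono-≤ (0≤+ {2 ℕ.^ (10 ∸ (k ∸ u))})

0≤rise : ∀ k u → 0ℤ ≤ rise k u
0≤rise zero u = ≤-refl
0≤rise (suc zero) u = ≤-refl
0≤rise (suc (suc zero)) u = ≤-refl
0≤rise (suc (suc (suc k))) u = 0≤+

weigh-addP : ∀ xs ys φ → weigh (addP xs ys) φ ≡ weigh xs φ + weigh ys φ
weigh-addP [] ys φ = sym (+-identityˡ _)
weigh-addP (x ∷ xs) [] φ = sym (+-identityʳ _)
weigh-addP (x ∷ xs) (y ∷ ys) φ =
  trans (cong₂ _+_ (cong (_* φ 0) (pos-+ x y)) (weigh-addP xs ys (λ u → φ (suc u)))) (lem (+ x) (+ y) (φ 0) _ _)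
  where
  lem : ∀ x y a p q → (x + y) * a + (p + q) ≡ x * a + p + (y * a + q)
  lem = solve-∀

weigh-errorRow : ∀ u e φ → weigh (errorRow u e) φ ≡ + e * φ u
weigh-errorRow zero e φ = +-identityʳ _
weigh-errorRow (suc u) e φ = trans (cong₂ _+_ (*-zeroˡ (φ 0)) (weigh-errorRow u e (λ u → φ (suc u)))) (+-identityˡ _)

value-addRows : ∀ φ k rs ss → value φ k (addRows rs ss) ≡ value φ k rs + value φ k ss
value-addRows φ k [] ss = sym (+-identityˡ _)
value-addRows φ k (r ∷ rs) [] = sym (+-identityʳ _)
value-addRows φ k ((m , e) ∷ rs) ((m′ , e′) ∷ ss)
  rewrite newton-addP m m′ (f k) | weigh-addP e e′ (φ k) | value-addRows φ (k ∸ 1) rs ss =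
  lem (newton m (f k)) (newton m′ (f k)) (weigh e (φ k)) (weigh e′ (φ k)) _ _
  where
  lem : ∀ a b c d p q → a + b + (c + d) + (p + q) ≡ a + c + p + (b + d + q)
  lem = solve-∀

-- Flags and masks describe the missing sums.

!-cover : ∀ e P C i → length C ℕ.≤ length P → cover e P C ‼ i ≡ C ‼ i ∨ hit e (P ! i)
!-cover e [] [] i h = sym (hit-oo e)
!-cover e (p ∷ P) [] zero h = refl
!-cover e (p ∷ P) [] (suc i) h = !-cover e P [] i z≤n
!-cover e (p ∷ P) (c ∷ C) zero h = refl
!-cover e (p ∷ P) (c ∷ C) (suc i) (s≤s h) = !-cover e P C i h

length-cover : ∀ e P C → length (cover e P C) ≡ length P
length-cover e [] C = refl
length-cover e (p ∷ P) [] = cong suc (length-cover e P [])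
length-cover e (p ∷ P) (c ∷ C) = cong suc (length-cover e P C)

Covers : List Digit → List Bool → Set
Covers P C = ∀ i → C ‼ i ≡ not (conv P (suc (length P ℕ.+ i)))

length-∷ʳ : ∀ {X : Set} (P : List X) d → length (P ++ d ∷ []) ≡ suc (length P)
length-∷ʳ P d = trans (length-++ P) (ℕₚ.+-comm (length P) 1)

last-digit : ∀ P d → (P ++ d ∷ []) ! length P ≡ d
last-digit P d = trans (cong ((P ++ d ∷ []) !_) (sym (ℕₚ.+-identityʳ (length P)))) (!-++ʳ P 0)

-- Positions outside the prefix read as `oo`, which realises nothing, so `conv P` tests only the
-- pairs inside P. A new last digit, at index t, adds the pair of t and i alone, because `hit-swap`
-- identifies the two orders.
conv-∷ʳ : ∀ P d i → let P′ = P ++ d ∷ []; k = suc (length P ℕ.+ i) in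
  conv P′ k ≡ conv P k ∧ not (hit (swap d) (P′ ! i))
conv-∷ʳ P d i = iff⇒≡ to from
  where
  P′ = P ++ d ∷ []
  t = length P
  k = suc (t ℕ.+ i)
  to : conv P′ k ≡ true → conv P k ∧ not (hit (swap d) (P′ ! i)) ≡ true
  to h = cong₂ _∧_ (conv-intro P k known) (cong not (subst (λ e → hit (swap e) (P′ ! i) ≡ false) (last-digit P d) (c t i refl)))
    where
    c = conv-elim P′ k h
    known : Conv P k
    known x y e with split t x | split t y
    ... | inj₂ (q , refl) | _ rewrite !-beyond P {t ℕ.+ q} (ℕₚ.m≤m+n t q) = refl
    ... | inj₁ _ | inj₂ (q , refl) rewrite !-beyond P {t ℕ.+ q} (ℕₚ.m≤m+n t q) = hit-oo _
    ... | inj₁ x< | inj₁ y< = subst₂ (λ u v → hit (swap u) v ≡ false) (!-++ˡ P x<) (!-++ˡ P y<) (c x y e)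
  from : conv P k ∧ not (hit (swap d) (P′ ! i)) ≡ true → conv P′ k ≡ true
  from h = conv-intro P′ k all
    where
    c = conv-elim P k (proj₁ (∧-true h))
    new : hit (swap d) (P′ ! i) ≡ false
    new = not-true (proj₂ (∧-true {conv P k} h))
    cancel : ∀ q j → suc (t ℕ.+ q ℕ.+ j) ≡ k → q ℕ.+ j ≡ i
    cancel q j e = ℕₚ.+-cancelˡ-≡ t _ _ (trans (sym (ℕₚ.+-assoc t q j)) (ℕₚ.suc-injective e))
    high : ∀ q y → q ℕ.+ y ≡ i → hit (swap (P′ ! (t ℕ.+ q))) (P′ ! y) ≡ false
    high zero y refl rewrite ℕₚ.+-identityʳ t | last-digit P d = new
    high (suc q) y _ rewrite !-++ʳ P {d ∷ []} (suc q) = refl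
    all : Conv P′ k
    all x y e with split t x | split t y
    ... | inj₁ x< | inj₁ y< = subst₂ (λ u v → hit (swap u) v ≡ false) (sym (!-++ˡ P x<)) (sym (!-++ˡ P y<)) (c x y e)
    ... | inj₂ (q , refl) | _ = high q y (cancel q y e)
    ... | inj₁ _ | inj₂ (q , refl) = trans (hit-swap (P′ ! x) (P′ ! (t ℕ.+ q)))
          (high q x (cancel q x (trans (cong suc (ℕₚ.+-comm (t ℕ.+ q) x)) e)))

-- Appending the digit at t affects the sums t, ..., 2t, so the flags grow by two. The first of
-- them, for the sum t, is thereby final and is taken off by `settle`; this restores the length
-- `length P` - 1.
cover-spec : ∀ P C d → length C ℕ.≤ length P → Covers P C → ∀ i →
  cover (swap d) (P ++ d ∷ []) C ‼ i ≡ not (conv (P ++ d ∷ []) (suc (length P ℕ.+ i)))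
cover-spec P C d l h i rewrite conv-∷ʳ P d i =
  trans (!-cover (swap d) (P ++ d ∷ []) C i (ℕₚ.≤-trans l (ℕₚ.≤-trans (ℕₚ.n≤1+n _) (ℕₚ.≤-reflexive (sym (length-∷ʳ P d))))))
    (trans (cong (_∨ hit (swap d) ((P ++ d ∷ []) ! i)) (h i)) (dm (conv P (suc (length P ℕ.+ i))) (hit (swap d) ((P ++ d ∷ []) ! i))))
  where
  dm : ∀ a b → not a ∨ b ≡ not (a ∧ not b)
  dm false b = refl
  dm true false = refl
  dm true true = refl

revswap-+ : ∀ P M q → revswap P M ! (length P ℕ.+ q) ≡ M ! q
revswap-+ [] M q = refl
revswap-+ (p ∷ P) M q = trans (cong (revswap P (swap p ∷ M) !_) (sym (ℕₚ.+-suc (length P) q))) (revswap-+ P (swap p ∷ M) (suc q))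

revswap-! : ∀ P M x q → suc (x ℕ.+ q) ≡ length P → revswap P M ! q ≡ swap (P ! x)
revswap-! (p ∷ P) M zero q refl = trans (cong (revswap P (swap p ∷ M) !_) (sym (ℕₚ.+-identityʳ (length P)))) (revswap-+ P (swap p ∷ M) 0)
revswap-! (p ∷ P) M (suc x) q e = revswap-! P (swap p ∷ M) x q (ℕₚ.suc-injective e)

length-revswap : ∀ P M → length (revswap P M) ≡ length P ℕ.+ length M
length-revswap [] M = refl
length-revswap (p ∷ P) M = trans (length-revswap P (swap p ∷ M)) (ℕₚ.+-suc (length P) (length M))

masks-spec : ∀ P C M Ms α → length C ℕ.≤ length P → avoided (masks P C M Ms) α
  ≡ count< (λ i → not (C ‼ i) ∧ avoid (revswap (take (suc i) P) M) α) (length C) ℕ.+ avoided Ms α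
masks-spec [] [] M Ms α _ = refl
masks-spec (p ∷ P) [] M Ms α _ = refl
masks-spec (p ∷ P) (true ∷ C) M Ms α (s≤s h) = masks-spec P C (swap p ∷ M) Ms α h
masks-spec (p ∷ P) (false ∷ C) M Ms α (s≤s h) =
  trans (masks-spec P C (swap p ∷ M) ((swap p ∷ M) ∷ Ms) α h) (lem (count< _ (length C)) _ (avoided Ms α))
  where
  lem : ∀ a b c → a ℕ.+ (b ℕ.+ c) ≡ b ℕ.+ a ℕ.+ c
  lem = solve-∀ₙ

missing : List Digit → ℕ → List Digit → ℕ
missing P L α = count< (λ i → conv (P ++ α) (suc (length P ℕ.+ i))) L

take-! : ∀ P n x → x ℕ.< n → take n P ! x ≡ P ! x
take-! [] zero x ()
take-! [] (suc n) x _ = refl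
take-! (p ∷ P) (suc n) zero _ = refl
take-! (p ∷ P) (suc n) (suc x) (s≤s h) = take-! P n x h

length-take-≤ : ∀ {X : Set} n (P : List X) → n ℕ.≤ length P → length (take n P) ≡ n
length-take-≤ zero P _ = refl
length-take-≤ (suc n) (p ∷ P) (s≤s h) = cong suc (length-take-≤ n P h)

-- Two indices ≥ t add up to at least 2t, which exceeds t + i. A pair therefore lies inside P, or
-- joins one prefix index to one index of α; γ begins too late to take part.
conv-near : ∀ P α γ i → i ℕ.< length α → length α ℕ.< length P →
  conv (P ++ α ++ γ) (suc (length P ℕ.+ i)) ≡ conv P (suc (length P ℕ.+ i)) ∧ avoid (revswap (take (suc i) P) []) α
conv-near P α γ i i<ℓ ℓ<t = iff⇒≡ to from
  where
  t = length P
  k = suc (t ℕ.+ i)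
  ω = P ++ α ++ γ
  Q = take (suc i) P
  M = revswap Q []
  ∣Q∣ : length Q ≡ suc i
  ∣Q∣ = length-take-≤ (suc i) P (ℕₚ.≤-trans i<ℓ (ℕₚ.<⇒≤ ℓ<t))
  M-! : ∀ y q → y ℕ.+ q ≡ i → M ! q ≡ swap (P ! y)
  M-! y q e = trans (revswap-! Q [] y q (trans (cong suc e) (sym ∣Q∣)))
    (cong swap (take-! P (suc i) y (s≤s (subst (y ℕ.≤_) e (ℕₚ.m≤m+n y q)))))
  ω-high : ∀ q → q ℕ.≤ i → ω ! (t ℕ.+ q) ≡ α ! q
  ω-high q q≤i = trans (!-++ʳ P q) (!-++ˡ α (ℕₚ.≤-<-trans q≤i i<ℓ))
  to : conv ω k ≡ true → conv P k ∧ avoid M α ≡ true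
  to h = cong₂ _∧_ (conv-intro P k known) (avoid-intro M α disjoint)
    where
    c = conv-elim ω k h
    known : Conv P k
    known x y e with split t x | split t y
    ... | inj₂ (q , refl) | _ rewrite !-beyond P {t ℕ.+ q} (ℕₚ.m≤m+n t q) = refl
    ... | inj₁ _ | inj₂ (q , refl) rewrite !-beyond P {t ℕ.+ q} (ℕₚ.m≤m+n t q) = hit-oo _
    ... | inj₁ x< | inj₁ y< = subst₂ (λ u v → hit (swap u) v ≡ false) (!-++ˡ P x<) (!-++ˡ P y<) (c x y e)
    disjoint : Avoid M α
    disjoint q with split (suc i) q
    ... | inj₂ (r , refl) = cong (λ z → hit z (α ! q)) (!-beyond M (subst (ℕ._≤ q) (sym (trans (length-revswap Q []) (trans (ℕₚ.+-identityʳ _) ∣Q∣))) (ℕₚ.m≤m+n (suc i) r)))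
    ... | inj₁ (s≤s q≤i) = subst₂ (λ u v → hit u v ≡ false)
        (trans (cong swap (!-++ˡ P (ℕₚ.≤-<-trans (ℕₚ.m∸n≤m i q) (ℕₚ.<-trans i<ℓ ℓ<t)))) (sym (M-! (i ∸ q) q (ℕₚ.m∸n+n≡m q≤i))))
        (ω-high q q≤i)
        (c (i ∸ q) (t ℕ.+ q) (cong suc (trans (lem (i ∸ q) t q) (cong (t ℕ.+_) (ℕₚ.m∸n+n≡m q≤i)))))
      where
      lem : ∀ a t q → a ℕ.+ (t ℕ.+ q) ≡ t ℕ.+ (a ℕ.+ q)
      lem = solve-∀ₙ
  from : conv P k ∧ avoid M α ≡ true → conv ω k ≡ true
  from h = conv-intro ω k all
    where
    c = conv-elim P k (proj₁ (∧-true h))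
    a = avoid-elim M α (proj₂ (∧-true {conv P k} h))
    high : ∀ q y → suc (t ℕ.+ q ℕ.+ y) ≡ k → hit (swap (ω ! y)) (ω ! (t ℕ.+ q)) ≡ false
    high q y e = subst₂ (λ u v → hit u v ≡ false)
      (trans (M-! y q y+q) (cong swap (sym (!-++ˡ P (ℕₚ.≤-<-trans (subst (y ℕ.≤_) y+q (ℕₚ.m≤m+n y q)) (ℕₚ.<-trans i<ℓ ℓ<t))))))
      (sym (ω-high q (subst (q ℕ.≤_) y+q (ℕₚ.m≤n+m q y)))) (a q)
      where
      y+q : y ℕ.+ q ≡ i
      y+q = ℕₚ.+-cancelˡ-≡ t _ _ (trans (lem t y q) (ℕₚ.suc-injective e))
        where
        lem : ∀ t y q → t ℕ.+ (y ℕ.+ q) ≡ t ℕ.+ q ℕ.+ y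
        lem = solve-∀ₙ
    all : Conv ω k
    all x y e with split t x | split t y
    ... | inj₁ x< | inj₁ y< = subst₂ (λ u v → hit (swap u) v ≡ false) (sym (!-++ˡ P x<)) (sym (!-++ˡ P y<)) (c x y e)
    ... | inj₂ (q , refl) | _ = trans (hit-swap (ω ! (t ℕ.+ q)) (ω ! y)) (high q y e)
    ... | inj₁ _ | inj₂ (q , refl) = high q x (trans (cong suc (ℕₚ.+-comm (t ℕ.+ q) x)) e)

-- A sum x + y ≥ 2t - 1 misses the pairs with x < t or y < t exactly when t later digits avoid the prefix;
-- the digits before those only meet each other.
conv-far : ∀ P γ δ ρ → length δ ≡ length P →
  conv (P ++ γ ++ δ ++ ρ) (length P ℕ.+ length P ℕ.+ length γ) ≡ true → conv γ (length γ) ∧ avoid (revswap P []) δ ≡ true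
conv-far P γ δ ρ ∣δ∣ h = cong₂ _∧_ (conv-intro γ i inner) (avoid-intro (revswap P []) δ outer)
  where
  t = length P
  i = length γ
  ω = P ++ γ ++ δ ++ ρ
  c = conv-elim ω (t ℕ.+ t ℕ.+ i) h
  inner : Conv γ i
  inner x y e = subst₂ (λ u v → hit (swap u) v ≡ false) (at x (s≤s (ℕₚ.m≤m+n x y))) (at y (s≤s (ℕₚ.m≤n+m y x)))
    (c (t ℕ.+ x) (t ℕ.+ y) (trans (lem t x y) (cong (t ℕ.+ t ℕ.+_) e)))
    where
    at : ∀ z → z ℕ.< suc (x ℕ.+ y) → ω ! (t ℕ.+ z) ≡ γ ! z
    at z z< = trans (!-++ʳ P z) (!-++ˡ γ (subst (z ℕ.<_) e z<))
    lem : ∀ t x y → suc (t ℕ.+ x ℕ.+ (t ℕ.+ y)) ≡ t ℕ.+ t ℕ.+ suc (x ℕ.+ y)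
    lem = solve-∀ₙ
  outer : Avoid (revswap P []) δ
  outer q with split t q
  ... | inj₂ (r , refl) = cong (λ z → hit z (δ ! q)) (!-beyond (revswap P []) (subst (ℕ._≤ q) (sym (trans (length-revswap P []) (ℕₚ.+-identityʳ _))) (ℕₚ.m≤m+n t r)))
  ... | inj₁ q<t = subst₂ (λ u v → hit u v ≡ false)
      (trans (cong swap (!-++ˡ P x<t)) (sym (revswap-! P [] x q x+q)))
      (trans (!-++ʳ P (i ℕ.+ q)) (trans (!-++ʳ γ q) (!-++ˡ δ (subst (q ℕ.<_) (sym ∣δ∣) q<t))))
      (c x (t ℕ.+ (i ℕ.+ q)) (trans (lem x t i q) (cong (λ z → t ℕ.+ z ℕ.+ i) x+q)))
    where
    x = t ∸ suc q
    x+q : suc (x ℕ.+ q) ≡ t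
    x+q = trans (sym (ℕₚ.+-suc x q)) (ℕₚ.m∸n+n≡m q<t)
    x<t : x ℕ.< t
    x<t = subst (x ℕ.<_) x+q (s≤s (ℕₚ.m≤m+n x q))
    lem : ∀ x t i q → suc (x ℕ.+ (t ℕ.+ (i ℕ.+ q))) ≡ t ℕ.+ suc (x ℕ.+ q) ℕ.+ i
    lem = solve-∀ₙ

-- Expected number of missing sums from 2t - 1 on.

opaque
  unfolding digits
  size-digits : Words.size digits ≡ + 4
  size-digits = refl

sumD-one : ∀ n → sumD n (λ _ → 1ℤ) ≡ (+ 4) ^ n
sumD-one n = trans (sumD-const n 1ℤ) (trans (*-identityʳ _) (cong (_^ n) size-digits))

-- The word is cut into γ, δ, ρ of lengths i, t, r. The necessary conditions from `conv-far` concern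
-- γ and δ separately, so the count is bounded by a product of three factors.
sumD-far : ∀ P i r → let t = length P in
  sumD (i ℕ.+ (t ℕ.+ r)) (λ α → 𝟙 (conv (P ++ α) (t ℕ.+ t ℕ.+ i))) ≤ (+ 3) ^ i * ((+ 2) ^ frees (revswap P []) * (+ 4) ^ r)
sumD-far P i r = begin
  sumD (i ℕ.+ (t ℕ.+ r)) (λ α → 𝟙 (conv (P ++ α) k))
    ≡⟨ trans (sumD-++ i (t ℕ.+ r) _) (sumD-cong i λ γ _ → sumD-++ t r _) ⟩
  sumD i (λ γ → sumD t (λ δ → sumD r (λ ρ → 𝟙 (conv (P ++ γ ++ δ ++ ρ) k))))
    ≤⟨ sumD-mono i (λ γ l → sumD-mono t (λ δ l′ → sumD-mono r (λ ρ _ → bound γ δ ρ l l′))) ⟩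
  sumD i (λ γ → sumD t (λ δ → sumD r (λ ρ → 𝟙 (conv γ i) * 𝟙 (avoid M δ) * 1ℤ)))
    ≡⟨ sumD-cong i (λ γ _ → sumD-cong t λ δ _ → trans (sumD-* r (𝟙 (conv γ i) * 𝟙 (avoid M δ)) (λ _ → 1ℤ)) (cong (𝟙 (conv γ i) * 𝟙 (avoid M δ) *_) (sumD-one r))) ⟩
  sumD i (λ γ → sumD t (λ δ → 𝟙 (conv γ i) * 𝟙 (avoid M δ) * (+ 4) ^ r))
    ≡⟨ sumD-cong i (λ γ _ → trans (sumD-*ʳ t ((+ 4) ^ r) (λ δ → 𝟙 (conv γ i) * 𝟙 (avoid M δ))) (cong (_* (+ 4) ^ r) (sumD-* t (𝟙 (conv γ i)) (λ δ → 𝟙 (avoid M δ))))) ⟩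
  sumD i (λ γ → 𝟙 (conv γ i) * A * (+ 4) ^ r)
    ≡⟨ trans (sumD-*ʳ i ((+ 4) ^ r) (λ γ → 𝟙 (conv γ i) * A)) (cong (_* (+ 4) ^ r) (sumD-*ʳ i A (λ γ → 𝟙 (conv γ i)))) ⟩
  sumD i (λ γ → 𝟙 (conv γ i)) * A * (+ 4) ^ r ≡⟨ *-assoc (sumD i (λ γ → 𝟙 (conv γ i))) A ((+ 4) ^ r) ⟩
  sumD i (λ γ → 𝟙 (conv γ i)) * (A * (+ 4) ^ r) ≡⟨ cong (λ z → sumD i (λ γ → 𝟙 (conv γ i)) * (z * (+ 4) ^ r)) A≡ ⟩
  sumD i (λ γ → 𝟙 (conv γ i)) * F ≤⟨ *-mono (sumD-0≤ i _ λ γ → 0≤𝟙 (conv γ i)) (0≤* (0≤^ 2 (frees M)) (0≤^ 4 r)) (sumD-conv i) ≤-refl ⟩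
  (+ 3) ^ i * F ∎
  where
  open ≤-Reasoning
  t = length P
  k = t ℕ.+ t ℕ.+ i
  M = revswap P []
  A = sumD t (λ δ → 𝟙 (avoid M δ))
  F = (+ 2) ^ frees M * (+ 4) ^ r
  A≡ : A ≡ (+ 2) ^ frees M
  A≡ = trans (cong (λ n → sumD n (λ δ → 𝟙 (avoid M δ))) (sym (trans (length-revswap P []) (ℕₚ.+-identityʳ t)))) (sumD-avoid M)
  bound : ∀ γ δ ρ → length γ ≡ i → length δ ≡ t → 𝟙 (conv (P ++ γ ++ δ ++ ρ) k) ≤ 𝟙 (conv γ i) * 𝟙 (avoid M δ) * 1ℤ
  bound γ δ ρ refl l = ≤-trans (𝟙-mono (conv-far P γ δ ρ l))
    (≤-reflexive (trans (𝟙-∧ (conv γ i) (avoid M δ)) (sym (*-identityʳ _))))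

-- The partial sums of the powers of 3/4, cleared of denominators; 3^n is the remainder.
geometric : ∀ n → sum< (λ i → (+ 3) ^ i * (+ 4) ^ (n ∸ suc i)) n + (+ 3) ^ n ≡ (+ 4) ^ n
geometric zero = refl
geometric (suc n) = begin
  sum< (term (suc n)) n + (+ 3) ^ n * (+ 4) ^ (n ∸ n) + + 3 * (+ 3) ^ n
    ≡⟨ cong (λ z → sum< (term (suc n)) n + (+ 3) ^ n * (+ 4) ^ z + + 3 * (+ 3) ^ n) (ℕₚ.n∸n≡0 n) ⟩
  sum< (term (suc n)) n + (+ 3) ^ n * + 1 + + 3 * (+ 3) ^ n
    ≡⟨ cong (λ z → z + (+ 3) ^ n * + 1 + + 3 * (+ 3) ^ n) (scale n ℕₚ.≤-refl) ⟩
  + 4 * sum< (term n) n + (+ 3) ^ n * + 1 + + 3 * (+ 3) ^ n ≡⟨ lem (sum< (term n) n) ((+ 3) ^ n) ⟩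
  + 4 * (sum< (term n) n + (+ 3) ^ n) ≡⟨ cong (+ 4 *_) (geometric n) ⟩
  + 4 * (+ 4) ^ n ∎
  where
  open ≡-Reasoning
  term : ℕ → ℕ → ℤ
  term n i = (+ 3) ^ i * (+ 4) ^ (n ∸ suc i)
  lem : ∀ s x → + 4 * s + x * + 1 + + 3 * x ≡ + 4 * (s + x)
  lem = solve-∀
  lem₂ : ∀ s x y → + 4 * s + x * (+ 4 * y) ≡ + 4 * (s + x * y)
  lem₂ = solve-∀
  scale : ∀ m → m ℕ.≤ n → sum< (term (suc n)) m ≡ + 4 * sum< (term n) m
  scale zero _ = refl
  scale (suc m) m<n = trans (cong₂ _+_ (scale m (ℕₚ.<⇒≤ m<n)) (cong (λ z → (+ 3) ^ m * (+ 4) ^ z) (ℕₚ.+-∸-assoc 1 m<n)))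
    (lem₂ (sum< (term n) m) ((+ 3) ^ m) ((+ 4) ^ (n ∸ suc m)))

union-zeros : ∀ M {X : Set} (xs : List X) → length M ≡ length xs → union M (zeros xs) ≡ M
union-zeros [] [] e = refl
union-zeros (m ∷ M) (x ∷ xs) e = cong₂ _∷_ (join-oo m) (union-zeros M xs (ℕₚ.suc-injective e))
  where
  join-oo : ∀ d → join d oo ≡ d
  join-oo oo = refl
  join-oo oi = refl
  join-oo io = refl
  join-oo ii = refl

frees-zeros : ∀ {X : Set} (xs : List X) → frees (zeros xs) ≡ length xs ℕ.* 2
frees-zeros [] = refl
frees-zeros (x ∷ xs) = cong (2 ℕ.+_) (frees-zeros xs)

2^frees-zeros : ∀ {X : Set} (xs : List X) → (+ 2) ^ frees (zeros xs) ≡ (+ 4) ^ length xs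
2^frees-zeros [] = refl
2^frees-zeros (x ∷ xs) = trans (cong (λ z → + 2 * (+ 2 * z)) (2^frees-zeros xs)) (lem ((+ 4) ^ length xs))
  where
  lem : ∀ x → + 2 * (+ 2 * x) ≡ + 4 * x
  lem = solve-∀

avoid-zeros : ∀ {X : Set} (xs : List X) α → avoid (zeros xs) α ≡ true
avoid-zeros [] α = refl
avoid-zeros (x ∷ xs) [] = refl
avoid-zeros (x ∷ xs) (d ∷ α) = avoid-zeros xs α

-- The two bounds at a leaf.

module Leaf (P : List Digit) (C : List Bool) (ws : List ℕ) (∣C∣ : suc (length C) ≡ length P) (covers : Covers P C)
            (halving : Halving (length P ℕ.* 2) ws) (r k : ℕ) where
  ℓ t : ℕ
  ℓ = length C
  t = length P
  Ms : List (List Digit)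
  Ms = masks P C [] []
  u e : ℕ
  u = length Ms
  e = hd (halves (revswap P []) (zeros P) ws)
  w N4 : ℤ
  w = + hd ws
  N4 = (+ 4) ^ (ℓ ℕ.+ r)

  far : List Digit → ℕ
  far α = count< (λ i → conv (P ++ α) (suc (t ℕ.+ (ℓ ℕ.+ i)))) r

  missing-split : ∀ α γ → length α ≡ ℓ → missing P (ℓ ℕ.+ r) (α ++ γ) ≡ avoided Ms α ℕ.+ far (α ++ γ)
  missing-split α γ refl′ = trans (count<-+ _ ℓ r) (cong (ℕ._+ far (α ++ γ)) near)
    where
    near : count< (λ i → conv (P ++ α ++ γ) (suc (t ℕ.+ i))) ℓ ≡ avoided Ms α
    near = sym (trans (masks-spec P C [] [] α (ℕₚ.≤-trans (ℕₚ.n≤1+n ℓ) (ℕₚ.≤-reflexive ∣C∣)))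
      (trans (ℕₚ.+-identityʳ _) (count<-cong ℓ λ i i<ℓ → sym (trans
        (conv-near P α γ i (subst (i ℕ.<_) (sym refl′) i<ℓ) (subst (ℕ._< t) (sym refl′) (ℕₚ.≤-reflexive ∣C∣)))
        (cong (_∧ avoid (revswap (take (suc i) P) []) α) (sym (trans (cong not (covers i)) (not-not _))))))))
      where
      not-not : ∀ b → not (not b) ≡ b
      not-not false = refl
      not-not true = refl

  near-sum : w * sumD (ℓ ℕ.+ r) (λ α → f k (avoided Ms (take ℓ α))) ≡ N4 * newton (moments Ms (zeros C) ws) (f k)
  near-sum = begin
    w * sumD (ℓ ℕ.+ r) (λ α → f k (avoided Ms (take ℓ α)))
      ≡⟨ cong (w *_) (trans (sumD-++ ℓ r _) (sumD-cong ℓ λ α l → trans (sumD-cong r λ γ _ → cong (λ z → f k (avoided Ms z)) (take-all α γ l))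
           (trans (sumD-const r (f k (avoided Ms α))) (cong (λ z → z ^ r * f k (avoided Ms α)) size-digits)))) ⟩
    w * sumD ℓ (λ α → (+ 4) ^ r * f k (avoided Ms α)) ≡⟨ cong (w *_) (sumD-* ℓ ((+ 4) ^ r) _) ⟩
    w * ((+ 4) ^ r * S)        ≡⟨ lem w ((+ 4) ^ r) S ⟩
    (+ 4) ^ r * (w * S)        ≡⟨ cong ((+ 4) ^ r *_) (sym spec) ⟩
    (+ 4) ^ r * (n * (+ 4) ^ ℓ) ≡⟨ lem₂ ((+ 4) ^ r) n ((+ 4) ^ ℓ) ⟩
    (+ 4) ^ ℓ * (+ 4) ^ r * n  ≡⟨ cong (_* n) (sym (^-+ (+ 4) ℓ r)) ⟩
    N4 * n                     ∎
    where
    open ≡-Reasoning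
    S = sumD ℓ (λ α → f k (avoided Ms α))
    n = newton (moments Ms (zeros C) ws) (f k)
    take-all : ∀ α γ {ℓ} → length α ≡ ℓ → take ℓ (α ++ γ) ≡ α
    take-all [] γ refl = refl
    take-all (d ∷ α) γ refl = cong (d ∷_) (take-all α γ refl)
    lem : ∀ a b c → a * (b * c) ≡ b * (a * c)
    lem = solve-∀
    lem₂ : ∀ a b c → a * (b * c) ≡ c * a * b
    lem₂ = solve-∀
    half : Halving (frees (zeros C)) ws
    half = Halving-≤ (frees (zeros C)) 2 ws (subst (λ z → Halving z ws)
      (trans (cong (ℕ._* 2) (sym ∣C∣)) (trans (ℕₚ.+-comm 2 (ℓ ℕ.* 2)) (cong (ℕ._+ 2) (sym (frees-zeros C))))) halving)
    spec : n * (+ 4) ^ ℓ ≡ w * S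
    spec = trans (cong (n *_) (sym (2^frees-zeros C))) (trans (moments-spec Ms (zeros C) ws (f k) half)
      (cong (w *_) (trans (cong (λ m → sumD m (λ α → 𝟙 (avoid (zeros C) α) * f k (avoided Ms α))) (length-map (λ _ → oo) C))
        (sumD-cong ℓ λ α _ → trans (cong (λ b → 𝟙 b * f k (avoided Ms α)) (avoid-zeros C α)) (*-identityˡ _)))))

  far-sum : w * sumD (ℓ ℕ.+ r) (λ α → + far α) ≤ N4 * + (4 ℕ.* e)
  far-sum = begin
    w * sumD (ℓ ℕ.+ r) (λ α → + far α)
      ≡⟨ cong (w *_) (trans (sumD-cong (ℓ ℕ.+ r) λ α _ → +count< _ r) (sumW-sum< digits (ℓ ℕ.+ r) r _)) ⟩
    w * sum< (λ i → sumD (ℓ ℕ.+ r) (λ α → 𝟙 (conv (P ++ α) (suc (t ℕ.+ (ℓ ℕ.+ i)))))) r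
      ≤⟨ *-monoˡ w 0≤+ (sum<-mono r term) ⟩
    w * sum< (λ i → F * ((+ 3) ^ i * (+ 4) ^ (r ∸ suc i))) r
      ≡⟨ cong (w *_) (sum<-* F (λ i → (+ 3) ^ i * (+ 4) ^ (r ∸ suc i)) r) ⟩
    w * (F * sum< (λ i → (+ 3) ^ i * (+ 4) ^ (r ∸ suc i)) r)
      ≤⟨ *-monoˡ w 0≤+ (*-monoˡ F (0≤^ 2 (frees M)) (≤-by ((+ 3) ^ r) (0≤^ 3 r) (sym (geometric r)))) ⟩
    w * (F * (+ 4) ^ r)           ≡⟨ sym (*-assoc w F _) ⟩
    w * F * (+ 4) ^ r             ≡⟨ cong (_* (+ 4) ^ r) weight ⟩
    + e * (+ 4) ^ t * (+ 4) ^ r   ≡⟨ cong (λ z → + e * (+ 4) ^ z * (+ 4) ^ r) (sym ∣C∣) ⟩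
    + e * (+ 4 * (+ 4) ^ ℓ) * (+ 4) ^ r ≡⟨ lem (+ e) ((+ 4) ^ ℓ) ((+ 4) ^ r) ⟩
    (+ 4) ^ ℓ * (+ 4) ^ r * (+ 4 * + e) ≡⟨ cong₂ _*_ (sym (^-+ (+ 4) ℓ r)) (sym (pos-* 4 e)) ⟩
    N4 * + (4 ℕ.* e)              ∎
    where
    open ≤-Reasoning
    M = revswap P []
    F = (+ 2) ^ frees M
    ∣M∣ : length M ≡ t
    ∣M∣ = trans (length-revswap P []) (ℕₚ.+-identityʳ t)
    lem : ∀ e x y → e * (+ 4 * x) * y ≡ x * y * (+ 4 * e)
    lem = solve-∀
    weight : w * F ≡ + e * (+ 4) ^ t
    weight = trans (cong (λ Z → w * (+ 2) ^ frees Z) (sym (union-zeros M P ∣M∣)))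
      (trans (proj₂ (halves-spec M (zeros P) ws (subst (λ z → Halving z ws) (sym (frees-zeros P)) halving)))
        (cong (+ e *_) (2^frees-zeros P)))
    index : ∀ i → suc (t ℕ.+ (ℓ ℕ.+ i)) ≡ t ℕ.+ t ℕ.+ i
    index i = trans (lem₃ t ℓ i) (cong (λ z → t ℕ.+ z ℕ.+ i) ∣C∣)
      where
      lem₃ : ∀ t ℓ i → suc (t ℕ.+ (ℓ ℕ.+ i)) ≡ t ℕ.+ suc ℓ ℕ.+ i
      lem₃ = solve-∀ₙ
    total : ∀ i → i ℕ.< r → ℓ ℕ.+ r ≡ i ℕ.+ (t ℕ.+ (r ∸ suc i))
    total i i<r = trans (cong (ℓ ℕ.+_) (sym (ℕₚ.m+[n∸m]≡n i<r))) (trans (lem₄ ℓ i (r ∸ suc i)) (cong (λ z → i ℕ.+ (z ℕ.+ (r ∸ suc i))) ∣C∣))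
      where
      lem₄ : ∀ ℓ i s → ℓ ℕ.+ (suc i ℕ.+ s) ≡ i ℕ.+ (suc ℓ ℕ.+ s)
      lem₄ = solve-∀ₙ
    lem₅ : ∀ a b c → a * (b * c) ≡ b * (a * c)
    lem₅ = solve-∀
    term : ∀ i → i ℕ.< r → sumD (ℓ ℕ.+ r) (λ α → 𝟙 (conv (P ++ α) (suc (t ℕ.+ (ℓ ℕ.+ i))))) ≤ F * ((+ 3) ^ i * (+ 4) ^ (r ∸ suc i))
    term i i<r = ≤-trans (≤-reflexive (cong₂ (λ n m → sumD n (λ α → 𝟙 (conv (P ++ α) m))) (total i i<r) (index i)))
      (≤-trans (sumD-far P i (r ∸ suc i)) (≤-reflexive (lem₅ ((+ 3) ^ i) F ((+ 4) ^ (r ∸ suc i)))))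

  expectation : ℤ
  expectation = w * sumD (ℓ ℕ.+ r) (λ α → f k (missing P (ℓ ℕ.+ r) α))

  near+far : ∀ α → length α ≡ ℓ ℕ.+ r → missing P (ℓ ℕ.+ r) α ≡ avoided Ms (take ℓ α) ℕ.+ far α
  near+far α l = trans (cong (missing P (ℓ ℕ.+ r)) (sym (take++drop≡id ℓ α)))
    (trans (missing-split (take ℓ α) (drop ℓ α) (length-take-≤ ℓ α (ℕₚ.≤-trans (ℕₚ.m≤m+n ℓ r) (ℕₚ.≤-reflexive (sym l)))))
      (cong (λ z → avoided Ms (take ℓ α) ℕ.+ far z) (take++drop≡id ℓ α)))

  linear : ∀ s → w * sumD (ℓ ℕ.+ r) (λ α → f k (avoided Ms (take ℓ α)) + + far α * s)
    ≡ N4 * newton (moments Ms (zeros C) ws) (f k) + w * sumD (ℓ ℕ.+ r) (λ α → + far α) * s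
  linear s = trans (cong (w *_) (trans (sumD-+ (ℓ ℕ.+ r) _ _) (cong (λ z → sumD (ℓ ℕ.+ r) (λ α → f k (avoided Ms (take ℓ α))) + z) (sumD-*ʳ (ℓ ℕ.+ r) s (λ α → + far α)))))
    (trans (lem w _ (sumD (ℓ ℕ.+ r) (λ α → + far α)) s) (cong (_+ w * sumD (ℓ ℕ.+ r) (λ α → + far α) * s) near-sum))
    where
    lem : ∀ w a b s → w * (a + b * s) ≡ w * a + w * b * s
    lem = solve-∀

  leaf-value : ∀ φ → N4 * value φ k (leafAt P C ws ∷ []) ≡ N4 * newton (moments Ms (zeros C) ws) (f k) + N4 * + (4 ℕ.* e) * φ k u
  leaf-value φ = trans (cong (λ z → N4 * (newton (moments Ms (zeros C) ws) (f k) + z + 0ℤ)) (weigh-errorRow u (4 ℕ.* e) (φ k)))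
    (lem N4 _ (+ (4 ℕ.* e)) (φ k u))
    where
    lem : ∀ n a b c → n * (a + b * c + 0ℤ) ≡ n * a + n * b * c
    lem = solve-∀

  -- The number u of masks bounds the exact part of the count, so `f-slope` applies to every word.
  -- The resulting inequality is linear in the far part, and only its mean is needed; as the slope
  -- is not positive, the upper bound `far-sum` acts in the right direction.
  lower : N4 * value slope k (leafAt P C ws ∷ []) ≤ expectation
  lower = begin
    N4 * value slope k (leafAt P C ws ∷ []) ≡⟨ leaf-value slope ⟩
    X + N4 * + (4 ℕ.* e) * slope k u
      ≤⟨ +-monoʳ-≤ X (*-monoʳ-≤-nonPos (slope k u) {{nonPositive (slope≤0 k u)}} far-sum) ⟩
    X + w * sumD (ℓ ℕ.+ r) (λ α → + far α) * slope k u ≡⟨ sym (linear (slope k u)) ⟩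
    w * sumD (ℓ ℕ.+ r) (λ α → f k (avoided Ms (take ℓ α)) + + far α * slope k u)
      ≤⟨ *-monoˡ w 0≤+ (sumD-mono (ℓ ℕ.+ r) λ α l → ≤-trans (f-slope k u _ (far α) (avoided-≤ Ms (take ℓ α)))
           (≤-reflexive (cong (f k) (sym (near+far α l))))) ⟩
    expectation ∎
    where
    open ≤-Reasoning
    X = N4 * newton (moments Ms (zeros C) ws) (f k)

  upper : expectation ≤ N4 * value rise k (leafAt P C ws ∷ [])
  upper = begin
    expectation
      ≤⟨ *-monoˡ w 0≤+ (sumD-mono (ℓ ℕ.+ r) λ α l → ≤-trans (≤-reflexive (cong (f k) (near+far α l))) (f-rise k u (avoided Ms (take ℓ α)) (far α))) ⟩
    w * sumD (ℓ ℕ.+ r) (λ α → f k (avoided Ms (take ℓ α)) + + far α * rise k u) ≡⟨ linear (rise k u) ⟩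
    X + w * sumD (ℓ ℕ.+ r) (λ α → + far α) * rise k u
      ≤⟨ +-monoʳ-≤ X (*-monoʳ-≤-nonNeg (rise k u) {{nonNegative (0≤rise k u)}} far-sum) ⟩
    X + N4 * + (4 ℕ.* e) * rise k u ≡⟨ sym (leaf-value rise) ⟩
    N4 * value rise k (leafAt P C ws ∷ []) ∎
    where
    open ≤-Reasoning
    X = N4 * newton (moments Ms (zeros C) ws) (f k)

-- Induction over the search tree.

-- Divided by w · 4^L, the values of the rows enclose the mean of `f k` over L uniform digits after
-- P. The rows depend neither on L nor on k, so the window may be long and x arbitrary.
record Bounds (P : List Digit) (w L k : ℕ) (rs : List Row) : Set where
  field
    lower : (+ 4) ^ L * value slope k rs ≤ + w * sumD L (λ α → f k (missing P L α))
    upper : + w * sumD L (λ α → f k (missing P L α)) ≤ (+ 4) ^ L * value rise k rs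

open Bounds

leaf-bounds : ∀ P C ws L k → suc (length C) ≡ length P → Covers P C → Halving (length P ℕ.* 2) ws → length C ℕ.≤ L →
  Bounds P (hd ws) L k (leafAt P C ws ∷ [])
leaf-bounds P C ws L k e c h l rewrite sym (ℕₚ.m+[n∸m]≡n l) =
  record { lower = Leaf.lower P C ws e c h (L ∸ length C) k ; upper = Leaf.upper P C ws e c h (L ∸ length C) k }

missing-∷ : ∀ P L d α → missing P (suc L) (d ∷ α)
  ≡ (if conv (P ++ d ∷ []) (suc (length P)) then 1 else 0) ℕ.+ missing (P ++ d ∷ []) L α
missing-∷ P L d α = cong₂ (λ b n → (if b then 1 else 0) ℕ.+ n) now later
  where
  P′ = P ++ d ∷ []
  assoc : P ++ d ∷ α ≡ P′ ++ α
  assoc = sym (++-assoc P (d ∷ []) α)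
  now : conv (P ++ d ∷ α) (suc (length P ℕ.+ 0)) ≡ conv P′ (suc (length P))
  now = trans (cong₂ (λ ω k → conv ω (suc k)) assoc (ℕₚ.+-identityʳ (length P)))
    (conv-cong (P′ ++ α) P′ (suc (length P)) λ x x< → !-++ˡ P′ (subst (x ℕ.<_) (sym (length-∷ʳ P d)) x<))
  later : count< (λ i → conv (P ++ d ∷ α) (suc (length P ℕ.+ suc i))) L ≡ missing P′ L α
  later = count<-cong L λ i _ → cong₂ (λ ω k → conv ω (suc k)) assoc
    (trans (ℕₚ.+-suc (length P) i) (cong (ℕ._+ i) (sym (length-∷ʳ P d))))

-- The branches cut off by `cap` contribute exactly 0, so pruning costs no accuracy.
empty-value : ∀ P w L k → k ℕ.≤ 1 → (+ 4) ^ L * 0ℤ ≡ + w * sumD L (λ α → f k (suc (missing P L α)))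
empty-value P w L k k≤1 = trans (*-zeroʳ ((+ 4) ^ L)) (sym (trans (cong (+ w *_)
  (trans (sumD-cong L λ α _ → zero-f k (missing P L α) k≤1) (sumD-zero L))) (*-zeroʳ (+ w))))
  where
  zero-f : ∀ k j → k ℕ.≤ 1 → f k (suc j) ≡ 0ℤ
  zero-f zero j _ = refl
  zero-f (suc zero) j _ rewrite ℕₚ.0∸n≡0 j = refl
  zero-f (suc (suc k)) j (s≤s ())

first-flag : ∀ P c C → (∀ i → (c ∷ C) ‼ i ≡ not (conv P (length P ℕ.+ i))) → conv P (length P) ≡ not c
first-flag P c C h rewrite h 0 | ℕₚ.+-identityʳ (length P) with conv P (length P)
... | true = refl
... | false = refl

-- The quantity `length P` + 2n falls by one with each digit, since the prefix grows while the fuel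
-- shrinks. It tracks L, which also falls by one, and its double tracks the halvings, of which every
-- digit uses two. At a leaf enough remains for two bits in each of `length P` later digits.
search-bounds : ∀ n cap b P C ws L k → k ℕ.≤ cap → suc (length C) ≡ length P → Covers P C →
  Halving ((length P ℕ.+ n ℕ.* 2) ℕ.* 2) ws → length P ℕ.+ n ℕ.* 2 ℕ.≤ suc L →
  Bounds P (hd ws) L k (search n cap b P C ws)

branch-bounds : ∀ n cap b P C ws L k → k ℕ.≤ cap → suc (length C) ≡ length P → Covers P C →
  Halving ((suc (length P) ℕ.+ n ℕ.* 2) ℕ.* 2) (tl (tl ws)) → hd ws ≡ 4 ℕ.* hd (tl (tl ws)) → suc (length P) ℕ.+ n ℕ.* 2 ℕ.≤ suc L →
  Bounds P (hd ws) (suc L) k (branch n cap b P C (tl (tl ws)))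

-- The head of C concerns the sum `length P` - 1, which no later digit can realise. If it is
-- missing, the count has a successor; `f-shift` trades this for a smaller k, just as prepending an
-- empty row does.
settle-bounds : ∀ n cap b P C ws L k → k ℕ.≤ cap → length C ≡ length P → 1 ℕ.≤ length P →
  (∀ i → C ‼ i ≡ not (conv P (length P ℕ.+ i))) →
  Halving ((length P ℕ.+ n ℕ.* 2) ℕ.* 2) ws → length P ℕ.+ n ℕ.* 2 ℕ.≤ suc L →
  let S = + hd ws * sumD L (λ α → f k ((if conv P (length P) then 1 else 0) ℕ.+ missing P L α)) in
  (+ 4) ^ L * value slope k (settle n cap b P C ws) ≤ S × S ≤ (+ 4) ^ L * value rise k (settle n cap b P C ws)

search-bounds zero cap b P C ws L k _ e c h l = leaf-bounds P C ws L k e c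
  (subst (λ z → Halving (z ℕ.* 2) ws) (ℕₚ.+-identityʳ (length P)) h)
  (ℕ.s≤s⁻¹ (subst (ℕ._≤ suc L) (trans (ℕₚ.+-identityʳ (length P)) (sym e)) l))
search-bounds (suc n) cap b P C ws L k k≤ e c h l with stop b C
... | true = leaf-bounds P C ws L k e c
      (Halving-≤ (length P ℕ.* 2) (suc n ℕ.* 2 ℕ.* 2) ws (subst (λ z → Halving z ws) (ℕₚ.*-distribʳ-+ 2 (length P) (suc n ℕ.* 2)) h))
      (ℕ.s≤s⁻¹ (subst (ℕ._≤ suc L) (sym e) (ℕₚ.≤-trans (ℕₚ.m≤m+n (length P) _) l)))
search-bounds (suc n) cap b P C ws zero k k≤ e c h l | false = contradiction l (λ { l → ℕₚ.<⇒≱ (ℕₚ.≤-trans (ℕₚ.m≤n+m 2 (n ℕ.* 2)) (ℕₚ.≤-trans (ℕₚ.≤-reflexive (ℕₚ.+-comm (n ℕ.* 2) 2)) (ℕₚ.m≤n+m _ (length P)))) l })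
search-bounds (suc n) cap b P C ws (suc L) k k≤ e c h l | false with subst (λ z → Halving z ws) (exponent (length P) n) h
  where
  exponent : ∀ t n → (t ℕ.+ suc n ℕ.* 2) ℕ.* 2 ≡ 2 ℕ.+ (suc t ℕ.+ n ℕ.* 2) ℕ.* 2
  exponent = solve-∀ₙ
... | e₁ , e₂ , h′ = branch-bounds n cap b P C ws L k k≤ e c h′
      (trans e₁ (trans (cong (2 ℕ.*_) e₂) (lem (hd (tl (tl ws))))))
      (ℕ.s≤s⁻¹ (subst (ℕ._≤ suc (suc L)) (lem₂ (length P) n) l))
  where
  lem : ∀ x → 2 ℕ.* (2 ℕ.* x) ≡ 4 ℕ.* x
  lem = solve-∀ₙ
  lem₂ : ∀ t n → t ℕ.+ suc n ℕ.* 2 ≡ suc (suc t ℕ.+ n ℕ.* 2)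
  lem₂ = solve-∀ₙ

branch-bounds n cap b P C ws L k k≤ e c h w≡ l = record
  { lower = begin
      + 4 * X * value slope k (branch n cap b P C (tl (tl ws)))
        ≡⟨ cong (+ 4 * X *_) (add slope) ⟩
      + 4 * X * (V slope oo + (V slope oi + (V slope io + V slope ii)))
        ≡⟨ lem X (V slope oo) (V slope oi) (V slope io) (V slope ii) ⟩
      + 4 * (X * V slope oo + (X * V slope oi + (X * V slope io + (X * V slope ii + 0ℤ))))
        ≤⟨ *-monoˡ (+ 4) 0≤+ (+-mono-≤ (proj₁ (child oo)) (+-mono-≤ (proj₁ (child oi)) (+-mono-≤ (proj₁ (child io)) (+-monoˡ-≤ 0ℤ (proj₁ (child ii)))))) ⟩
      + 4 * (S oo + (S oi + (S io + (S ii + 0ℤ)))) ≡⟨ total ⟩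
      + hd ws * sumD (suc L) (λ α → f k (missing P (suc L) α)) ∎
  ; upper = begin
      + hd ws * sumD (suc L) (λ α → f k (missing P (suc L) α)) ≡⟨ sym total ⟩
      + 4 * (S oo + (S oi + (S io + (S ii + 0ℤ))))
        ≤⟨ *-monoˡ (+ 4) 0≤+ (+-mono-≤ (proj₂ (child oo)) (+-mono-≤ (proj₂ (child oi)) (+-mono-≤ (proj₂ (child io)) (+-monoˡ-≤ 0ℤ (proj₂ (child ii)))))) ⟩
      + 4 * (X * V rise oo + (X * V rise oi + (X * V rise io + (X * V rise ii + 0ℤ))))
        ≡⟨ sym (lem X (V rise oo) (V rise oi) (V rise io) (V rise ii)) ⟩
      + 4 * X * (V rise oo + (V rise oi + (V rise io + V rise ii))) ≡⟨ cong (+ 4 * X *_) (sym (add rise)) ⟩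
      + 4 * X * value rise k (branch n cap b P C (tl (tl ws))) ∎
  }
  where
  open ≤-Reasoning
  ws′ = tl (tl ws)
  X = (+ 4) ^ L
  V : (ℕ → ℕ → ℤ) → Digit → ℤ
  V φ d = value φ k (extend n cap b P C ws′ d)
  S : Digit → ℤ
  S d = + hd ws′ * sumD L (λ α → f k (missing P (suc L) (d ∷ α)))
  lem : ∀ x a b c d → + 4 * x * (a + (b + (c + d))) ≡ + 4 * (x * a + (x * b + (x * c + (x * d + 0ℤ))))
  lem = solve-∀
  add : ∀ φ → value φ k (branch n cap b P C ws′) ≡ V φ oo + (V φ oi + (V φ io + V φ ii))
  add φ = trans (value-addRows φ k (extend n cap b P C ws′ oo) _) (cong (λ z → V φ oo + z)
    (trans (value-addRows φ k (extend n cap b P C ws′ oi) _) (cong (λ z → V φ oi + z)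
      (value-addRows φ k (extend n cap b P C ws′ io) _))))
  total : + 4 * (S oo + (S oi + (S io + (S ii + 0ℤ)))) ≡ + hd ws * sumD (suc L) (λ α → f k (missing P (suc L) α))
  total = trans (cong (+ 4 *_) (trans (sym (sumL-digits S)) (sumL-* digits (+ hd ws′) _)))
    (trans (sym (*-assoc (+ 4) (+ hd ws′) (sumD (suc L) (λ α → f k (missing P (suc L) α)))))
      (cong (_* sumD (suc L) (λ α → f k (missing P (suc L) α))) (trans (sym (pos-* 4 (hd ws′))) (cong +_ (sym w≡)))))
  child : ∀ d → X * V slope d ≤ S d × S d ≤ X * V rise d
  child d = subst (λ s → X * V slope d ≤ s × s ≤ X * V rise d)
    (cong (+ hd ws′ *_) (sumD-cong L λ α _ → cong (f k)
      (trans (cong (λ m → (if conv P′ m then 1 else 0) ℕ.+ missing P′ L α) (length-∷ʳ P d)) (sym (missing-∷ P L d α)))))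
    (settle-bounds n cap (b ∸ cost d) P′ (cover (swap d) P′ C) ws′ L k k≤ (length-cover (swap d) P′ C)
      (subst (1 ℕ.≤_) (sym (length-∷ʳ P d)) (s≤s z≤n))
      (λ i → trans (cover-spec P C d (ℕₚ.≤-trans (ℕₚ.n≤1+n _) (ℕₚ.≤-reflexive e)) c i) (cong (λ m → not (conv P′ (m ℕ.+ i))) (sym (length-∷ʳ P d))))
      (subst (λ m → Halving ((m ℕ.+ n ℕ.* 2) ℕ.* 2) ws′) (sym (length-∷ʳ P d)) h)
      (subst (λ m → m ℕ.+ n ℕ.* 2 ℕ.≤ suc L) (sym (length-∷ʳ P d)) l))
    where P′ = P ++ d ∷ []

settle-bounds n cap b [] [] ws L k k≤ e () c h l
settle-bounds n cap b P (true ∷ C) ws L k k≤ e t≥1 c h l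
  rewrite first-flag P true C c = lower ih , upper ih
  where
  ih = search-bounds n cap b P C ws L k k≤ e
    (λ i → trans (c (suc i)) (cong (λ m → not (conv P m)) (ℕₚ.+-suc (length P) i))) h l
settle-bounds n cap b P (false ∷ C) ws L k k≤ e t≥1 c h l rewrite first-flag P false C c = go cap k k≤
  where
  S : ℕ → ℤ
  S k = + hd ws * sumD L (λ α → f k (suc (missing P L α)))
  go : ∀ cap k → k ℕ.≤ cap →
    (+ 4) ^ L * value slope k (settle n cap b P (false ∷ C) ws) ≤ S k ×
    S k ≤ (+ 4) ^ L * value rise k (settle n cap b P (false ∷ C) ws)
  go zero k k≤ = ≤-reflexive z , ≤-reflexive (sym z)
    where z = empty-value P (hd ws) L k (ℕₚ.m≤n⇒m≤1+n k≤)
  go (suc zero) k k≤ = ≤-reflexive z , ≤-reflexive (sym z)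
    where z = empty-value P (hd ws) L k k≤
  go (suc (suc cap)) k k≤
    rewrite sumD-cong L {λ α → f k (suc (missing P L α))} {λ α → f (k ∸ 1) (missing P L α)} (λ α _ → f-shift k (missing P L α))
          | +-identityˡ (value slope (k ∸ 1) (search n (suc cap) b P C ws))
          | +-identityˡ (value rise (k ∸ 1) (search n (suc cap) b P C ws)) = lower ih , upper ih
    where
    ih = search-bounds n (suc cap) b P C ws L (k ∸ 1) (ℕₚ.∸-monoˡ-≤ 1 k≤) e
      (λ i → trans (c (suc i)) (cong (λ m → not (conv P m)) (ℕₚ.+-suc (length P) i))) h l

-- Uniform bit words and the probability that a difference is missing.

opaque
  bits : List Bool
  bits = false ∷ true ∷ []

open Words bits using () renaming
  (sumW to sumB; sumW-cong to sumB-cong; sumW-mono to sumB-mono; sumW-+ to sumB-+; sumW-* to sumB-*;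
   sumW-*ʳ to sumB-*ʳ; sumW-const to sumB-const; sumW-zero to sumB-zero; sumW-0≤ to sumB-0≤; sumW-++ to sumB-++;
   sumW-∷ʳ to sumB-∷ʳ; sumW-sumL to sumB-sumL) public

opaque
  unfolding bits
  sumL-bits : ∀ φ → sumL bits φ ≡ φ false + (φ true + 0ℤ)
  sumL-bits φ = refl

  sumL-bits-digits : ∀ (F : Bool → Bool → ℤ) → sumL bits (λ a → sumL bits (λ b → F a b)) ≡ sumL digits (λ d → F (left d) (right d))
  sumL-bits-digits F = trans (lem (F false false) (F false true) (F true false) (F true true))
    (sym (sumL-digits (λ d → F (left d) (right d))))
    where
    lem : ∀ a b c d → a + (b + 0ℤ) + (c + (d + 0ℤ) + 0ℤ) ≡ a + (b + (c + (d + 0ℤ)))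
    lem = solve-∀

  size-bits : Words.size bits ≡ + 2
  size-bits = refl

sumB-one : ∀ n → sumB n (λ _ → 1ℤ) ≡ (+ 2) ^ n
sumB-one n = trans (sumB-const n 1ℤ) (trans (*-identityʳ _) (cong (_^ n) size-bits))

‼-++ˡ : ∀ u {v x} → x ℕ.< length u → (u ++ v) ‼ x ≡ u ‼ x
‼-++ˡ (p ∷ u) {x = zero} _ = refl
‼-++ˡ (p ∷ u) {x = suc x} (s≤s x<) = ‼-++ˡ u x<

‼-++ʳ : ∀ u {v} x → (u ++ v) ‼ (length u ℕ.+ x) ≡ v ‼ x
‼-++ʳ [] x = refl
‼-++ʳ (p ∷ u) x = ‼-++ʳ u x

-- The difference d does not occur in the set with characteristic word s.
Gap : ℕ → List Bool → Set
Gap d s = ∀ x → s ‼ x ∧ s ‼ (d ℕ.+ x) ≡ false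

opaque
  gap : ℕ → List Bool → Bool
  gap d s = all< (λ x → not (s ‼ x ∧ s ‼ (d ℕ.+ x))) (length s)

  gap-elim : ∀ d s → gap d s ≡ true → Gap d s
  gap-elim d s h x with split (length s) x
  ... | inj₁ x< = not-true (all<-elim (λ x → not (s ‼ x ∧ s ‼ (d ℕ.+ x))) (length s) h x x<)
  ... | inj₂ (q , refl) rewrite ‼-beyond s {length s ℕ.+ q} (ℕₚ.m≤m+n _ q) = refl

  gap-intro : ∀ d s → Gap d s → gap d s ≡ true
  gap-intro d s h = all<-intro _ (length s) λ x _ → cong not (h x)

gaps : List Bool → ℕ
gaps s = count< (λ i → gap (suc i) s) (length s ∸ 1)

apart : List Bool → List Bool → Bool
apart (x ∷ u) (y ∷ v) = not (x ∧ y) ∧ apart u v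
apart _ _ = true

apart-intro : ∀ u v → (∀ x → x ℕ.< length u → u ‼ x ∧ v ‼ x ≡ false) → apart u v ≡ true
apart-intro [] v h = refl
apart-intro (x ∷ u) [] h = refl
apart-intro (x ∷ u) (y ∷ v) h rewrite h 0 (s≤s z≤n) = apart-intro u v λ x x< → h (suc x) (s≤s x<)

sumB-apart : ∀ j → sumB j (λ u → sumB j (λ v → 𝟙 (apart u v))) ≡ (+ 3) ^ j
sumB-apart zero = refl
sumB-apart (suc j) = begin
  sumL bits (λ a → sumB j (λ u → sumL bits (λ b → sumB j (λ v → 𝟙 (not (a ∧ b) ∧ apart u v)))))
    ≡⟨ sumL-cong bits (λ a → trans (sumB-sumL j bits (λ b u → sumB j (λ v → 𝟙 (not (a ∧ b) ∧ apart u v))))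
         (sumL-cong bits λ b → inner a b)) ⟩
  sumL bits (λ a → sumL bits (λ b → T * 𝟙 (not (a ∧ b))))
    ≡⟨ trans (sumL-cong bits λ a → sumL-* bits T (λ b → 𝟙 (not (a ∧ b)))) (sumL-* bits T _) ⟩
  T * sumL bits (λ a → sumL bits (λ b → 𝟙 (not (a ∧ b)))) ≡⟨ cong₂ _*_ (sumB-apart j) three ⟩
  (+ 3) ^ j * + 3 ≡⟨ *-comm ((+ 3) ^ j) (+ 3) ⟩
  + 3 * (+ 3) ^ j ∎
  where
  open ≡-Reasoning
  T = sumB j (λ u → sumB j (λ v → 𝟙 (apart u v)))
  inner : ∀ a b → sumB j (λ u → sumB j (λ v → 𝟙 (not (a ∧ b) ∧ apart u v))) ≡ T * 𝟙 (not (a ∧ b))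
  inner a b = trans (sumB-cong j λ u _ → trans (sumB-cong j λ v _ → trans (𝟙-∧ (not (a ∧ b)) (apart u v)) (*-comm (𝟙 (not (a ∧ b))) (𝟙 (apart u v))))
    (sumB-*ʳ j (𝟙 (not (a ∧ b))) (λ v → 𝟙 (apart u v)))) (sumB-*ʳ j (𝟙 (not (a ∧ b))) (λ u → sumB j (λ v → 𝟙 (apart u v))))
  three : sumL bits (λ a → sumL bits (λ b → 𝟙 (not (a ∧ b)))) ≡ + 3
  three = trans (sumL-bits-digits (λ a b → 𝟙 (not (a ∧ b)))) (sumL-digits (λ d → 𝟙 (not (left d ∧ right d))))

4^ : ∀ j → (+ 4) ^ j ≡ (+ 2) ^ j * (+ 2) ^ j
4^ zero = refl
4^ (suc j) = trans (cong (+ 4 *_) (4^ j)) (lem ((+ 2) ^ j))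
  where
  lem : ∀ x → + 4 * (x * x) ≡ + 2 * x * (+ 2 * x)
  lem = solve-∀

-- The word is cut into u v w z with u and w of length j and v of length d - j, so that w is u
-- shifted by d. Each of the j independent pairs of bits admits three of its four values.
gap-count-pairs : ∀ j d n → j ℕ.≤ d → d ℕ.+ j ℕ.≤ n → sumB n (λ s → 𝟙 (gap d s)) * (+ 4) ^ j ≤ (+ 3) ^ j * (+ 2) ^ n
gap-count-pairs j d n j≤d d+j≤n = subst (λ n → sumB n (λ s → 𝟙 (gap d s)) * (+ 4) ^ j ≤ (+ 3) ^ j * (+ 2) ^ n) n≡ (begin
  sumB (j ℕ.+ (a ℕ.+ (j ℕ.+ b))) (λ s → 𝟙 (gap d s)) * (+ 4) ^ j
    ≡⟨ cong (_* (+ 4) ^ j) (trans (sumB-++ j (a ℕ.+ (j ℕ.+ b)) _) (sumB-cong j λ u _ → trans (sumB-++ a (j ℕ.+ b) _) (sumB-cong a λ v _ → sumB-++ j b _))) ⟩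
  sumB j (λ u → sumB a (λ v → sumB j (λ w → sumB b (λ z → 𝟙 (gap d (u ++ v ++ w ++ z)))))) * (+ 4) ^ j
    ≤⟨ *-monoʳ-≤-nonNeg ((+ 4) ^ j) {{nonNegative (0≤^ 4 j)}} (sumB-mono j λ u l₁ → sumB-mono a λ v l₂ → sumB-mono j λ w l₃ → sumB-mono b λ z _ →
         ≤-trans (𝟙-mono (pairs u v w z l₁ l₂ l₃)) (≤-reflexive (sym (*-identityʳ _)))) ⟩
  sumB j (λ u → sumB a (λ v → sumB j (λ w → sumB b (λ z → 𝟙 (apart u w) * 1ℤ)))) * (+ 4) ^ j
    ≡⟨ cong (_* (+ 4) ^ j) (sumB-cong j λ u _ → trans (sumB-cong a λ v _ → trans (sumB-cong j λ w _ → trans (sumB-* b (𝟙 (apart u w)) (λ _ → 1ℤ)) (cong (𝟙 (apart u w) *_) (sumB-one b)))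
         (trans (sumB-*ʳ j ((+ 2) ^ b) (λ w → 𝟙 (apart u w))) (sym (*-identityʳ _)))) (trans (sumB-* a (sumB j (λ w → 𝟙 (apart u w)) * (+ 2) ^ b) (λ _ → 1ℤ))
           (trans (cong (sumB j (λ w → 𝟙 (apart u w)) * (+ 2) ^ b *_) (sumB-one a)) (*-assoc (sumB j (λ w → 𝟙 (apart u w))) ((+ 2) ^ b) ((+ 2) ^ a))))) ⟩
  sumB j (λ u → sumB j (λ w → 𝟙 (apart u w)) * ((+ 2) ^ b * (+ 2) ^ a)) * (+ 4) ^ j
    ≡⟨ cong (_* (+ 4) ^ j) (trans (sumB-*ʳ j ((+ 2) ^ b * (+ 2) ^ a) _) (cong (_* ((+ 2) ^ b * (+ 2) ^ a)) (sumB-apart j))) ⟩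
  (+ 3) ^ j * ((+ 2) ^ b * (+ 2) ^ a) * (+ 4) ^ j
    ≡⟨ trans (cong ((+ 3) ^ j * ((+ 2) ^ b * (+ 2) ^ a) *_) (4^ j)) (lem ((+ 3) ^ j) ((+ 2) ^ b) ((+ 2) ^ a) ((+ 2) ^ j)) ⟩
  (+ 3) ^ j * ((+ 2) ^ j * ((+ 2) ^ a * ((+ 2) ^ j * (+ 2) ^ b)))
    ≡⟨ cong ((+ 3) ^ j *_) (sym (trans (^-+ (+ 2) j (a ℕ.+ (j ℕ.+ b))) (cong ((+ 2) ^ j *_) (trans (^-+ (+ 2) a (j ℕ.+ b)) (cong ((+ 2) ^ a *_) (^-+ (+ 2) j b)))))) ⟩
  (+ 3) ^ j * (+ 2) ^ (j ℕ.+ (a ℕ.+ (j ℕ.+ b))) ∎)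
  where
  open ≤-Reasoning
  a = d ∸ j
  b = n ∸ (d ℕ.+ j)
  j+a : j ℕ.+ a ≡ d
  j+a = ℕₚ.m+[n∸m]≡n j≤d
  n≡ : j ℕ.+ (a ℕ.+ (j ℕ.+ b)) ≡ n
  n≡ = trans (sym (ℕₚ.+-assoc j a (j ℕ.+ b))) (trans (cong (ℕ._+ (j ℕ.+ b)) j+a) (trans (sym (ℕₚ.+-assoc d j b)) (ℕₚ.m+[n∸m]≡n d+j≤n)))
  lem : ∀ x b a j → x * (b * a) * (j * j) ≡ x * (j * (a * (j * b)))
  lem = solve-∀
  pairs : ∀ u v w z → length u ≡ j → length v ≡ a → length w ≡ j → gap d (u ++ v ++ w ++ z) ≡ true → apart u w ≡ true
  pairs u v w z l₁ l₂ l₃ g = apart-intro u w λ x x< → subst₂ (λ p q → p ∧ q ≡ false)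
    (‼-++ˡ u x<)
    (trans (cong ((u ++ v ++ w ++ z) ‼_) (trans (cong (ℕ._+ x) (trans (sym j+a) (sym (cong₂ ℕ._+_ l₁ l₂)))) (ℕₚ.+-assoc (length u) (length v) x)))
      (trans (‼-++ʳ u (length v ℕ.+ x)) (trans (‼-++ʳ v x) (‼-++ˡ w (subst (x ℕ.<_) (trans l₁ (sym l₃)) x<)))))
    (gap-elim d (u ++ v ++ w ++ z) g x)

-- Either j ≤ d and the pairs {x , d + x}, x < j, are disjoint, or a block of length 2d splits off.
gap-count : ∀ fuel j d n → j ℕ.≤ fuel → 1 ℕ.≤ d → j ℕ.+ j ℕ.+ d ℕ.≤ suc n → sumB n (λ s → 𝟙 (gap d s)) * (+ 4) ^ j ≤ (+ 3) ^ j * (+ 2) ^ n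
gap-count fuel j d n j≤ d≥1 h with ℕₚ.≤-total j d
-- The case j = 0 stands apart: d may be n + 1, and then d + j ≤ n fails.
gap-count fuel zero d n j≤ d≥1 h | inj₁ _ = begin
  sumB n (λ s → 𝟙 (gap d s)) * + 1 ≡⟨ *-identityʳ _ ⟩
  sumB n (λ s → 𝟙 (gap d s))       ≤⟨ sumB-mono n (λ s _ → 𝟙≤1 (gap d s)) ⟩
  sumB n (λ _ → 1ℤ)                ≡⟨ trans (sumB-one n) (sym (*-identityˡ _)) ⟩
  + 1 * (+ 2) ^ n                  ∎
  where open ≤-Reasoning
gap-count fuel j@(suc i) d n j≤ d≥1 h | inj₁ j≤d = gap-count-pairs j d n j≤d
  (ℕₚ.≤-trans (ℕₚ.m≤m+n (d ℕ.+ j) i) (ℕ.s≤s⁻¹ (subst (ℕ._≤ suc n) (lem i d) h)))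
  where
  lem : ∀ i d → suc i ℕ.+ suc i ℕ.+ d ≡ suc (d ℕ.+ suc i ℕ.+ i)
  lem = solve-∀ₙ
gap-count zero zero d n j≤ d≥1 h | inj₂ d≤j = contradiction (ℕₚ.≤-trans d≥1 d≤j) λ ()
gap-count (suc fuel) j d n j≤ d≥1 h | inj₂ d≤j = subst (λ n → sumB n (λ s → 𝟙 (gap d s)) * (+ 4) ^ j ≤ (+ 3) ^ j * (+ 2) ^ n) n≡ (begin
  sumB (d ℕ.+ (d ℕ.+ m)) (λ s → 𝟙 (gap d s)) * (+ 4) ^ j
    ≡⟨ cong (_* (+ 4) ^ j) (trans (sumB-++ d (d ℕ.+ m) _) (sumB-cong d λ u _ → sumB-++ d m _)) ⟩
  sumB d (λ u → sumB d (λ v → sumB m (λ w → 𝟙 (gap d (u ++ v ++ w))))) * (+ 4) ^ j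
    ≤⟨ *-monoʳ-≤-nonNeg ((+ 4) ^ j) {{nonNegative (0≤^ 4 j)}} (sumB-mono d λ u l₁ → sumB-mono d λ v l₂ → sumB-mono m λ w _ →
         ≤-trans (𝟙-mono (block u v w l₁ l₂)) (≤-reflexive (𝟙-∧ (apart u v) (gap d w)))) ⟩
  sumB d (λ u → sumB d (λ v → sumB m (λ w → 𝟙 (apart u v) * 𝟙 (gap d w)))) * (+ 4) ^ j
    ≡⟨ cong (_* (+ 4) ^ j) (trans (sumB-cong d λ u _ → trans (sumB-cong d λ v _ → sumB-* m (𝟙 (apart u v)) (λ w → 𝟙 (gap d w))) (sumB-*ʳ d G (λ v → 𝟙 (apart u v))))
         (trans (sumB-*ʳ d G _) (cong (_* G) (sumB-apart d)))) ⟩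
  (+ 3) ^ d * G * (+ 4) ^ j ≡⟨ trans (cong (λ i → (+ 3) ^ d * G * (+ 4) ^ i) (sym d+j′)) (trans (cong ((+ 3) ^ d * G *_) (^-+ (+ 4) d j′)) (lem ((+ 3) ^ d) G ((+ 4) ^ d) ((+ 4) ^ j′))) ⟩
  (+ 3) ^ d * (+ 4) ^ d * (G * (+ 4) ^ j′) ≤⟨ *-monoˡ ((+ 3) ^ d * (+ 4) ^ d) (0≤* (0≤^ 3 d) (0≤^ 4 d)) ih ⟩
  (+ 3) ^ d * (+ 4) ^ d * ((+ 3) ^ j′ * (+ 2) ^ m) ≡⟨ trans (cong (λ z → (+ 3) ^ d * z * ((+ 3) ^ j′ * (+ 2) ^ m)) (4^ d)) (lem₃ ((+ 3) ^ d) ((+ 2) ^ d) ((+ 3) ^ j′) ((+ 2) ^ m)) ⟩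
  (+ 3) ^ d * (+ 3) ^ j′ * ((+ 2) ^ d * ((+ 2) ^ d * (+ 2) ^ m))
    ≡⟨ cong₂ _*_ (trans (sym (^-+ (+ 3) d j′)) (cong ((+ 3) ^_) d+j′)) (sym (trans (^-+ (+ 2) d (d ℕ.+ m)) (cong ((+ 2) ^ d *_) (^-+ (+ 2) d m)))) ⟩
  (+ 3) ^ j * (+ 2) ^ (d ℕ.+ (d ℕ.+ m)) ∎)
  where
  open ≤-Reasoning
  j′ = j ∸ d
  d+j′ : d ℕ.+ j′ ≡ j
  d+j′ = ℕₚ.m+[n∸m]≡n d≤j
  h′ : d ℕ.+ d ℕ.+ (j′ ℕ.+ j′ ℕ.+ d) ℕ.≤ suc n
  h′ = subst (ℕ._≤ suc n) (trans (cong (λ i → i ℕ.+ i ℕ.+ d) (sym d+j′)) (lem₁ d j′)) h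
    where
    lem₁ : ∀ d i → d ℕ.+ i ℕ.+ (d ℕ.+ i) ℕ.+ d ≡ d ℕ.+ d ℕ.+ (i ℕ.+ i ℕ.+ d)
    lem₁ = solve-∀ₙ
  2d≤n : d ℕ.+ d ℕ.≤ n
  2d≤n = ℕ.s≤s⁻¹ (ℕₚ.≤-trans (ℕₚ.≤-trans (ℕₚ.≤-reflexive (ℕₚ.+-comm 1 (d ℕ.+ d))) (ℕₚ.+-monoʳ-≤ (d ℕ.+ d) (ℕₚ.≤-trans d≥1 (ℕₚ.m≤n+m d (j′ ℕ.+ j′))))) h′)
  m = n ∸ (d ℕ.+ d)
  n≡ : d ℕ.+ (d ℕ.+ m) ≡ n
  n≡ = trans (sym (ℕₚ.+-assoc d d m)) (ℕₚ.m+[n∸m]≡n 2d≤n)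
  G = sumB m (λ w → 𝟙 (gap d w))
  ih : G * (+ 4) ^ j′ ≤ (+ 3) ^ j′ * (+ 2) ^ m
  ih = gap-count fuel j′ d m (ℕ.s≤s⁻¹ (ℕₚ.≤-trans (ℕₚ.≤-trans (ℕₚ.+-monoˡ-≤ j′ d≥1) (ℕₚ.≤-reflexive d+j′)) j≤)) d≥1
    (subst (j′ ℕ.+ j′ ℕ.+ d ℕ.≤_) (ℕₚ.+-∸-assoc 1 2d≤n) (ℕₚ.m+n≤o⇒m≤o∸n (j′ ℕ.+ j′ ℕ.+ d) (subst (ℕ._≤ suc n) (ℕₚ.+-comm (d ℕ.+ d) (j′ ℕ.+ j′ ℕ.+ d)) h′)))
  lem : ∀ x g y z → x * g * (y * z) ≡ x * y * (g * z)
  lem = solve-∀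
  lem₃ : ∀ x y z w → x * (y * y) * (z * w) ≡ x * z * (y * (y * w))
  lem₃ = solve-∀
  block : ∀ u v w → length u ≡ d → length v ≡ d → gap d (u ++ v ++ w) ≡ true → apart u v ∧ gap d w ≡ true
  block u v w l₁ l₂ g = cong₂ _∧_
    (apart-intro u v λ x x< → subst₂ (λ p q → p ∧ q ≡ false) (‼-++ˡ u x<)
      (trans (at x) (‼-++ˡ v (subst (x ℕ.<_) (trans l₁ (sym l₂)) x<))) (c x))
    (gap-intro d w λ x → subst₂ (λ p q → p ∧ q ≡ false)
      (trans (at (d ℕ.+ x)) (low x))
      (trans (at (d ℕ.+ (d ℕ.+ x))) (low (d ℕ.+ x)))
      (c (d ℕ.+ (d ℕ.+ x))))
    where
    c = gap-elim d (u ++ v ++ w) g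
    at : ∀ x → (u ++ v ++ w) ‼ (d ℕ.+ x) ≡ (v ++ w) ‼ x
    at x = trans (cong (λ i → (u ++ v ++ w) ‼ (i ℕ.+ x)) (sym l₁)) (‼-++ʳ u x)
    low : ∀ x → (v ++ w) ‼ (d ℕ.+ x) ≡ w ‼ x
    low x = trans (cong (λ i → (v ++ w) ‼ (i ℕ.+ x)) (sym l₂)) (‼-++ʳ v x)

-- Terms 2m and 2m + 1 both admit j = p + 1 + m. The series of pairs is twice (3/4)^(p+1) times 4,
-- that is 6 (3/4)^p. The induction removes one pair: 2 · 3/4 + 6 · 3/4 = 6.
tail-sum : ∀ r p Y x → 0ℤ ≤ Y →
  (∀ i → i ℕ.< r → ∀ j → j ℕ.+ j ℕ.≤ p ℕ.+ p ℕ.+ (2 ℕ.+ i) → x i * (+ 4) ^ j ≤ (+ 3) ^ j * Y) →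
  sum< x r * (+ 4) ^ p ≤ + 6 * (+ 3) ^ p * Y
tail-sum zero p Y x 0≤Y h = ≤-trans (≤-reflexive (*-zeroˡ ((+ 4) ^ p))) (0≤* {+ 6 * (+ 3) ^ p} (0≤* {+ 6} 0≤+ (0≤^ 3 p)) 0≤Y)
tail-sum (suc zero) p Y x 0≤Y h = begin
  (0ℤ + x 0) * (+ 4) ^ p ≡⟨ cong (_* (+ 4) ^ p) (+-identityˡ (x 0)) ⟩
  x 0 * (+ 4) ^ p        ≤⟨ h 0 (s≤s z≤n) p (ℕₚ.m≤m+n _ 2) ⟩
  (+ 3) ^ p * Y          ≤⟨ ≤-by (+ 5 * ((+ 3) ^ p * Y)) (0≤* {+ 5} 0≤+ (0≤* (0≤^ 3 p) 0≤Y)) (lem ((+ 3) ^ p) Y) ⟩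
  + 6 * (+ 3) ^ p * Y    ∎
  where
  open ≤-Reasoning
  lem : ∀ a y → + 6 * a * y ≡ a * y + + 5 * (a * y)
  lem = solve-∀
tail-sum (suc (suc r)) p Y x 0≤Y h = *-cancelʳ-≤-pos _ _ (+ 4) (begin
  sum< x (2 ℕ.+ r) * (+ 4) ^ p * + 4
    ≡⟨ cong (λ z → z * (+ 4) ^ p * + 4) (trans (sum<-front x (suc r)) (cong (λ z → x 0 + z) (sum<-front (λ i → x (suc i)) r))) ⟩
  (x 0 + (x 1 + T)) * (+ 4) ^ p * + 4 ≡⟨ lem₁ (x 0) (x 1) T ((+ 4) ^ p) ⟩
  x 0 * (+ 4) ^ suc p + (x 1 * (+ 4) ^ suc p + T * (+ 4) ^ suc p)
    ≤⟨ +-mono-≤ (h 0 (s≤s z≤n) (suc p) (ℕₚ.≤-reflexive (idx p)))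
       (+-mono-≤ (h 1 (s≤s (s≤s z≤n)) (suc p) (ℕₚ.≤-trans (ℕₚ.≤-reflexive (idx p)) (ℕₚ.+-monoʳ-≤ (p ℕ.+ p) (s≤s (s≤s z≤n)))))
         (tail-sum r (suc p) Y (λ i → x (2 ℕ.+ i)) 0≤Y λ i i<r j l → h (2 ℕ.+ i) (s≤s (s≤s i<r)) j (ℕₚ.≤-trans l (ℕₚ.≤-reflexive (idx₂ p i))))) ⟩
  (+ 3) ^ suc p * Y + ((+ 3) ^ suc p * Y + + 6 * (+ 3) ^ suc p * Y) ≡⟨ lem₂ ((+ 3) ^ p) Y ⟩
  + 6 * (+ 3) ^ p * Y * + 4 ∎)
  where
  open ≤-Reasoning
  T = sum< (λ i → x (2 ℕ.+ i)) r
  sum<-front : ∀ φ k → sum< φ (suc k) ≡ φ 0 + sum< (λ i → φ (suc i)) k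
  sum<-front φ zero = trans (+-identityˡ (φ 0)) (sym (+-identityʳ (φ 0)))
  sum<-front φ (suc k) = trans (cong (_+ φ (suc k)) (sum<-front φ k)) (+-assoc (φ 0) _ (φ (suc k)))
  lem₁ : ∀ a b t y → (a + (b + t)) * y * + 4 ≡ a * (+ 4 * y) + (b * (+ 4 * y) + t * (+ 4 * y))
  lem₁ = solve-∀
  lem₂ : ∀ a y → + 3 * a * y + (+ 3 * a * y + + 6 * (+ 3 * a) * y) ≡ + 6 * a * y * + 4
  lem₂ = solve-∀
  idx : ∀ p → suc p ℕ.+ suc p ≡ p ℕ.+ p ℕ.+ 2
  idx = solve-∀ₙ
  idx₂ : ∀ p i → suc p ℕ.+ suc p ℕ.+ (2 ℕ.+ i) ≡ p ℕ.+ p ℕ.+ (2 ℕ.+ (2 ℕ.+ i))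
  idx₂ = solve-∀ₙ

-- From large differences of a word to sums of the digits at its ends.

wrap : List Digit → List Bool → List Bool
wrap [] mid = mid
wrap (d ∷ ω) mid = left d ∷ wrap ω mid ++ right d ∷ []

length-wrap : ∀ ω mid → length (wrap ω mid) ≡ length ω ℕ.* 2 ℕ.+ length mid
length-wrap [] mid = refl
length-wrap (d ∷ ω) mid = cong suc (trans (length-∷ʳ (wrap ω mid) (right d)) (cong suc (length-wrap ω mid)))

wrap-left : ∀ ω mid x → x ℕ.< length ω → wrap ω mid ‼ x ≡ left (ω ! x)
wrap-left (d ∷ ω) mid zero _ = refl
wrap-left (d ∷ ω) mid (suc x) (s≤s x<) = trans (‼-++ˡ (wrap ω mid) (subst (x ℕ.<_) (sym (length-wrap ω mid))
  (ℕₚ.≤-trans x< (ℕₚ.≤-trans (ℕₚ.m≤m*n (length ω) 2) (ℕₚ.m≤m+n _ (length mid)))))) (wrap-left ω mid x x<)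

wrap-right : ∀ ω mid y z → y ℕ.< length ω → z ℕ.+ suc y ≡ length ω ℕ.* 2 ℕ.+ length mid → wrap ω mid ‼ z ≡ right (ω ! y)
wrap-right (d ∷ ω) mid zero zero _ e = contradiction (ℕₚ.suc-injective e) λ ()
wrap-right (d ∷ ω) mid zero (suc z) _ e = trans (cong ((wrap ω mid ++ right d ∷ []) ‼_)
  (trans z≡ (sym (trans (ℕₚ.+-identityʳ _) (length-wrap ω mid))))) (‼-++ʳ (wrap ω mid) 0)
  where
  z≡ : z ≡ length ω ℕ.* 2 ℕ.+ length mid
  z≡ = ℕₚ.suc-injective (trans (ℕₚ.+-comm 1 z) (ℕₚ.suc-injective e))
wrap-right (d ∷ ω) mid (suc y) zero (s≤s y<) e = contradiction e (ℕₚ.<⇒≢ (s≤s (s≤s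
  (ℕₚ.≤-trans y< (ℕₚ.≤-trans (ℕₚ.m≤m*n (length ω) 2) (ℕₚ.m≤m+n _ (length mid)))))))
wrap-right (d ∷ ω) mid (suc y) (suc z) (s≤s y<) e = trans (‼-++ˡ (wrap ω mid) (subst (z ℕ.<_)
  (sym (trans (length-wrap ω mid) (sym e′))) (ℕₚ.m<m+n z (s≤s z≤n)))) (wrap-right ω mid y z y< e′)
  where
  e′ : z ℕ.+ suc y ≡ length ω ℕ.* 2 ℕ.+ length mid
  e′ = ℕₚ.suc-injective (trans (sym (ℕₚ.+-suc z (suc y))) (ℕₚ.suc-injective e))

hit-left-right : ∀ d e → hit (swap d) e ≡ false → left d ∧ right e ≡ false
hit-left-right oo e h = refl
hit-left-right oi e h = refl
hit-left-right io oo h = refl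
hit-left-right io io h = refl
hit-left-right ii oo h = refl

left-right-hit : ∀ d e → left d ∧ right e ≡ false → left e ∧ right d ≡ false → hit (swap d) e ≡ false
left-right-hit oo e _ _ = refl
left-right-hit oi oo _ _ = refl
left-right-hit oi oi _ _ = refl
left-right-hit io oo _ _ = refl
left-right-hit io io _ _ = refl
left-right-hit ii oo _ _ = refl

-- In a word of length N, the difference N - 1 - s joins x to N - 1 - (s - x), so it corresponds to
-- the sum s of a left and a right index. As s is smaller than the length of ω, both bits belong to
-- digits of ω and the middle is irrelevant.
gap-conv : ∀ ω mid s d → s ℕ.< length ω → d ℕ.+ suc s ≡ length ω ℕ.* 2 ℕ.+ length mid → gap d (wrap ω mid) ≡ conv ω (suc s)
gap-conv ω mid s d s< e = iff⇒≡ to from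
  where
  W = wrap ω mid
  L≤ : ∀ x y → x ℕ.+ y ≡ s → W ‼ x ≡ left (ω ! x) × W ‼ (d ℕ.+ x) ≡ right (ω ! y)
  L≤ x y refl = wrap-left ω mid x (ℕₚ.≤-<-trans (ℕₚ.m≤m+n x y) s<) ,
    wrap-right ω mid y (d ℕ.+ x) (ℕₚ.≤-<-trans (ℕₚ.m≤n+m y x) s<) (trans (lem d x y) e)
    where
    lem : ∀ d x y → d ℕ.+ x ℕ.+ suc y ≡ d ℕ.+ suc (x ℕ.+ y)
    lem = solve-∀ₙ
  to : gap d W ≡ true → conv ω (suc s) ≡ true
  to g = conv-intro ω (suc s) λ x y x+y → left-right-hit (ω ! x) (ω ! y) (pair x y (ℕₚ.suc-injective x+y))
      (pair y x (trans (ℕₚ.+-comm y x) (ℕₚ.suc-injective x+y)))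
    where
    pair : ∀ x y → x ℕ.+ y ≡ s → left (ω ! x) ∧ right (ω ! y) ≡ false
    pair x y x+y = subst₂ (λ p q → p ∧ q ≡ false) (proj₁ (L≤ x y x+y)) (proj₂ (L≤ x y x+y)) (gap-elim d W g x)
  from : conv ω (suc s) ≡ true → gap d W ≡ true
  from c = gap-intro d W all
    where
    all : Gap d W
    all x with split (suc s) x
    ... | inj₁ (s≤s x≤s) = subst₂ (λ p q → p ∧ q ≡ false) (sym (proj₁ (L≤ x (s ∸ x) x+y))) (sym (proj₂ (L≤ x (s ∸ x) x+y)))
        (hit-left-right (ω ! x) (ω ! (s ∸ x)) (conv-elim ω (suc s) c x (s ∸ x) (cong suc x+y)))
      where x+y = ℕₚ.m+[n∸m]≡n x≤s
    ... | inj₂ (q , refl) = trans (cong (W ‼ x ∧_) (‼-beyond W (ℕₚ.≤-trans (ℕₚ.≤-reflexive (trans (length-wrap ω mid) (sym e)))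
        (ℕₚ.+-monoʳ-≤ d (ℕₚ.m≤m+n (suc s) q))))) (∧-zeroʳ (W ‼ x))

sumB-ends : ∀ m F → sumB (2 ℕ.+ m) F ≡ sumL digits (λ d → sumB m (λ s → F (left d ∷ s ++ right d ∷ [])))
sumB-ends m F = trans (sumL-cong bits λ a → trans (sumB-∷ʳ m (λ s → F (a ∷ s))) (sumB-sumL m bits (λ b s → F (a ∷ s ++ b ∷ []))))
  (sumL-bits-digits (λ a b → sumB m (λ s → F (a ∷ s ++ b ∷ []))))

sumB-wrap : ∀ L l F → sumB (L ℕ.* 2 ℕ.+ l) F ≡ sumD L (λ α → sumB l (λ mid → F (wrap α mid)))
sumB-wrap zero l F = refl
sumB-wrap (suc L) l F = trans (sumB-ends (L ℕ.* 2 ℕ.+ l) F)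
  (sumL-cong digits λ d → sumB-wrap L l (λ s → F (left d ∷ s ++ right d ∷ [])))

frame : List Bool → List Bool
frame s = true ∷ s ++ true ∷ []

-- `gap-count` concerns uniform words, so the frame is forgotten. This multiplies the number of
-- words by 4 and turns the 6 of `tail-sum` into the 24 of the later bounds.
sumB-frame : ∀ m F → (∀ s → 0ℤ ≤ F s) → sumB m (λ s → F (frame s)) ≤ sumB (2 ℕ.+ m) F
sumB-frame m F 0≤F = ≤-by (S oo + (S oi + (S io + 0ℤ))) (+-mono-≤ (0≤S oo) (+-mono-≤ (0≤S oi) (+-mono-≤ (0≤S io) ≤-refl)))
  (trans (sumB-ends m F) (trans (sumL-digits S) (lem (S oo) (S oi) (S io) (S ii))))
  where
  S : Digit → ℤ
  S d = sumB m (λ s → F (left d ∷ s ++ right d ∷ []))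
  0≤S : ∀ d → 0ℤ ≤ S d
  0≤S d = sumB-0≤ m _ λ s → 0≤F _
  lem : ∀ a b c d → a + (b + (c + (d + 0ℤ))) ≡ d + (a + (b + (c + 0ℤ)))
  lem = solve-∀

record Near (a b ε : ℤ) : Set where
  constructor within
  field
    above : a ≤ b + ε
    below : b ≤ a + ε

open Near public

-- The words between a first and a last element of the set, both fixed. `fringe` is the counterpart
-- on the digit side: the prefix `ii` records these two elements.
framed : ℕ → ℕ → ℤ
framed n x = sumB n (λ s → 𝟙 (gaps (frame s) ℕ.≡ᵇ x))

fringe : ℕ → ℕ → ℤ
fringe L x = sumD L (λ α → 𝟙 (missing (ii ∷ []) L α ℕ.≡ᵇ x))

indicator-near : ∀ a b x → Near (𝟙 (a ℕ.+ b ℕ.≡ᵇ x)) (𝟙 (a ℕ.≡ᵇ x)) (+ b)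
indicator-near a zero x rewrite ℕₚ.+-identityʳ a = within (≤-reflexive (sym (+-identityʳ _))) (≤-reflexive (sym (+-identityʳ _)))
indicator-near a (suc b) x = within (far (a ℕ.+ suc b ℕ.≡ᵇ x) (a ℕ.≡ᵇ x)) (far (a ℕ.≡ᵇ x) (a ℕ.+ suc b ℕ.≡ᵇ x))
  where
  far : ∀ p q → 𝟙 p ≤ 𝟙 q + + suc b
  far p q = ≤-trans (𝟙≤1 p) (+-mono-≤ (0≤𝟙 q) (+≤+ (s≤s (z≤n {b}))))

module Fringe (L p : ℕ) (L≡ : suc L ≡ p ℕ.+ p) (l : ℕ) where
  n : ℕ
  n = L ℕ.* 2 ℕ.+ l

  later : List Bool → ℕ
  later s = count< (λ i → gap (suc (n ∸ (suc L ℕ.+ i))) (frame s)) (L ℕ.+ l)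

  n≡ : suc n ≡ suc L ℕ.+ (L ℕ.+ l)
  n≡ = lem L l
    where
    lem : ∀ L l → suc (L ℕ.* 2 ℕ.+ l) ≡ suc L ℕ.+ (L ℕ.+ l)
    lem = solve-∀ₙ

  -- Differences are counted from the largest down. The first `suc L` of them are decided by the
  -- digits, and the very first, n + 1, is realised by the frame itself.
  gaps-wrap : ∀ α mid → length α ≡ L → length mid ≡ l → gaps (frame (wrap α mid)) ≡ missing (ii ∷ []) L α ℕ.+ later (wrap α mid)
  gaps-wrap α mid ∣α∣ ∣mid∣ = begin
    count< (λ i → gap (suc i) W) (length W ∸ 1) ≡⟨ cong (count< (λ i → gap (suc i) W)) ∣W∣ ⟩
    count< (λ i → gap (suc i) W) (suc n)        ≡⟨ sym (count<-reverse (λ i → gap (suc i) W) (suc n)) ⟩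
    count< (λ s → gap (suc (n ∸ s)) W) (suc n)  ≡⟨ cong (count< (λ s → gap (suc (n ∸ s)) W)) n≡ ⟩
    count< (λ s → gap (suc (n ∸ s)) W) (suc L ℕ.+ (L ℕ.+ l)) ≡⟨ count<-+ (λ s → gap (suc (n ∸ s)) W) (suc L) (L ℕ.+ l) ⟩
    count< (λ s → gap (suc (n ∸ s)) W) (suc L) ℕ.+ later (wrap α mid)
      ≡⟨ cong (ℕ._+ later (wrap α mid)) (count<-cong (suc L) λ s s< → gap-conv ω mid s (suc (n ∸ s)) (subst (λ k → s ℕ.< suc k) (sym ∣α∣) s<)
           (trans (cong suc (trans (ℕₚ.+-suc (n ∸ s) s) (cong suc (ℕₚ.m∸n+n≡m (s≤n s (ℕ.s≤s⁻¹ s<)))))) (cong₂ (λ a b → suc (suc (a ℕ.* 2 ℕ.+ b))) (sym ∣α∣) (sym ∣mid∣)))) ⟩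
    count< (λ s → conv ω (suc s)) (suc L) ℕ.+ later (wrap α mid)
      ≡⟨ cong (λ b → (if b then 1 else 0) ℕ.+ missing (ii ∷ []) L α ℕ.+ later (wrap α mid)) first ⟩
    missing (ii ∷ []) L α ℕ.+ later (wrap α mid) ∎
    where
    open ≡-Reasoning
    ω = ii ∷ α
    W = frame (wrap α mid)
    ∣W∣ : length W ∸ 1 ≡ suc n
    ∣W∣ = trans (length-∷ʳ (wrap α mid) true) (cong suc (trans (length-wrap α mid) (cong₂ (λ a b → a ℕ.* 2 ℕ.+ b) ∣α∣ ∣mid∣)))
    s≤n : ∀ s → s ℕ.≤ L → s ℕ.≤ n
    s≤n s s≤L = ℕₚ.≤-trans s≤L (ℕₚ.≤-trans (ℕₚ.m≤m*n L 2) (ℕₚ.m≤m+n _ l))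
    first : conv ω 1 ≡ false
    first with conv ω 1 in eq
    ... | false = refl
    ... | true = contradiction (conv-elim ω 1 eq 0 0 refl) λ ()

  E : ℤ
  E = sumB n (λ s → + later s)

  -- At the position s = L + 1 + i from the top the difference is n + 1 - s in a word of length n +
  -- 2, so `gap-count` admits all j with 2j ≤ s + 2. As L + 1 = 2p, this is the condition 2j ≤ 2p +
  -- 2 + i of `tail-sum`.
  E-bound : E * (+ 4) ^ p ≤ + 24 * (+ 3) ^ p * (+ 2) ^ n
  E-bound = begin
    E * (+ 4) ^ p
      ≡⟨ cong (_* (+ 4) ^ p) (trans (sumB-cong n λ s _ → +count< _ (L ℕ.+ l)) (sumW-sum< bits n (L ℕ.+ l) _)) ⟩
    sum< term (L ℕ.+ l) * (+ 4) ^ p ≤⟨ tail-sum (L ℕ.+ l) p ((+ 2) ^ (2 ℕ.+ n)) term (0≤^ 2 (2 ℕ.+ n)) bound ⟩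
    + 6 * (+ 3) ^ p * (+ 2) ^ (2 ℕ.+ n) ≡⟨ lem ((+ 3) ^ p) ((+ 2) ^ n) ⟩
    + 24 * (+ 3) ^ p * (+ 2) ^ n ∎
    where
    open ≤-Reasoning
    term : ℕ → ℤ
    term i = sumB n (λ s → 𝟙 (gap (suc (n ∸ (suc L ℕ.+ i))) (frame s)))
    lem : ∀ a b → + 6 * a * (+ 2 * (+ 2 * b)) ≡ + 24 * a * b
    lem = solve-∀
    bound : ∀ i → i ℕ.< L ℕ.+ l → ∀ j → j ℕ.+ j ℕ.≤ p ℕ.+ p ℕ.+ (2 ℕ.+ i) → term i * (+ 4) ^ j ≤ (+ 3) ^ j * (+ 2) ^ (2 ℕ.+ n)
    bound i i< j j≤ = ≤-trans (*-monoʳ-≤-nonNeg ((+ 4) ^ j) {{nonNegative (0≤^ 4 j)}}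
        (sumB-frame n (λ s → 𝟙 (gap d s)) (λ s → 0≤𝟙 (gap d s))))
      (gap-count j j d (2 ℕ.+ n) ℕₚ.≤-refl (s≤s z≤n) (ℕₚ.≤-trans (ℕₚ.+-monoˡ-≤ d (subst (λ m → j ℕ.+ j ℕ.≤ m ℕ.+ (2 ℕ.+ i)) (sym L≡) j≤))
        (ℕₚ.≤-reflexive (trans (lem₂ (suc L) i (n ∸ (suc L ℕ.+ i))) (cong (3 ℕ.+_) (ℕₚ.m+[n∸m]≡n s≤n))))))
      where
      d = suc (n ∸ (suc L ℕ.+ i))
      s≤n : suc L ℕ.+ i ℕ.≤ n
      s≤n = ℕ.s≤s⁻¹ (subst (suc (suc L ℕ.+ i) ℕ.≤_) (sym n≡) (ℕₚ.≤-trans (ℕₚ.≤-reflexive (sym (ℕₚ.+-suc (suc L) i))) (ℕₚ.+-monoʳ-≤ (suc L) i<)))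
      lem₂ : ∀ m i r → m ℕ.+ (2 ℕ.+ i) ℕ.+ suc r ≡ 3 ℕ.+ (m ℕ.+ i ℕ.+ r)
      lem₂ = solve-∀ₙ

  -- Divided by 2^n 4^L 4^p: the two relative frequencies differ by at most 24 (3/4)^p, whatever n
  -- is. The counts agree unless a later difference is missing, and E bounds how often that happens.
  framed-near : ∀ x → Near (framed n x * ((+ 4) ^ L * (+ 4) ^ p)) ((+ 2) ^ n * (fringe L x * (+ 4) ^ p)) ((+ 2) ^ n * (+ 24 * (+ 3) ^ p * (+ 4) ^ L))
  framed-near x = within (≤-trans (≤-reflexive (sym (*-assoc (framed n x) _ _))) (≤-trans (scale up) (≤-trans (≤-reflexive (lem₁ ((+ 2) ^ l) (fringe L x) E ((+ 4) ^ L) ((+ 4) ^ p)))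
                    (+-mono-≤ (≤-reflexive target) error))))
                  (≤-trans (≤-reflexive (sym target)) (≤-trans (≤-reflexive (lem₂ ((+ 4) ^ L) ((+ 2) ^ l) (fringe L x) ((+ 4) ^ p))) (≤-trans (scale down)
                    (≤-trans (≤-reflexive (lem₃ (framed n x) E ((+ 4) ^ L) ((+ 4) ^ p))) (+-monoʳ-≤ (framed n x * ((+ 4) ^ L * (+ 4) ^ p)) error)))))
    where
    lem₁ : ∀ a q e L p → (a * q + e) * L * p ≡ L * a * (q * p) + e * p * L
    lem₁ = solve-∀
    lem₂ : ∀ L a q p → L * a * (q * p) ≡ a * q * L * p
    lem₂ = solve-∀
    lem₃ : ∀ h e L p → (h + e) * L * p ≡ h * (L * p) + e * p * L
    lem₃ = solve-∀
    lem₄ : ∀ a b c → + 24 * a * b * c ≡ b * (+ 24 * a * c)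
    lem₄ = solve-∀
    4^L : (+ 2) ^ n ≡ (+ 4) ^ L * (+ 2) ^ l
    4^L = trans (^-+ (+ 2) (L ℕ.* 2) l) (cong (_* (+ 2) ^ l) (go L))
      where
      go : ∀ L → (+ 2) ^ (L ℕ.* 2) ≡ (+ 4) ^ L
      go zero = refl
      go (suc L) = trans (cong (λ z → + 2 * (+ 2 * z)) (go L)) (sym (*-assoc (+ 2) (+ 2) ((+ 4) ^ L)))
    target : (+ 4) ^ L * (+ 2) ^ l * (fringe L x * (+ 4) ^ p) ≡ (+ 2) ^ n * (fringe L x * (+ 4) ^ p)
    target = cong (_* (fringe L x * (+ 4) ^ p)) (sym 4^L)
    error : E * (+ 4) ^ p * (+ 4) ^ L ≤ (+ 2) ^ n * (+ 24 * (+ 3) ^ p * (+ 4) ^ L)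
    error = ≤-trans (*-monoʳ-≤-nonNeg ((+ 4) ^ L) {{nonNegative (0≤^ 4 L)}} E-bound) (≤-reflexive (lem₄ ((+ 3) ^ p) ((+ 2) ^ n) ((+ 4) ^ L)))
    scale : ∀ {a b} → a ≤ b → a * (+ 4) ^ L * (+ 4) ^ p ≤ b * (+ 4) ^ L * (+ 4) ^ p
    scale h = *-monoʳ-≤-nonNeg ((+ 4) ^ p) {{nonNegative (0≤^ 4 p)}} (*-monoʳ-≤-nonNeg ((+ 4) ^ L) {{nonNegative (0≤^ 4 L)}} h)
    by-fringe : ∀ F → sumB n F ≡ sumD L (λ α → sumB l (λ mid → F (wrap α mid)))
    by-fringe = sumB-wrap L l
    main : (+ 2) ^ l * fringe L x ≡ sumD L (λ α → sumB l (λ mid → 𝟙 (missing (ii ∷ []) L α ℕ.≡ᵇ x)))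
    main = trans (sym (sumD-* L ((+ 2) ^ l) _)) (sumD-cong L λ α _ → sym (trans (sumB-const l _) (cong (λ z → z ^ l * 𝟙 (missing (ii ∷ []) L α ℕ.≡ᵇ x)) size-bits)))
    combine : ∀ (F G : List Digit → List Bool → ℤ) → sumD L (λ α → sumB l (λ mid → F α mid + G α mid))
      ≡ sumD L (λ α → sumB l (F α)) + sumD L (λ α → sumB l (G α))
    combine F G = trans (sumD-cong L λ α _ → sumB-+ l (F α) (G α)) (sumD-+ L _ _)
    up : framed n x ≤ (+ 2) ^ l * fringe L x + E
    up = ≤-trans (≤-reflexive (by-fringe _)) (≤-trans (sumD-mono L λ α ∣α∣ → sumB-mono l λ mid ∣mid∣ →
        ≤-trans (≤-reflexive (cong (λ m → 𝟙 (m ℕ.≡ᵇ x)) (gaps-wrap α mid ∣α∣ ∣mid∣))) (above (indicator-near (missing (ii ∷ []) L α) (later (wrap α mid)) x)))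
      (≤-reflexive (trans (combine (λ α mid → 𝟙 (missing (ii ∷ []) L α ℕ.≡ᵇ x)) (λ α mid → + later (wrap α mid))) (cong₂ _+_ (sym main) (sym (by-fringe _))))))
    down : (+ 2) ^ l * fringe L x ≤ framed n x + E
    down = ≤-trans (≤-reflexive main) (≤-trans (sumD-mono L λ α ∣α∣ → sumB-mono l λ mid ∣mid∣ →
        ≤-trans (below (indicator-near (missing (ii ∷ []) L α) (later (wrap α mid)) x)) (≤-reflexive (cong (λ m → 𝟙 (m ℕ.≡ᵇ x) + + later (wrap α mid)) (sym (gaps-wrap α mid ∣α∣ ∣mid∣)))))
      (≤-reflexive (trans (combine (λ α mid → 𝟙 (gaps (frame (wrap α mid)) ℕ.≡ᵇ x)) (λ α mid → + later (wrap α mid))) (cong₂ _+_ (sym (by-fringe _)) (sym (by-fringe _))))))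

-- Zeros at the two ends of a word and the geometric variables.

-- Padding creates no difference but admits one more candidate, `length s`, which is too large to
-- occur.
gaps-pad : ∀ s s′ → length s′ ≡ suc (length s) → 1 ℕ.≤ length s → (∀ d → gap (suc d) s′ ≡ gap (suc d) s) → gaps s′ ≡ suc (gaps s)
gaps-pad s s′ e l h = begin
  count< (λ i → gap (suc i) s′) (length s′ ∸ 1) ≡⟨ cong (λ m → count< (λ i → gap (suc i) s′) (m ∸ 1)) e ⟩
  count< (λ i → gap (suc i) s′) (length s)      ≡⟨ count<-cong (length s) (λ i _ → h i) ⟩
  count< (λ i → gap (suc i) s) (length s)       ≡⟨ cong (count< (λ i → gap (suc i) s)) (sym k+1) ⟩
  count< (λ i → gap (suc i) s) (suc k)          ≡⟨ count<-last (λ i → gap (suc i) s) k ⟩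
  (if gap (suc k) s then 1 else 0) ℕ.+ gaps s   ≡⟨ cong (λ b → (if b then 1 else 0) ℕ.+ gaps s) top ⟩
  suc (gaps s)                                  ∎
  where
  open ≡-Reasoning
  k = length s ∸ 1
  k+1 : suc k ≡ length s
  k+1 = ℕₚ.m+[n∸m]≡n l
  top : gap (suc k) s ≡ true
  top = gap-intro (suc k) s λ x → trans (cong (s ‼ x ∧_) (‼-beyond s (ℕₚ.≤-trans (ℕₚ.≤-reflexive (sym k+1)) (ℕₚ.m≤m+n (suc k) x)))) (∧-zeroʳ (s ‼ x))

gaps-false∷ : ∀ s → 1 ℕ.≤ length s → gaps (false ∷ s) ≡ suc (gaps s)
gaps-false∷ s l = gaps-pad s (false ∷ s) refl l λ d → iff⇒≡
  (λ g → gap-intro (suc d) s λ x → subst (λ i → s ‼ x ∧ s ‼ i ≡ false) (ℕₚ.+-suc d x) (gap-elim (suc d) (false ∷ s) g (suc x)))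
  (λ g → gap-intro (suc d) (false ∷ s) λ { zero → refl ; (suc x) → subst (λ i → s ‼ x ∧ s ‼ i ≡ false) (sym (ℕₚ.+-suc d x)) (gap-elim (suc d) s g x) })

gaps-∷ʳfalse : ∀ s → 1 ℕ.≤ length s → gaps (s ++ false ∷ []) ≡ suc (gaps s)
gaps-∷ʳfalse s l = gaps-pad s (s ++ false ∷ []) (length-∷ʳ s false) l λ d → iff⇒≡
  (λ g → gap-intro (suc d) s λ x → subst₂ (λ a b → a ∧ b ≡ false) (same s x) (same s (suc d ℕ.+ x)) (gap-elim (suc d) (s ++ false ∷ []) g x))
  (λ g → gap-intro (suc d) (s ++ false ∷ []) λ x → subst₂ (λ a b → a ∧ b ≡ false) (sym (same s x)) (sym (same s (suc d ℕ.+ x))) (gap-elim (suc d) s g x))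
  where
  same : ∀ s x → (s ++ false ∷ []) ‼ x ≡ s ‼ x
  same [] zero = refl
  same [] (suc x) = refl
  same (b ∷ s) zero = refl
  same (b ∷ s) (suc x) = same s x

opaque
  -- `opened` fixes a one at the front only. A zero stripped off an end lowers the number of gaps by
  -- one; the resulting recursions produce the two geometric variables.
  opened total : ℕ → ℕ → ℤ
  opened n x = sumB n (λ s → 𝟙 (gaps (true ∷ s) ℕ.≡ᵇ x))
  total n x = sumB n (λ s → 𝟙 (gaps s ℕ.≡ᵇ x))

  opened-suc : ∀ n x → opened (suc n) x ≡ sumB n (λ s → 𝟙 (suc (gaps (true ∷ s)) ℕ.≡ᵇ x)) + framed n x
  opened-suc n x = trans (sumB-∷ʳ n (λ s → 𝟙 (gaps (true ∷ s) ℕ.≡ᵇ x))) (trans (sumB-cong n λ s _ → trans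
    (sumL-bits (λ b → 𝟙 (gaps (true ∷ s ++ b ∷ []) ℕ.≡ᵇ x)))
    (cong₂ (λ a b → 𝟙 (a ℕ.≡ᵇ x) + b) (gaps-∷ʳfalse (true ∷ s) (s≤s z≤n)) (+-identityʳ _)))
    (sumB-+ n _ _))

  total-suc : ∀ n x → total (2 ℕ.+ n) x ≡ sumB (suc n) (λ s → 𝟙 (suc (gaps s) ℕ.≡ᵇ x)) + opened (suc n) x
  total-suc n x = trans (sumL-bits (λ a → sumB (suc n) (λ s → 𝟙 (gaps (a ∷ s) ℕ.≡ᵇ x)))) (cong₂ _+_
    (sumB-cong (suc n) λ s l → cong (λ m → 𝟙 (m ℕ.≡ᵇ x)) (gaps-false∷ s (subst (1 ℕ.≤_) (sym l) (s≤s z≤n))))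
    (+-identityʳ (opened (suc n) x)))

  total-def : ∀ n x → total n x ≡ sumB n (λ s → 𝟙 (gaps s ℕ.≡ᵇ x))
  total-def n x = refl

  opened-zero : ∀ n → opened (suc n) 0 ≡ framed n 0
  opened-zero n = trans (opened-suc n 0) (trans (cong (_+ framed n 0) (sumB-zero n)) (+-identityˡ (framed n 0)))

  opened-suc-suc : ∀ n x → opened (suc n) (suc x) ≡ opened n x + framed n (suc x)
  opened-suc-suc n x = opened-suc n (suc x)

  total-zero : ∀ n → total (2 ℕ.+ n) 0 ≡ opened (suc n) 0
  total-zero n = trans (total-suc n 0) (trans (cong (_+ opened (suc n) 0) (sumB-zero (suc n))) (+-identityˡ (opened (suc n) 0)))

  total-suc-suc : ∀ n x → total (2 ℕ.+ n) (suc x) ≡ total (suc n) x + opened (suc n) (suc x)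
  total-suc-suc n x = total-suc n (suc x)

near-+ : ∀ {a b e a′ b′ e′} → Near a b e → Near a′ b′ e′ → Near (a + a′) (b + b′) (e + e′)
near-+ {a} {b} {e} {a′} {b′} {e′} (within h g) (within h′ g′) =
  within (≤-trans (+-mono-≤ h h′) (≤-reflexive (lem b e b′ e′))) (≤-trans (+-mono-≤ g g′) (≤-reflexive (lem a e a′ e′)))
  where
  lem : ∀ a b c d → a + b + (c + d) ≡ a + c + (b + d)
  lem = solve-∀

near-* : ∀ c {a b e} → 0ℤ ≤ c → Near a b e → Near (c * a) (c * b) (c * e)
near-* c {a} {b} {e} 0≤c (within h g) = within (≤-trans (*-monoˡ c 0≤c h) (≤-reflexive (*-distribˡ-+ c b e)))
  (≤-trans (*-monoˡ c 0≤c g) (≤-reflexive (*-distribˡ-+ c a e)))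

near-≡ : ∀ {a b e a′ b′ e′} → a ≡ a′ → b ≡ b′ → e ≡ e′ → Near a b e → Near a′ b′ e′
near-≡ refl refl refl h = h

near-weaken : ∀ {a b e e′} → e ≤ e′ → Near a b e → Near a b e′
near-weaken {a} {b} e≤ (within h g) = within (≤-trans h (+-monoʳ-≤ b e≤)) (≤-trans g (+-monoʳ-≤ a e≤))

-- This and the next three lemmas show that errors do not accumulate: each recursion averages two
-- frequencies, and the average of two quantities known up to η is again known up to η. For x = 0
-- one of the two is exactly zero.
near-start : ∀ o d n a η → 0ℤ ≤ n → 0ℤ ≤ η → Near (o * d) (n * a) (n * η) →
  Near (o * (+ 2 * 1ℤ * d)) (+ 2 * n * a) (+ 2 * n * (+ 2 * 1ℤ * η))
near-start o d n a η 0≤n 0≤η h = near-≡ {+ 2 * (o * d)} {+ 2 * (n * a)} (lem₁ o d) (lem₂ n a) refl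
  (near-weaken {+ 2 * (o * d)} {+ 2 * (n * a)} {+ 2 * (n * η)} (≤-by (+ 2 * n * η) (0≤* {+ 2 * n} (0≤* {+ 2} 0≤+ 0≤n) 0≤η) (lem₃ n η))
    (near-* (+ 2) {o * d} {n * a} {n * η} 0≤+ h))
  where
  lem₁ : ∀ f d → + 2 * (f * d) ≡ f * (+ 2 * 1ℤ * d)
  lem₁ = solve-∀
  lem₂ : ∀ x q → + 2 * (x * q) ≡ + 2 * x * q
  lem₂ = solve-∀
  lem₃ : ∀ x η → + 2 * x * (+ 2 * 1ℤ * η) ≡ + 2 * (x * η) + + 2 * x * η
  lem₃ = solve-∀

near-double : ∀ o t d n a η → 0ℤ ≤ n → 0ℤ ≤ t → 0ℤ ≤ η → Near (o * (t * d)) (n * a) (n * (t * η)) →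
  Near (o * (+ 2 * t * d)) (+ 2 * n * a) (+ 2 * n * (+ 2 * t * η))
near-double o t d n a η 0≤n 0≤t 0≤η h = near-≡ {+ 2 * (o * (t * d))} {+ 2 * (n * a)} (lem₁ o t d) (lem₂ n a) refl
  (near-weaken {+ 2 * (o * (t * d))} {+ 2 * (n * a)} {+ 2 * (n * (t * η))}
    (≤-by (+ 2 * n * (t * η)) (0≤* {+ 2 * n} (0≤* {+ 2} 0≤+ 0≤n) (0≤* {t} 0≤t 0≤η)) (lem₃ n t η))
    (near-* (+ 2) {o * (t * d)} {n * a} {n * (t * η)} 0≤+ h))
  where
  lem₁ : ∀ f t d → + 2 * (f * (t * d)) ≡ f * (+ 2 * t * d)
  lem₁ = solve-∀
  lem₂ : ∀ x q → + 2 * (x * q) ≡ + 2 * x * q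
  lem₂ = solve-∀
  lem₃ : ∀ x t η → + 2 * x * (+ 2 * t * η) ≡ + 2 * (x * (t * η)) + + 2 * x * (t * η)
  lem₃ = solve-∀

near-step : ∀ o f t d n a q η → 0ℤ ≤ t → Near (o * (t * d)) (n * a) (n * (t * η)) → Near (f * d) (n * q) (n * η) →
  Near ((o + f) * (+ 2 * t * d)) (+ 2 * n * (a + t * q)) (+ 2 * n * (+ 2 * t * η))
near-step o f t d n a q η 0≤t h g = near-≡ (lem₁ o f t d) (lem₂ n a t q) (lem₃ n t η)
  (near-+ {+ 2 * (o * (t * d))} {+ 2 * (n * a)} {+ 2 * (n * (t * η))} {+ 2 * t * (f * d)} {+ 2 * t * (n * q)} {+ 2 * t * (n * η)}
    (near-* (+ 2) {o * (t * d)} {n * a} {n * (t * η)} 0≤+ h)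
    (near-* (+ 2 * t) {f * d} {n * q} {n * η} (0≤* {+ 2} 0≤+ 0≤t) g))
  where
  lem₁ : ∀ o f t d → + 2 * (o * (t * d)) + + 2 * t * (f * d) ≡ (o + f) * (+ 2 * t * d)
  lem₁ = solve-∀
  lem₂ : ∀ n a t q → + 2 * (n * a) + + 2 * t * (n * q) ≡ + 2 * n * (a + t * q)
  lem₂ = solve-∀
  lem₃ : ∀ n t η → + 2 * (n * (t * η)) + + 2 * t * (n * η) ≡ + 2 * n * (+ 2 * t * η)
  lem₃ = solve-∀

near-sum : ∀ o f t d n a b η → Near (o * (t * d)) (n * a) (n * (t * η)) → Near (f * (t * d)) (n * b) (n * (t * η)) →
  Near ((o + f) * (+ 2 * t * d)) (+ 2 * n * (a + b)) (+ 2 * n * (+ 2 * t * η))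
near-sum o f t d n a b η h g = near-≡ (lem₁ o f t d) (lem₂ n a b) (lem₃ n t η)
  (near-+ {+ 2 * (o * (t * d))} {+ 2 * (n * a)} {+ 2 * (n * (t * η))} {+ 2 * (f * (t * d))} {+ 2 * (n * b)} {+ 2 * (n * (t * η))}
    (near-* (+ 2) {o * (t * d)} {n * a} {n * (t * η)} 0≤+ h)
    (near-* (+ 2) {f * (t * d)} {n * b} {n * (t * η)} 0≤+ g))
  where
  lem₁ : ∀ o f t d → + 2 * (o * (t * d)) + + 2 * (f * (t * d)) ≡ (o + f) * (+ 2 * t * d)
  lem₁ = solve-∀
  lem₂ : ∀ n a b → + 2 * (n * a) + + 2 * (n * b) ≡ + 2 * n * (a + b)
  lem₂ = solve-∀
  lem₃ : ∀ n t η → + 2 * (n * (t * η)) + + 2 * (n * (t * η)) ≡ + 2 * n * (+ 2 * t * η)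
  lem₃ = solve-∀

-- Sealing the powers of two keeps conversion checking from unfolding integer products.
opaque
  2^ : ℕ → ℤ
  2^ n = (+ 2) ^ n

  2^-def : ∀ n → 2^ n ≡ (+ 2) ^ n
  2^-def n = refl

  2^-suc : ∀ n → 2^ (suc n) ≡ + 2 * 2^ n
  2^-suc n = refl

  0≤2^ : ∀ n → 0ℤ ≤ 2^ n
  0≤2^ n = 0≤^ 2 n

-- If q is the distribution of a random variable Y and i, j are independent geometric variables, then
-- acc₁ q x / 2^(x+1) = P(i + Y = x) and acc₂ q x / 2^(x+2) = P(i + j + Y = x).
acc₁ acc₂ : (ℕ → ℤ) → ℕ → ℤ
acc₁ q zero = q 0
acc₁ q (suc x) = acc₁ q x + 2^ (suc x) * q (suc x)
acc₂ q zero = acc₁ q 0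
acc₂ q (suc x) = acc₂ q x + acc₁ q (suc x)

module Accumulate (D η : ℤ) (0≤η : 0ℤ ≤ η) (q : ℕ → ℤ) (n₀ : ℕ)
  (near : ∀ n x → n₀ ℕ.≤ n → Near (framed n x * D) (2^ n * q x) (2^ n * η)) where

  opened-near : ∀ x n → n₀ ℕ.+ suc x ℕ.≤ n → Near (opened n x * (2^ (suc x) * D)) (2^ n * acc₁ q x) (2^ n * (2^ (suc x) * η))
  opened-near x zero h = contradiction (subst (ℕ._≤ 0) (ℕₚ.+-suc n₀ x) h) λ ()
  opened-near zero (suc n) h = near-≡
    (cong₂ _*_ (sym (opened-zero n)) (cong (_* D) (sym 2^1)))
    (cong (_* q 0) (sym (2^-suc n))) (cong₂ _*_ (sym (2^-suc n)) (cong (_* η) (sym 2^1)))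
    (near-start (framed n 0) D (2^ n) (q 0) η (0≤2^ n) 0≤η (near n 0 (ℕ.s≤s⁻¹ (subst (ℕ._≤ suc n) (ℕₚ.+-comm n₀ 1) h))))
    where
    2^1 : 2^ 1 ≡ + 2 * 1ℤ
    2^1 = trans (2^-suc 0) (cong (+ 2 *_) (2^-def 0))
  opened-near (suc x) (suc n) h = near-≡
    (cong₂ _*_ (sym (opened-suc-suc n x)) (cong (_* D) (sym (2^-suc (suc x)))))
    (cong (_* acc₁ q (suc x)) (sym (2^-suc n))) (cong₂ _*_ (sym (2^-suc n)) (cong (_* η) (sym (2^-suc (suc x)))))
    (near-step (opened n x) (framed n (suc x)) (2^ (suc x)) D (2^ n) (acc₁ q x) (q (suc x)) η (0≤2^ (suc x))
      (opened-near x n h′) (near n (suc x) (ℕₚ.≤-trans (ℕₚ.m≤m+n n₀ (suc x)) h′)))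
    where
    h′ : n₀ ℕ.+ suc x ℕ.≤ n
    h′ = ℕ.s≤s⁻¹ (subst (ℕ._≤ suc n) (ℕₚ.+-suc n₀ (suc x)) h)

  total-near : ∀ x n → n₀ ℕ.+ suc (suc x) ℕ.≤ n → Near (total n x * (2^ (suc (suc x)) * D)) (2^ n * acc₂ q x) (2^ n * (2^ (suc (suc x)) * η))
  total-near x zero h = contradiction (subst (ℕ._≤ 0) (ℕₚ.+-suc n₀ (suc x)) h) λ ()
  total-near x (suc zero) h = contradiction (subst (ℕ._≤ 1) (trans (ℕₚ.+-suc n₀ (suc x)) (cong suc (ℕₚ.+-suc n₀ x))) h) λ { (s≤s ()) }
  total-near zero (suc (suc m)) h = near-≡
    (cong₂ _*_ (sym (total-zero m)) (cong (_* D) (sym (2^-suc 1))))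
    (cong (_* q 0) (sym (2^-suc (suc m)))) (cong₂ _*_ (sym (2^-suc (suc m))) (cong (_* η) (sym (2^-suc 1))))
    (near-double (opened (suc m) 0) (2^ 1) D (2^ (suc m)) (q 0) η (0≤2^ (suc m)) (0≤2^ 1) 0≤η
      (opened-near 0 (suc m) (ℕ.s≤s⁻¹ (subst (ℕ._≤ suc (suc m)) (ℕₚ.+-suc n₀ 1) h))))
  total-near (suc x) (suc (suc m)) h = near-≡
    (cong₂ _*_ (sym (total-suc-suc m x)) (cong (_* D) (sym (2^-suc (suc (suc x))))))
    (cong (_* acc₂ q (suc x)) (sym (2^-suc (suc m)))) (cong₂ _*_ (sym (2^-suc (suc m))) (cong (_* η) (sym (2^-suc (suc (suc x))))))
    (near-sum (total (suc m) x) (opened (suc m) (suc x)) (2^ (suc (suc x))) D (2^ (suc m)) (acc₂ q x) (acc₁ q (suc x)) η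
      (total-near x (suc m) h′) (opened-near (suc x) (suc m) h′))
    where
    h′ : n₀ ℕ.+ suc (suc x) ℕ.≤ suc m
    h′ = ℕ.s≤s⁻¹ (subst (ℕ._≤ suc (suc m)) (ℕₚ.+-suc n₀ (suc (suc x))) h)

-- Closed form of the accumulated distributions.

≡ᵇ-refl : ∀ j → (j ℕ.≡ᵇ j) ≡ true
≡ᵇ-refl zero = refl
≡ᵇ-refl (suc j) = ≡ᵇ-refl j

≡ᵇ-< : ∀ {j x} → x ℕ.< j → (j ℕ.≡ᵇ x) ≡ false
≡ᵇ-< {suc j} {zero} _ = refl
≡ᵇ-< {suc j} {suc x} (s≤s h) = ≡ᵇ-< h

≡ᵇ-> : ∀ {j x} → j ℕ.< x → (j ℕ.≡ᵇ x) ≡ false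
≡ᵇ-> {zero} {suc x} _ = refl
≡ᵇ-> {suc j} {suc x} (s≤s h) = ≡ᵇ-> h

module _ (j : ℕ) where
  private
    δ : ℕ → ℤ
    δ x = 𝟙 (j ℕ.≡ᵇ x)

  acc₁-δ-< : ∀ x → x ℕ.< j → acc₁ δ x ≡ 0ℤ
  acc₁-δ-< zero h rewrite ≡ᵇ-< h = refl
  acc₁-δ-< (suc x) h rewrite acc₁-δ-< x (ℕₚ.<-trans (ℕₚ.n<1+n x) h) | ≡ᵇ-< h = trans (+-identityˡ _) (*-zeroʳ (2^ (suc x)))

  acc₁-δ-≥ : ∀ x → j ℕ.≤ x → acc₁ δ x ≡ (+ 2) ^ j
  acc₁-δ-≥ zero z≤n = refl
  acc₁-δ-≥ (suc x) h with ℕₚ.m≤n⇒m<n∨m≡n h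
  ... | inj₁ j<x rewrite ≡ᵇ-> j<x | acc₁-δ-≥ x (ℕ.s≤s⁻¹ j<x) = trans (cong (λ z → (+ 2) ^ j + z) (*-zeroʳ (2^ (suc x)))) (+-identityʳ _)
  ... | inj₂ refl rewrite acc₁-δ-< x (ℕₚ.n<1+n x) | ≡ᵇ-refl x | 2^-def (suc x) = trans (+-identityˡ _) (*-identityʳ _)

  -- Point masses suffice, because `acc₂` is linear in the distribution: the value for `fringe` is
  -- then a sum over words.
  acc₂-δ : ∀ x → acc₂ δ x ≡ + (suc x ∸ j) * (+ 2) ^ j
  acc₂-δ zero with split 1 j
  ... | inj₁ (s≤s z≤n) = refl
  ... | inj₂ (i , refl) rewrite ℕₚ.0∸n≡0 i = sym (*-zeroˡ ((+ 2) ^ suc i))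
  acc₂-δ (suc x) rewrite acc₂-δ x with ℕₚ.≤-total j (suc x)
  ... | inj₁ j≤ rewrite acc₁-δ-≥ (suc x) j≤ | ℕₚ.+-∸-assoc 1 j≤ = lem (+ (suc x ∸ j)) ((+ 2) ^ j)
    where
    lem : ∀ a b → a * b + b ≡ (+ 1 + a) * b
    lem = solve-∀
  ... | inj₂ x≤j with ℕₚ.m≤n⇒m<n∨m≡n x≤j
  ...   | inj₁ x<j rewrite acc₁-δ-< (suc x) x<j | ℕₚ.m≤n⇒m∸n≡0 x<j | ℕₚ.m≤n⇒m∸n≡0 (ℕₚ.<⇒≤ x<j) = +-identityʳ _
  ...   | inj₂ refl rewrite acc₁-δ-≥ (suc x) ℕₚ.≤-refl | ℕₚ.n∸n≡0 x | ℕₚ.+-∸-assoc 1 (ℕₚ.≤-refl {x}) | ℕₚ.n∸n≡0 x =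
      trans (cong (_+ (+ 2) ^ suc x) (*-zeroˡ ((+ 2) ^ suc x))) (trans (+-identityˡ _) (sym (*-identityˡ _)))

  -- The scale 2^(x+2) of `acc₂` is brought to the common scale 2^12 of `f`; this is where x ≤ 10
  -- comes from.
  f-acc₂ : ∀ x → x ℕ.≤ 10 → f (suc x) j ≡ (+ 2) ^ (10 ∸ x) * acc₂ δ x
  f-acc₂ x x≤10 rewrite acc₂-δ x with split (suc x) j
  ... | inj₂ (i , refl) rewrite ℕₚ.m≤n⇒m∸n≡0 (ℕₚ.m≤m+n (suc x) i) = trans (sym (*-zeroʳ ((+ 2) ^ (10 ∸ x)))) (cong ((+ 2) ^ (10 ∸ x) *_) (sym (*-zeroˡ ((+ 2) ^ suc (x ℕ.+ i)))))
  ... | inj₁ (s≤s j≤x) = begin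
    + (i ℕ.* 2 ℕ.^ (11 ∸ i))                ≡⟨ trans (pos-* i _) (cong (+ i *_) (pos-^ 2 (11 ∸ i))) ⟩
    + i * (+ 2) ^ (11 ∸ i)                  ≡⟨ cong (λ e → + i * (+ 2) ^ e) exponent ⟩
    + i * (+ 2) ^ (10 ∸ x ℕ.+ j)            ≡⟨ cong (+ i *_) (^-+ (+ 2) (10 ∸ x) j) ⟩
    + i * ((+ 2) ^ (10 ∸ x) * (+ 2) ^ j)    ≡⟨ lem (+ i) ((+ 2) ^ (10 ∸ x)) ((+ 2) ^ j) ⟩
    (+ 2) ^ (10 ∸ x) * (+ i * (+ 2) ^ j)    ∎
    where
    open ≡-Reasoning
    i = suc x ∸ j
    lem : ∀ a b c → a * (b * c) ≡ b * (a * c)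
    lem = solve-∀
    exponent : 11 ∸ i ≡ 10 ∸ x ℕ.+ j
    exponent = begin
      11 ∸ (suc x ∸ j)       ≡⟨ cong (11 ∸_) (ℕₚ.+-∸-assoc 1 j≤x) ⟩
      10 ∸ (x ∸ j)           ≡⟨ cong (_∸ (x ∸ j)) (sym (ℕₚ.m∸n+n≡m x≤10)) ⟩
      10 ∸ x ℕ.+ x ∸ (x ∸ j) ≡⟨ ℕₚ.+-∸-assoc (10 ∸ x) (ℕₚ.m∸n≤m x j) ⟩
      10 ∸ x ℕ.+ (x ∸ (x ∸ j)) ≡⟨ cong (10 ∸ x ℕ.+_) (ℕₚ.m∸[m∸n]≡n j≤x) ⟩
      10 ∸ x ℕ.+ j           ∎

acc₁-sumD : ∀ L c (F : List Digit → ℕ → ℤ) x → acc₁ (λ y → sumD L (λ α → F α y) * c) x ≡ sumD L (λ α → acc₁ (F α) x) * c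
acc₁-sumD L c F zero = refl
acc₁-sumD L c F (suc x) = begin
  acc₁ (λ y → sumD L (λ α → F α y) * c) x + t * (B * c) ≡⟨ cong (_+ t * (B * c)) (acc₁-sumD L c F x) ⟩
  A * c + t * (B * c)                                   ≡⟨ lem A c t B ⟩
  (A + t * B) * c                                       ≡⟨ cong (λ z → (A + z) * c) (sym (sumD-* L t (λ α → F α (suc x)))) ⟩
  (A + sumD L (λ α → t * F α (suc x))) * c              ≡⟨ cong (_* c) (sym (sumD-+ L (λ α → acc₁ (F α) x) (λ α → t * F α (suc x)))) ⟩
  sumD L (λ α → acc₁ (F α) x + t * F α (suc x)) * c     ∎
  where
  open ≡-Reasoning
  t = 2^ (suc x)
  A = sumD L (λ α → acc₁ (F α) x)
  B = sumD L (λ α → F α (suc x))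
  lem : ∀ a c t b → a * c + t * (b * c) ≡ (a + t * b) * c
  lem = solve-∀

acc₂-sumD : ∀ L c (F : List Digit → ℕ → ℤ) x → acc₂ (λ y → sumD L (λ α → F α y) * c) x ≡ sumD L (λ α → acc₂ (F α) x) * c
acc₂-sumD L c F zero = refl
acc₂-sumD L c F (suc x) = trans (cong₂ (λ a b → a + b) (acc₂-sumD L c F x) (acc₁-sumD L c F (suc x)))
  (trans (sym (*-distribʳ-+ c A B)) (cong (_* c) (sym (sumD-+ L (λ α → acc₂ (F α) x) (λ α → acc₁ (F α) (suc x))))))
  where
  A = sumD L (λ α → acc₂ (F α) x)
  B = sumD L (λ α → acc₁ (F α) (suc x))

fringes : ℕ → ℕ → ℤ
fringes L x = sumD L (λ α → acc₂ (λ y → 𝟙 (missing (ii ∷ []) L α ℕ.≡ᵇ y)) x)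

-- Divided through: the frequency of x gaps is `fringes L x` / (2^(x+2) 4^L) up to 24 (3/4)^p. The
-- approximation does not involve n, which yields convergence.
fringes-near : ∀ L p x n → suc L ≡ p ℕ.+ p → L ℕ.* 2 ℕ.+ suc (suc x) ℕ.≤ n →
  Near (total n x * (2^ (suc (suc x)) * ((+ 4) ^ L * (+ 4) ^ p))) (2^ n * (fringes L x * (+ 4) ^ p))
       (2^ n * (2^ (suc (suc x)) * (+ 24 * (+ 3) ^ p * (+ 4) ^ L)))
fringes-near L p x n L≡ h = near-≡ refl
  (cong (2^ n *_) (acc₂-sumD L ((+ 4) ^ p) (λ α y → 𝟙 (missing (ii ∷ []) L α ℕ.≡ᵇ y)) x)) refl
  (Accumulate.total-near ((+ 4) ^ L * (+ 4) ^ p) (+ 24 * (+ 3) ^ p * (+ 4) ^ L)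
    (0≤* {+ 24 * (+ 3) ^ p} (0≤* {+ 24} 0≤+ (0≤^ 3 p)) (0≤^ 4 L)) (λ y → fringe L y * (+ 4) ^ p) (L ℕ.* 2) near x n h)
  where
  near : ∀ n x → L ℕ.* 2 ℕ.≤ n → Near (framed n x * ((+ 4) ^ L * (+ 4) ^ p)) (2^ n * (fringe L x * (+ 4) ^ p)) (2^ n * (+ 24 * (+ 3) ^ p * (+ 4) ^ L))
  near n x h rewrite 2^-def n | sym (ℕₚ.m+[n∸m]≡n h) = Fringe.framed-near L p L≡ (n ∸ L ℕ.* 2) x

expectation-f : ∀ L x → x ℕ.≤ 10 → sumD L (λ α → f (suc x) (missing (ii ∷ []) L α)) ≡ (+ 2) ^ (10 ∸ x) * fringes L x
expectation-f L x x≤10 = trans (sumD-cong L λ α _ → f-acc₂ (missing (ii ∷ []) L α) x x≤10)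
  (sumD-* L ((+ 2) ^ (10 ∸ x)) (λ α → acc₂ (λ y → 𝟙 (missing (ii ∷ []) L α ℕ.≡ᵇ y)) x))

-- The size of the difference set in terms of gaps.

unique-length : {A : Set} {xs ys : List A} → Unique xs → Unique ys →
  (∀ {z} → z ∈ xs → z ∈ ys) → (∀ {z} → z ∈ ys → z ∈ xs) → length xs ≡ length ys
unique-length u v f g = ↭-length (∼bag⇒↭ (unique∧set⇒bag u v (mk⇔ f g)))

∈-elemsFrom⁻ : ∀ i s {y} → y ∈ elemsFrom i s → ∃ λ x → y ≡ i ℕ.+ x × s ‼ x ≡ true
∈-elemsFrom⁻ i (false ∷ s) h with ∈-elemsFrom⁻ (suc i) s h
... | x , e , t = suc x , trans e (sym (ℕₚ.+-suc i x)) , t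
∈-elemsFrom⁻ i (true ∷ s) (here refl) = 0 , sym (ℕₚ.+-identityʳ i) , refl
∈-elemsFrom⁻ i (true ∷ s) (there h) with ∈-elemsFrom⁻ (suc i) s h
... | x , e , t = suc x , trans e (sym (ℕₚ.+-suc i x)) , t

∈-elemsFrom⁺ : ∀ i s x → s ‼ x ≡ true → i ℕ.+ x ∈ elemsFrom i s
∈-elemsFrom⁺ i (true ∷ s) zero _ = here (ℕₚ.+-identityʳ i)
∈-elemsFrom⁺ i (false ∷ s) (suc x) t = subst (_∈ elemsFrom (suc i) s) (sym (ℕₚ.+-suc i x)) (∈-elemsFrom⁺ (suc i) s x t)
∈-elemsFrom⁺ i (true ∷ s) (suc x) t = there (subst (_∈ elemsFrom (suc i) s) (sym (ℕₚ.+-suc i x)) (∈-elemsFrom⁺ (suc i) s x t))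

differences : List Bool → List ℤ
differences s = concatMap (λ x → map (λ y → + x - + y) (elems s)) (elems s)

∈-differences⁻ : ∀ s {z} → z ∈ differences s → ∃ λ x → ∃ λ y → s ‼ x ≡ true × s ‼ y ≡ true × z ≡ + x - + y
∈-differences⁻ s h with find (∈-concatMap⁻ (λ x → map (λ y → + x - + y) (elems s)) {xs = elems s} h)
... | a , a∈ , h′ with ∈-map⁻ (λ y → + a - + y) h′
...   | b , b∈ , refl with ∈-elemsFrom⁻ 0 s a∈ | ∈-elemsFrom⁻ 0 s b∈
...     | x , refl , sx | y , refl , sy = x , y , sx , sy , refl

∈-differences⁺ : ∀ s x y → s ‼ x ≡ true → s ‼ y ≡ true → + x - + y ∈ differences s
∈-differences⁺ s x y sx sy = ∈-concatMap⁺ (λ x → map (λ y → + x - + y) (elems s))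
  (lose (∈-elemsFrom⁺ 0 s x sx) (∈-map⁺ (λ y → + x - + y) (∈-elemsFrom⁺ 0 s y sy)))

collect : (ℕ → Bool) → ℕ → List ℕ
collect p zero = []
collect p (suc k) = if p k then k ∷ collect p k else collect p k

∈-collect⁻ : ∀ p k {i} → i ∈ collect p k → i ℕ.< k × p i ≡ true
∈-collect⁻ p (suc k) h with p k in eq
∈-collect⁻ p (suc k) (here refl) | true = ℕₚ.≤-refl , eq
∈-collect⁻ p (suc k) (there h) | true = let a , b = ∈-collect⁻ p k h in ℕₚ.m≤n⇒m≤1+n a , b
∈-collect⁻ p (suc k) h | false = let a , b = ∈-collect⁻ p k h in ℕₚ.m≤n⇒m≤1+n a , b

∈-collect⁺ : ∀ p k {i} → i ℕ.< k → p i ≡ true → i ∈ collect p k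
∈-collect⁺ p (suc k) (s≤s i≤k) t with ℕₚ.m≤n⇒m<n∨m≡n i≤k
... | inj₂ refl rewrite t = here refl
... | inj₁ i<k with p k
...   | true = there (∈-collect⁺ p k i<k t)
...   | false = ∈-collect⁺ p k i<k t

collect-! : ∀ p k → Unique (collect p k)
collect-! p zero = []
collect-! p (suc k) with p k
... | true = All.tabulate (λ h e → ℕₚ.<-irrefl (sym e) (proj₁ (∈-collect⁻ p k h))) ∷ collect-! p k
... | false = collect-! p k

length-collect : ∀ p k → length (collect p k) ≡ count< p k
length-collect p zero = refl
length-collect p (suc k) rewrite count<-last p k with p k
... | true = cong suc (length-collect p k)
... | false = length-collect p k

count<-not : ∀ p k → count< (λ i → not (p i)) k ℕ.+ count< p k ≡ k
count<-not p zero = refl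
count<-not p (suc k) with p 0
... | true = trans (ℕₚ.+-suc _ _) (cong suc (count<-not (λ i → p (suc i)) k))
... | false = cong suc (count<-not (λ i → p (suc i)) k)

all<-false : ∀ p k → all< p k ≡ false → ∃ λ i → p i ≡ false
all<-false p (suc k) h with p 0 in eq
... | false = 0 , eq
... | true = let i , e = all<-false (λ i → p (suc i)) k h in suc i , e

not-false : ∀ {a} → not a ≡ false → a ≡ true
not-false {true} _ = refl

opaque
  unfolding gap
  gap-false : ∀ d s → gap d s ≡ false → ∃ λ x → s ‼ x ≡ true × s ‼ (d ℕ.+ x) ≡ true
  gap-false d s h with all<-false (λ x → not (s ‼ x ∧ s ‼ (d ℕ.+ x))) (length s) h
  ... | x , e = x , ∧-true (not-false e)

present : List Bool → List ℕ
present s = collect (λ i → not (gap (suc i) s)) (length s ∸ 1)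

-- A duplicate-free listing of S - S for nonempty S. Having the same members as the deduplicated
-- list, it has the same length, whatever the order.
canonical : List Bool → List ℤ
canonical s = + 0 ∷ map (λ i → + suc i) (present s) ++ map -[1+_] (present s)

canonical-! : ∀ s → Unique (canonical s)
canonical-! s = All.tabulate zero≢ ∷ Uniqueₚ.++⁺ (Uniqueₚ.map⁺ (λ { refl → refl }) u) (Uniqueₚ.map⁺ (λ { refl → refl }) u) disjoint
  where
  u = collect-! (λ i → not (gap (suc i) s)) (length s ∸ 1)
  zero≢ : ∀ {z} → z ∈ map (λ i → + suc i) (present s) ++ map -[1+_] (present s) → + 0 ≢ z
  zero≢ h refl with ∈-++⁻ (map (λ i → + suc i) (present s)) h
  ... | inj₁ h′ with () ← proj₂ (proj₂ (∈-map⁻ (λ i → + suc i) h′))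
  ... | inj₂ h′ with () ← proj₂ (proj₂ (∈-map⁻ -[1+_] h′))
  disjoint : ∀ {z} → ¬ (z ∈ map (λ i → + suc i) (present s) × z ∈ map -[1+_] (present s))
  disjoint (h , h′) with ∈-map⁻ (λ i → + suc i) h | ∈-map⁻ -[1+_] h′
  ... | _ , _ , refl | _ , _ , ()

‼-true : ∀ s {x} → s ‼ x ≡ true → x ℕ.< length s
‼-true s {x} t with split (length s) x
... | inj₁ x< = x<
... | inj₂ (q , refl) = contradiction (trans (sym t) (‼-beyond s (ℕₚ.m≤m+n _ q))) λ ()

present⁺ : ∀ s y q → s ‼ y ≡ true → s ‼ (suc q ℕ.+ y) ≡ true → q ∈ present s
present⁺ s y q sy sx = ∈-collect⁺ _ (length s ∸ 1) (ℕₚ.≤-trans (s≤s (ℕₚ.m≤m+n q y)) (ℕₚ.∸-monoˡ-≤ 1 (‼-true s sx))) no-gap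
  where
  no-gap : not (gap (suc q) s) ≡ true
  no-gap with gap (suc q) s in eq
  ... | false = refl
  ... | true = contradiction (trans (sym (gap-elim (suc q) s eq y)) (cong₂ _∧_ sy sx)) λ ()

diff-pos : ∀ y q → + (y ℕ.+ q) - + y ≡ + q
diff-pos y q = trans (cong (_- + y) (pos-+ y q)) (lem (+ y) (+ q))
  where
  lem : ∀ y q → y + q - y ≡ q
  lem = solve-∀

diff-neg : ∀ x q → + x - + (suc q ℕ.+ x) ≡ -[1+ q ]
diff-neg x q = trans (cong (λ z → + x - z) (pos-+ (suc q) x)) (lem (+ x) (+ suc q))
  where
  lem : ∀ x q → x - (q + x) ≡ - q
  lem = solve-∀

canonical⁺ : ∀ s {z} → z ∈ differences s → z ∈ canonical s
canonical⁺ s h with ∈-differences⁻ s h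
... | x , y , sx , sy , refl with split y x
...   | inj₂ (zero , refl) = here (diff-pos y 0)
...   | inj₂ (suc q , refl) = there (∈-++⁺ˡ (subst (_∈ map (λ i → + suc i) (present s)) (sym (diff-pos y (suc q)))
        (∈-map⁺ (λ i → + suc i) (present⁺ s y q sy (subst (λ i → s ‼ i ≡ true) (ℕₚ.+-comm y (suc q)) sx)))))
...   | inj₁ x<y with split (suc x) y
...     | inj₁ (s≤s y≤x) = contradiction y≤x (ℕₚ.<⇒≱ x<y)
...     | inj₂ (q , refl) = there (∈-++⁺ʳ _ (subst (_∈ map -[1+_] (present s))
          (sym (trans (cong (λ m → + x - + m) flip) (diff-neg x q)))
          (∈-map⁺ -[1+_] (present⁺ s x q sx (subst (λ i → s ‼ i ≡ true) flip sy)))))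
      where
      flip : suc x ℕ.+ q ≡ suc q ℕ.+ x
      flip = cong suc (ℕₚ.+-comm x q)

canonical⁻ : ∀ s {x₀} → s ‼ x₀ ≡ true → ∀ {z} → z ∈ canonical s → z ∈ differences s
canonical⁻ s {x₀} t (here refl) = subst (_∈ differences s) (+-inverseʳ (+ x₀)) (∈-differences⁺ s x₀ x₀ t t)
canonical⁻ s t (there h) with ∈-++⁻ (map (λ i → + suc i) (present s)) h
... | inj₁ h′ with ∈-map⁻ (λ i → + suc i) h′
...   | q , q∈ , refl with gap-false (suc q) s (not-true (proj₂ (∈-collect⁻ _ (length s ∸ 1) q∈)))
...     | y , sy , sx = subst (_∈ differences s) (trans (cong (λ m → + m - + y) (ℕₚ.+-comm (suc q) y)) (diff-pos y (suc q))) (∈-differences⁺ s (suc q ℕ.+ y) y sx sy)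
canonical⁻ s t (there h) | inj₂ h′ with ∈-map⁻ -[1+_] h′
...   | q , q∈ , refl with gap-false (suc q) s (not-true (proj₂ (∈-collect⁻ _ (length s ∸ 1) q∈)))
...     | y , sy , sx = subst (_∈ differences s) (diff-neg y q) (∈-differences⁺ s y (suc q ℕ.+ y) sy sx)

-- With p positive differences present and g absent, |S - S| = 2p + 1 and n = p + g + 1, so 2n - 1 -
-- |S - S| = 2g. A member of S is needed for the difference 0.
diffCard-gaps : ∀ s {x₀} → s ‼ x₀ ≡ true → 2 ℕ.* length s ∸ 1 ∸ diffCard s ≡ 2 ℕ.* gaps s
diffCard-gaps s {x₀} t = trans (cong₂ (λ a b → 2 ℕ.* a ∸ 1 ∸ b) len card) (trans (cong (_∸ suc (p ℕ.+ p)) (cong (_∸ 1) (lem p g)))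
  (ℕₚ.m+n∸m≡n (suc (p ℕ.+ p)) (2 ℕ.* g)))
  where
  p = length (present s)
  g = gaps s
  len : length s ≡ suc (p ℕ.+ g)
  len = trans (sym (ℕₚ.m+[n∸m]≡n (ℕₚ.≤-trans (s≤s z≤n) (‼-true s t))))
    (cong suc (sym (trans (cong (ℕ._+ g) (length-collect _ (length s ∸ 1))) (count<-not (λ i → gap (suc i) s) (length s ∸ 1)))))
  card : diffCard s ≡ suc (p ℕ.+ p)
  card = trans (unique-length (deduplicate-! (differences s)) (canonical-! s)
      (λ h → canonical⁺ s (∈-deduplicate⁻ ℤ._≟_ (differences s) h))
      (λ h → ∈-deduplicate⁺ ℤ._≟_ (canonical⁻ s t h)))
    (cong suc (trans (length-++ (map (λ i → + suc i) (present s))) (cong₂ ℕ._+_ (length-map (λ i → + suc i) (present s)) (length-map -[1+_] (present s)))))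
  lem : ∀ p g → 2 ℕ.* suc (p ℕ.+ g) ≡ suc (suc (p ℕ.+ p) ℕ.+ 2 ℕ.* g)
  lem = solve-∀ₙ

inhabited? : ∀ s → (∃ λ x → s ‼ x ≡ true) ⊎ (elems s ≡ [] × ∀ x → s ‼ x ≡ false)
inhabited? s = go 0 s
  where
  go : ∀ i s → (∃ λ x → s ‼ x ≡ true) ⊎ (elemsFrom i s ≡ [] × ∀ x → s ‼ x ≡ false)
  go i [] = inj₂ (refl , λ _ → refl)
  go i (true ∷ s) = inj₁ (0 , refl)
  go i (false ∷ s) with go (suc i) s
  ... | inj₁ (x , t) = inj₁ (suc x , t)
  ... | inj₂ (e , h) = inj₂ (e , λ { zero → refl ; (suc x) → h x })

diffCard-empty : ∀ s → elems s ≡ [] → diffCard s ≡ 0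
diffCard-empty s e rewrite e = refl

gaps-empty : ∀ s → (∀ x → s ‼ x ≡ false) → gaps s ≡ length s ∸ 1
gaps-empty s h = count<-all _ (length s ∸ 1) λ i _ → gap-intro (suc i) s λ x → cong (_∧ s ‼ (suc i ℕ.+ x)) (h x)

-- The counts of subsets as sums over words.

sumL-++ : ∀ {X : Set} (xs ys : List X) F → sumL (xs ++ ys) F ≡ sumL xs F + sumL ys F
sumL-++ [] ys F = sym (+-identityˡ _)
sumL-++ (x ∷ xs) ys F = trans (cong (λ z → F x + z) (sumL-++ xs ys F)) (sym (+-assoc (F x) _ _))

sumL-concatMap : ∀ {X Y : Set} (g : X → List Y) xs F → sumL (concatMap g xs) F ≡ sumL xs (λ x → sumL (g x) F)
sumL-concatMap g [] F = refl
sumL-concatMap g (x ∷ xs) F = trans (sumL-++ (g x) (concatMap g xs) F) (cong (λ z → sumL (g x) F + z) (sumL-concatMap g xs F))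

sumL-subsets : ∀ n F → sumL (subsets n) F ≡ sumB n F
sumL-subsets zero F = +-identityʳ (F [])
sumL-subsets (suc n) F = trans (sumL-concatMap (λ s → (false ∷ s) ∷ (true ∷ s) ∷ []) (subsets n) F)
  (trans (sumL-subsets n _) (trans (sumB-cong n λ s _ → sym (sumL-bits (λ b → F (b ∷ s)))) (sumB-sumL n bits (λ b s → F (b ∷ s)))))

length-filter : ∀ {X : Set} {P : X → Set} (P? : ∀ x → Dec (P x)) xs → + length (filter P? xs) ≡ sumL xs (λ x → 𝟙 (does (P? x)))
length-filter P? [] = refl
length-filter P? (x ∷ xs) with does (P? x)
... | true = trans (pos-+ 1 (length (filter P? xs))) (cong (λ z → 1ℤ + z) (length-filter P? xs))
... | false = trans (length-filter P? xs) (sym (+-identityˡ _))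

count-sum : ∀ n k → + count n k ≡ sumB n (λ s → 𝟙 (does (2 ℕ.* n ∸ 1 ∸ diffCard s ℕₚ.≟ k)))
count-sum n k = trans (length-filter (λ s → 2 ℕ.* n ∸ 1 ∸ diffCard s ℕₚ.≟ k) (subsets n)) (sumL-subsets n _)

-- Only the empty set misses an odd number of differences (namely 2n - 1).
count-even : ∀ n x → suc (suc x) ℕ.≤ n → + count n (2 ℕ.* x) ≡ total n x
count-even n x x<n = trans (count-sum n (2 ℕ.* x)) (trans (sumB-cong n λ s l → cong 𝟙 (same s l)) (sym (total-def n x)))
  where
  same : ∀ s → length s ≡ n → does (2 ℕ.* n ∸ 1 ∸ diffCard s ℕₚ.≟ 2 ℕ.* x) ≡ (gaps s ℕ.≡ᵇ x)
  same s refl with inhabited? s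
  ... | inj₁ (x₀ , t) rewrite diffCard-gaps s t = double (gaps s) x
    where
    double : ∀ a b → (2 ℕ.* a ℕ.≡ᵇ 2 ℕ.* b) ≡ (a ℕ.≡ᵇ b)
    double a b with ℕₚ.<-cmp a b
    ... | tri< a<b _ _ = trans (≡ᵇ-> (ℕₚ.*-monoʳ-< 2 a<b)) (sym (≡ᵇ-> a<b))
    ... | tri≈ _ refl _ = trans (≡ᵇ-refl (2 ℕ.* a)) (sym (≡ᵇ-refl a))
    ... | tri> _ _ b<a = trans (≡ᵇ-< (ℕₚ.*-monoʳ-< 2 b<a)) (sym (≡ᵇ-< b<a))
  -- For the empty set the left side compares 2n - 1 with 2x, the right side n - 1 with x; n ≥ x + 2
  -- makes both comparisons false.
  ... | inj₂ (e , h) rewrite diffCard-empty s e | gaps-empty s h = trans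
      (≡ᵇ-< (ℕₚ.≤-trans (ℕₚ.m≤n+m _ 2) (ℕₚ.≤-trans (ℕₚ.≤-reflexive (cong (_∸ 1) (lem x))) (ℕₚ.∸-monoˡ-≤ 1 (ℕₚ.*-monoʳ-≤ 2 x<n)))))
      (sym (≡ᵇ-< (ℕₚ.∸-monoˡ-≤ 1 x<n)))
    where
    lem : ∀ x → suc (suc (suc (suc (2 ℕ.* x)))) ≡ 2 ℕ.* suc (suc x)
    lem = solve-∀ₙ

count-odd : ∀ n x → suc (suc x) ℕ.≤ n → count n (suc (2 ℕ.* x)) ≡ 0
count-odd n x x<n = +-injective (trans (count-sum n (suc (2 ℕ.* x))) (trans (sumB-cong n λ s l → cong 𝟙 (never s l)) (sumB-zero n)))
  where
  never : ∀ s → length s ≡ n → does (2 ℕ.* n ∸ 1 ∸ diffCard s ℕₚ.≟ suc (2 ℕ.* x)) ≡ false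
  never s refl with inhabited? s
  ... | inj₁ (x₀ , t) rewrite diffCard-gaps s t = dec-false (2 ℕ.* gaps s ℕₚ.≟ suc (2 ℕ.* x)) (odd (gaps s) x)
    where
    odd : ∀ a b → 2 ℕ.* a ≢ suc (2 ℕ.* b)
    odd a b e with ℕₚ.≤-total a b
    ... | inj₁ a≤b = ℕₚ.<⇒≢ (s≤s (ℕₚ.*-monoʳ-≤ 2 a≤b)) e
    ... | inj₂ b≤a with ℕₚ.m≤n⇒m<n∨m≡n b≤a
    ...   | inj₁ b<a = ℕₚ.<⇒≢ (ℕₚ.≤-trans (ℕₚ.≤-trans (ℕₚ.≤-reflexive (lem b)) (ℕₚ.*-monoʳ-≤ 2 b<a)) ℕₚ.≤-refl) (sym e)
      where
      lem : ∀ b → suc (suc (2 ℕ.* b)) ≡ 2 ℕ.* suc b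
      lem = solve-∀ₙ
    ...   | inj₂ refl = ℕₚ.<⇒≢ (ℕₚ.n<1+n (2 ℕ.* b)) e
  ... | inj₂ (e , h) rewrite diffCard-empty s e = dec-false (2 ℕ.* length s ∸ 1 ℕₚ.≟ suc (2 ℕ.* x)) λ eq →
      ℕₚ.<⇒≢ (ℕₚ.≤-trans (ℕₚ.n≤1+n _) (ℕₚ.≤-trans (ℕₚ.≤-reflexive (cong (_∸ 1) (lem x))) (ℕₚ.∸-monoˡ-≤ 1 (ℕₚ.*-monoʳ-≤ 2 x<n)))) (sym eq)
    where
    lem : ∀ x → suc (suc (suc (suc (2 ℕ.* x)))) ≡ 2 ℕ.* suc (suc x)
    lem = solve-∀ₙ

-- Comparison of fractions, and convergence.

/-≤ : ∀ a c d e .{{_ : ℕ.NonZero d}} .{{_ : ℕ.NonZero e}} → a * + e ≤ c * + d → a ℚ./ d ℚ.≤ c ℚ./ e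
/-≤ a c (suc d) (suc e) h = ℚₚ.toℚᵘ-cancel-≤ (ℚᵘₚ.≤-respˡ-≃ (ℚᵘₚ.≃-sym (ℚₚ.toℚᵘ-fromℚᵘ (mkℚᵘ a d)))
  (ℚᵘₚ.≤-respʳ-≃ (ℚᵘₚ.≃-sym (ℚₚ.toℚᵘ-fromℚᵘ (mkℚᵘ c e))) (ℚᵘ.*≤* h)))

/-< : ∀ a c d e .{{_ : ℕ.NonZero d}} .{{_ : ℕ.NonZero e}} → a * + e < c * + d → a ℚ./ d ℚ.< c ℚ./ e
/-< a c (suc d) (suc e) h = ℚₚ.toℚᵘ-cancel-< (ℚᵘₚ.<-respˡ-≃ (ℚᵘₚ.≃-sym (ℚₚ.toℚᵘ-fromℚᵘ (mkℚᵘ a d)))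
  (ℚᵘₚ.<-respʳ-≃ (ℚᵘₚ.≃-sym (ℚₚ.toℚᵘ-fromℚᵘ (mkℚᵘ c e))) (ℚᵘ.*<* h)))

numerator-pos : ∀ ε → 0ℚ ℚ.< ε → + 1 ≤ ℚ.↥ ε
numerator-pos ε (ℚ.*<* h) with ℚ.↥ ε | subst (0ℤ <_) (*-identityʳ (ℚ.↥ ε)) h
... | + n | +<+ 0<n = +≤+ 0<n

denominator-pos : ∀ ε → 1 ℕ.≤ ℚ.↧ₙ ε
denominator-pos ε@record{} = s≤s z≤n

-- The hypothesis bounds the difference by 2/(3 · `↧ₙ ε`), which is less than 1/`↧ₙ ε`; and ε is at
-- least that, since its numerator is at least 1.
/-distance : ∀ a b d e ε .{{_ : ℕ.NonZero d}} .{{_ : ℕ.NonZero e}} → 0ℚ ℚ.< ε →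
  a * + e * + (3 ℕ.* ℚ.↧ₙ ε) ≤ b * + d * + (3 ℕ.* ℚ.↧ₙ ε) + + 2 * (+ d * + e) → a ℚ./ d ℚ.- b ℚ./ e ℚ.< ε
/-distance a b (suc d) (suc e) ε@record{} 0<ε h = ℚₚ.toℚᵘ-cancel-< (ℚᵘₚ.<-respˡ-≃ (ℚᵘₚ.≃-sym difference) (ℚᵘ.*<* bound))
  where
  open ≤-Reasoning
  E = ℚ.↧ ε
  de = + suc d * + suc e
  difference : ℚ.toℚᵘ (a ℚ./ suc d ℚ.- b ℚ./ suc e) ℚᵘ.≃ mkℚᵘ a d ℚᵘ.- mkℚᵘ b e
  difference = ℚᵘₚ.≃-trans (ℚₚ.toℚᵘ-homo-+ (a ℚ./ suc d) (ℚ.- (b ℚ./ suc e)))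
    (ℚᵘₚ.+-cong (ℚₚ.toℚᵘ-fromℚᵘ (mkℚᵘ a d)) (ℚᵘₚ.≃-trans (ℚₚ.toℚᵘ-homo‿- (b ℚ./ suc e)) (ℚᵘₚ.-‿cong (ℚₚ.toℚᵘ-fromℚᵘ (mkℚᵘ b e)))))
  lem₁ : ∀ a b d e E → (a * e + - b * d) * E * + 3 ≡ a * e * (+ 3 * E) - b * d * (+ 3 * E)
  lem₁ = solve-∀
  lem₂ : ∀ x y → x + y - x ≡ y
  lem₂ = solve-∀
  bound : (a * + suc e + - b * + suc d) * E < ℚ.↥ ε * + (suc d ℕ.* suc e)
  bound = *-cancelʳ-<-nonNeg (+ 3) (begin-strict
    (a * + suc e + - b * + suc d) * E * + 3 ≡⟨ lem₁ a b (+ suc d) (+ suc e) E ⟩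
    a * + suc e * (+ 3 * E) - b * + suc d * (+ 3 * E)
      ≡⟨ cong (λ z → a * + suc e * z - b * + suc d * z) (sym (pos-* 3 (ℚ.↧ₙ ε))) ⟩
    a * + suc e * + (3 ℕ.* ℚ.↧ₙ ε) - b * + suc d * + (3 ℕ.* ℚ.↧ₙ ε) ≤⟨ +-monoˡ-≤ (- (b * + suc d * + (3 ℕ.* ℚ.↧ₙ ε))) h ⟩
    b * + suc d * + (3 ℕ.* ℚ.↧ₙ ε) + + 2 * de - b * + suc d * + (3 ℕ.* ℚ.↧ₙ ε) ≡⟨ lem₂ (b * + suc d * + (3 ℕ.* ℚ.↧ₙ ε)) (+ 2 * de) ⟩
    + 2 * de <⟨ *-monoʳ-<-pos de {+ 2} {+ 3} (+<+ ℕₚ.≤-refl) ⟩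
    + 3 * de ≡⟨ *-comm (+ 3) de ⟩
    de * + 3 ≡⟨ cong (_* + 3) (sym (trans (cong (+ 1 *_) (pos-* (suc d) (suc e))) (*-identityˡ de))) ⟩
    + 1 * + (suc d ℕ.* suc e) * + 3 ≤⟨ *-monoʳ-≤-nonNeg (+ 3) (*-monoʳ-≤-nonNeg (+ (suc d ℕ.* suc e)) (numerator-pos ε 0<ε)) ⟩
    ℚ.↥ ε * + (suc d ℕ.* suc e) * + 3 ∎)

-- For every accuracy 1/K some fraction q/D is that close to all late probabilities. The fraction
-- may change with K: the limit itself is never named, and two late probabilities differ by at most
-- 2/K.
Approximable : ℕ → Set
Approximable k = ∀ K → 1 ℕ.≤ K → ∃ λ N → Σ ℤ λ q → Σ ℤ λ D → Positive D ×
  (∀ n → N ℕ.≤ n → Near (+ count n k * D * + K) ((+ 2) ^ n * q * + K) ((+ 2) ^ n * D))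

∣-∣-< : ∀ {a b ε} → a ℚ.- b ℚ.< ε → b ℚ.- a ℚ.< ε → ℚ.∣ a ℚ.- b ∣ ℚ.< ε
∣-∣-< {a} {b} {ε} h g = cases (ℚₚ.∣p∣≡p∨∣p∣≡-p (a ℚ.- b))
  where
  flip : ℚ.- (a ℚ.- b) ≡ b ℚ.- a
  flip = trans (ℚₚ.neg-distrib-+ a (ℚ.- b)) (trans (cong (ℚ.- a ℚ.+_) (⁻¹-involutive b)) (ℚₚ.+-comm (ℚ.- a) b))
  cases : ℚ.∣ a ℚ.- b ∣ ≡ a ℚ.- b ⊎ ℚ.∣ a ℚ.- b ∣ ≡ ℚ.- (a ℚ.- b) → ℚ.∣ a ℚ.- b ∣ ℚ.< ε
  cases (inj₁ e) = subst (ℚ._< ε) (sym e) h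
  cases (inj₂ e) = subst (ℚ._< ε) (sym (trans e flip)) g

near-cross : ∀ a b X Y q D K .{{_ : Positive D}} → 0ℤ ≤ X → 0ℤ ≤ Y →
  Near (a * D * K) (X * q * K) (X * D) → Near (b * D * K) (Y * q * K) (Y * D) → a * Y * K ≤ b * X * K + + 2 * (X * Y)
near-cross a b X Y q D K 0≤X 0≤Y h g = *-cancelʳ-≤-pos (a * Y * K) (b * X * K + + 2 * (X * Y)) D (begin
  a * Y * K * D               ≡⟨ lem₁ a Y K D ⟩
  Y * (a * D * K)             ≤⟨ *-monoˡ Y 0≤Y (above h) ⟩
  Y * (X * q * K + X * D)     ≡⟨ lem₂ Y X q K D ⟩
  X * (Y * q * K) + X * Y * D ≤⟨ +-monoˡ-≤ (X * Y * D) (*-monoˡ X 0≤X (below g)) ⟩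
  X * (b * D * K + Y * D) + X * Y * D ≡⟨ lem₃ X b D K Y ⟩
  (b * X * K + + 2 * (X * Y)) * D ∎)
  where
  open ≤-Reasoning
  lem₁ : ∀ a y k d → a * y * k * d ≡ y * (a * d * k)
  lem₁ = solve-∀
  lem₂ : ∀ y x q k d → y * (x * q * k + x * d) ≡ x * (y * q * k) + x * y * d
  lem₂ = solve-∀
  lem₃ : ∀ x b d k y → x * (b * d * k + y * d) + x * y * d ≡ (b * x * k + + 2 * (x * y)) * d
  lem₃ = solve-∀

prob-distance : ∀ k q D ε m n .{{_ : Positive D}} → 0ℚ ℚ.< ε → let K = 3 ℕ.* ℚ.↧ₙ ε in
  Near (+ count m k * D * + K) ((+ 2) ^ m * q * + K) ((+ 2) ^ m * D) →
  Near (+ count n k * D * + K) ((+ 2) ^ n * q * + K) ((+ 2) ^ n * D) → prob m k ℚ.- prob n k ℚ.< ε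
prob-distance k q D ε m n 0<ε h g = /-distance (+ count m k) (+ count n k) (2 ℕ.^ m) (2 ℕ.^ n) ε {{ℕₚ.m^n≢0 2 m}} {{ℕₚ.m^n≢0 2 n}} 0<ε
  (subst₂ (λ x y → + count m k * y * + (3 ℕ.* ℚ.↧ₙ ε) ≤ + count n k * x * + (3 ℕ.* ℚ.↧ₙ ε) + + 2 * (x * y)) (sym (pos-^ 2 m)) (sym (pos-^ 2 n))
    (near-cross (+ count m k) (+ count n k) ((+ 2) ^ m) ((+ 2) ^ n) q D (+ (3 ℕ.* ℚ.↧ₙ ε)) (0≤^ 2 m) (0≤^ 2 n) h g))

approximable⇒converges : ∀ k → Approximable k → Converges (λ n → prob n k)
approximable⇒converges k approx ε 0<ε = conclude (approx (3 ℕ.* ℚ.↧ₙ ε) (ℕₚ.≤-trans (denominator-pos ε) (ℕₚ.m≤m+n _ _)))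
  where
  K = 3 ℕ.* ℚ.↧ₙ ε
  conclude : (∃ λ N → Σ ℤ λ q → Σ ℤ λ D → Positive D ×
      (∀ n → N ℕ.≤ n → Near (+ count n k * D * + K) ((+ 2) ^ n * q * + K) ((+ 2) ^ n * D))) →
    ∃ λ N → ∀ m n → N ℕ.≤ m → N ℕ.≤ n → ℚ.∣ prob m k ℚ.- prob n k ∣ ℚ.< ε
  conclude (N , q , D , D>0 , near) = N , λ m n N≤m N≤n → ∣-∣-< {prob m k} {prob n k}
    (prob-distance k q D ε m n {{D>0}} 0<ε (near m N≤m) (near n N≤n)) (prob-distance k q D ε n m {{D>0}} 0<ε (near n N≤n) (near m N≤m))

-- Bernoulli's inequality (4/3)^p ≥ 1 + p/3.
power-gap : ∀ p → + (p ℕ.+ 3) * (+ 3) ^ p ≤ + 3 * (+ 4) ^ p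
power-gap zero = ≤-refl
power-gap (suc p) = begin
  + (suc p ℕ.+ 3) * (+ 3 * T)     ≤⟨ ≤-by (+ p * T) (0≤* {+ p} 0≤+ (0≤^ 3 p)) (trans (cong (λ z → + 4 * (z * T)) (pos-+ p 3)) (trans (lem (+ p) T) (cong (λ z → z * (+ 3 * T) + + p * T) (sym (pos-+ (suc p) 3))))) ⟩
  + 4 * (+ (p ℕ.+ 3) * T)         ≤⟨ *-monoˡ (+ 4) 0≤+ (power-gap p) ⟩
  + 4 * (+ 3 * (+ 4) ^ p)         ≡⟨ lem₂ ((+ 4) ^ p) ⟩
  + 3 * (+ 4 * (+ 4) ^ p)         ∎
  where
  open ≤-Reasoning
  T = (+ 3) ^ p
  lem : ∀ p t → + 4 * ((p + + 3) * t) ≡ (+ 1 + p + + 3) * (+ 3 * t) + p * t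
  lem = solve-∀
  lem₂ : ∀ x → + 4 * (+ 3 * x) ≡ + 3 * (+ 4 * x)
  lem₂ = solve-∀

module Even (x L p K : ℕ) (L≡ : suc L ≡ p ℕ.+ p) (small : + 24 * (+ 3) ^ p * + K ≤ (+ 4) ^ p) where
  q T D : ℤ
  q = fringes L x * (+ 4) ^ p
  T = 2^ (suc (suc x))
  D = T * ((+ 4) ^ L * (+ 4) ^ p)

  D>0 : Positive D
  D>0 = subst Positive (trans (pos-* t (l ℕ.* r)) (cong₂ _*_ (trans (pos-^ 2 (suc (suc x))) (sym (2^-def (suc (suc x)))))
      (trans (pos-* l r) (cong₂ _*_ (pos-^ 4 L) (pos-^ 4 p)))))
    (positive (+<+ (ℕₚ.*-mono-≤ (ℕₚ.m^n>0 2 (suc (suc x))) (ℕₚ.*-mono-≤ (ℕₚ.m^n>0 4 L) (ℕₚ.m^n>0 4 p)))))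
    where
    t = 2 ℕ.^ suc (suc x)
    l = 4 ℕ.^ L
    r = 4 ℕ.^ p

  near : ∀ n → L ℕ.* 2 ℕ.+ suc (suc x) ℕ.≤ n → Near (+ count n (2 ℕ.* x) * D * + K) ((+ 2) ^ n * q * + K) ((+ 2) ^ n * D)
  near n h = near-≡
    (trans (*-comm (+ K) (total n x * D)) (cong (λ z → z * D * + K) (sym (count-even n x (ℕₚ.≤-trans (ℕₚ.m≤n+m _ (L ℕ.* 2)) h)))))
    (trans (*-comm (+ K) (2^ n * q)) (cong (λ z → z * q * + K) (2^-def n))) refl
    (near-weaken error (near-* (+ K) 0≤+ (fringes-near L p x n L≡ h)))
    where
    open ≤-Reasoning
    lem : ∀ k n t s L → k * (n * (t * (+ 24 * s * L))) ≡ n * (t * (L * (+ 24 * s * k)))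
    lem = solve-∀
    error : + K * (2^ n * (T * (+ 24 * (+ 3) ^ p * (+ 4) ^ L))) ≤ (+ 2) ^ n * D
    error = begin
      + K * (2^ n * (T * (+ 24 * (+ 3) ^ p * (+ 4) ^ L)))  ≡⟨ lem (+ K) (2^ n) T ((+ 3) ^ p) ((+ 4) ^ L) ⟩
      2^ n * (T * ((+ 4) ^ L * (+ 24 * (+ 3) ^ p * + K)))  ≤⟨ *-monoˡ (2^ n) (0≤2^ n) (*-monoˡ T (0≤2^ (suc (suc x))) (*-monoˡ ((+ 4) ^ L) (0≤^ 4 L) small)) ⟩
      2^ n * D                                             ≡⟨ cong (_* D) (2^-def n) ⟩
      (+ 2) ^ n * D ∎

-- Bernoulli gives (4/3)^p ≥ p/3, and p/3 = 24 K is what is required; hence 72 = 3 · 24.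
power-small : ∀ K p → p ≡ 72 ℕ.* K → + 24 * (+ 3) ^ p * + K ≤ (+ 4) ^ p
power-small K p p≡ = *-cancelˡ-≤-pos (+ 24 * (+ 3) ^ p * + K) ((+ 4) ^ p) (+ 3) (begin
  + 3 * (+ 24 * (+ 3) ^ p * + K) ≡⟨ lem ((+ 3) ^ p) (+ K) ⟩
  + 72 * + K * (+ 3) ^ p         ≡⟨ cong (_* (+ 3) ^ p) (trans (sym (pos-* 72 K)) (cong +_ (sym p≡))) ⟩
  + p * (+ 3) ^ p                ≤⟨ *-monoʳ-≤-nonNeg ((+ 3) ^ p) {{nonNegative (0≤^ 3 p)}} (+≤+ (ℕₚ.m≤m+n p 3)) ⟩
  + (p ℕ.+ 3) * (+ 3) ^ p        ≤⟨ power-gap p ⟩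
  + 3 * (+ 4) ^ p                ∎)
  where
  open ≤-Reasoning
  lem : ∀ t k → + 3 * (+ 24 * t * k) ≡ + 72 * k * t
  lem = solve-∀

even-approximable : ∀ x → Approximable (2 ℕ.* x)
even-approximable x K K≥1 = go (72 ℕ.* K) refl (72 ℕ.* K ℕ.+ 72 ℕ.* K ∸ 1)
    (ℕₚ.m+[n∸m]≡n (ℕₚ.≤-trans K≥1 (ℕₚ.≤-trans (ℕₚ.m≤n*m K 72) (ℕₚ.m≤m+n (72 ℕ.* K) (72 ℕ.* K)))))
  where
  go : ∀ p → p ≡ 72 ℕ.* K → ∀ L → suc L ≡ p ℕ.+ p → ∃ λ N → Σ ℤ λ q → Σ ℤ λ D → Positive D ×
    (∀ n → N ℕ.≤ n → Near (+ count n (2 ℕ.* x) * D * + K) ((+ 2) ^ n * q * + K) ((+ 2) ^ n * D))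
  go p p≡ L L≡ = L ℕ.* 2 ℕ.+ suc (suc x) , Even.q x L p K L≡ small , Even.D x L p K L≡ small , Even.D>0 x L p K L≡ small , Even.near x L p K L≡ small
    where small = power-small K p p≡

odd-approximable : ∀ x → Approximable (suc (2 ℕ.* x))
odd-approximable x K _ = suc (suc x) , 0ℤ , 1ℤ , _ , near
  where
  near : ∀ n → suc (suc x) ℕ.≤ n → Near (+ count n (suc (2 ℕ.* x)) * 1ℤ * + K) ((+ 2) ^ n * 0ℤ * + K) ((+ 2) ^ n * 1ℤ)
  near n h = near-≡ {0ℤ} {0ℤ} {(+ 2) ^ n} (cong (λ c → + c * 1ℤ * + K) (sym (count-odd n x h))) (cong (_* + K) (sym (*-zeroʳ ((+ 2) ^ n))))
    (sym (*-identityʳ ((+ 2) ^ n))) (within 0≤0+2ⁿ 0≤0+2ⁿ)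
    where
    0≤0+2ⁿ : 0ℤ ≤ 0ℤ + (+ 2) ^ n
    0≤0+2ⁿ = ≤-trans (0≤^ 2 n) (≤-reflexive (sym (+-identityˡ ((+ 2) ^ n))))

half : ∀ k → (∃ λ x → k ≡ 2 ℕ.* x) ⊎ (∃ λ x → k ≡ suc (2 ℕ.* x))
half zero = inj₁ (0 , refl)
half (suc k) with half k
... | inj₁ (x , refl) = inj₂ (x , refl)
... | inj₂ (x , refl) = inj₁ (suc x , cong suc (sym (ℕₚ.+-suc x (x ℕ.+ 0))))

prob-converges : ∀ k → Converges (λ n → prob n k)
prob-converges k = approximable⇒converges k (cases (half k))
  where
  cases : (∃ λ x → k ≡ 2 ℕ.* x) ⊎ (∃ λ x → k ≡ suc (2 ℕ.* x)) → Approximable k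
  cases (inj₁ (x , e)) = subst Approximable (sym e) (even-approximable x)
  cases (inj₂ (x , e)) = subst Approximable (sym e) (odd-approximable x)

-- From the table to bounds on the probabilities.

module Numeric (x L p w : ℕ) (rs : List Row) (x≤10 : x ℕ.≤ 10) (L≡ : suc L ≡ p ℕ.+ p) (bounds : Bounds (ii ∷ []) w L (suc x) rs)
               (n : ℕ) (n≥ : L ℕ.* 2 ℕ.+ suc (suc x) ℕ.≤ n) where
  private
    c T X F W V U S : ℤ
    c = (+ 2) ^ (10 ∸ x)
    T = 2^ (suc (suc x))
    X = 2^ n
    F = fringes L x
    W = + w * (+ 2) ^ 12
    V = value slope (suc x) rs
    U = value rise (suc x) rs
    S = total n x

    -- The exponents 10 - x and x + 2 add up to 12, so the normalisation W is the same for all x.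
    c*T : c * T ≡ (+ 2) ^ 12
    c*T = trans (cong (c *_) (2^-def (suc (suc x)))) (trans (sym (^-+ (+ 2) (10 ∸ x) (suc (suc x))))
      (cong ((+ 2) ^_) (trans (ℕₚ.+-suc (10 ∸ x) (suc x)) (cong suc (trans (ℕₚ.+-suc (10 ∸ x) x) (cong suc (ℕₚ.m∸n+n≡m x≤10)))))))

    near : Near (S * (T * ((+ 4) ^ L * (+ 4) ^ p))) (X * (F * (+ 4) ^ p)) (X * (T * (+ 24 * (+ 3) ^ p * (+ 4) ^ L)))
    near = fringes-near L p x n L≡ n≥

    0≤c : 0ℤ ≤ c
    0≤c = 0≤^ 2 (10 ∸ x)

    0≤w*c : 0ℤ ≤ + w * c
    0≤w*c = 0≤* {+ w} 0≤+ 0≤c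

    V≤ : (+ 4) ^ L * V ≤ + w * (c * F)
    V≤ = subst (λ z → (+ 4) ^ L * V ≤ + w * z) (expectation-f L x x≤10) (lower bounds)

    ≤U : + w * (c * F) ≤ (+ 4) ^ L * U
    ≤U = subst (λ z → + w * z ≤ (+ 4) ^ L * U) (expectation-f L x x≤10) (upper bounds)

    lem₁ : ∀ L X V p → L * (X * (V * p)) ≡ X * p * (L * V)
    lem₁ = solve-∀
    lem₂ : ∀ X p w c F → X * p * (w * (c * F)) ≡ w * c * (X * (F * p))
    lem₂ = solve-∀
    lem₃ : ∀ w c S T L p X t → w * c * (S * (T * (L * p)) + X * (T * (+ 24 * t * L))) ≡ L * (S * (w * (c * T) * p) + X * (+ 24 * t * (w * (c * T))))
    lem₃ = solve-∀
    lem₄ : ∀ w c S T L p → L * (S * (w * (c * T) * p)) ≡ w * c * (S * (T * (L * p)))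
    lem₄ = solve-∀
    lem₅ : ∀ w c F T L p X t → w * c * (X * (F * p) + X * (T * (+ 24 * t * L))) ≡ X * p * (w * (c * F)) + L * (X * (+ 24 * t * (w * (c * T))))
    lem₅ = solve-∀
    lem₆ : ∀ L X U p e → X * p * (L * U) + L * e ≡ L * (X * (U * p) + e)
    lem₆ = solve-∀

    0≤Xp : 0ℤ ≤ X * (+ 4) ^ p
    0≤Xp = 0≤* {X} (0≤2^ n) (0≤^ 4 p)

  -- Divided by 2^n W 4^p: V/W exceeds the frequency of x gaps by at most 24 (3/4)^p. `V≤` compares
  -- V with the fringe and `near` the fringe with words of length n; the common factor 4^L cancels.
  total-lower : X * (V * (+ 4) ^ p) ≤ S * (W * (+ 4) ^ p) + X * (+ 24 * (+ 3) ^ p * W)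
  total-lower = subst (λ z → X * (V * (+ 4) ^ p) ≤ S * (+ w * z * (+ 4) ^ p) + X * (+ 24 * (+ 3) ^ p * (+ w * z))) c*T
    (*-cancelˡ-≤-pos (X * (V * (+ 4) ^ p)) (S * (+ w * (c * T) * (+ 4) ^ p) + X * (+ 24 * (+ 3) ^ p * (+ w * (c * T)))) ((+ 4) ^ L) {{^-positive 4 L}} (begin
      (+ 4) ^ L * (X * (V * (+ 4) ^ p))   ≡⟨ lem₁ ((+ 4) ^ L) X V ((+ 4) ^ p) ⟩
      X * (+ 4) ^ p * ((+ 4) ^ L * V)     ≤⟨ *-monoˡ (X * (+ 4) ^ p) 0≤Xp V≤ ⟩
      X * (+ 4) ^ p * (+ w * (c * F))     ≡⟨ lem₂ X ((+ 4) ^ p) (+ w) c F ⟩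
      + w * c * (X * (F * (+ 4) ^ p))     ≤⟨ *-monoˡ (+ w * c) 0≤w*c (below near) ⟩
      + w * c * (S * (T * ((+ 4) ^ L * (+ 4) ^ p)) + X * (T * (+ 24 * (+ 3) ^ p * (+ 4) ^ L)))
        ≡⟨ lem₃ (+ w) c S T ((+ 4) ^ L) ((+ 4) ^ p) X ((+ 3) ^ p) ⟩
      (+ 4) ^ L * (S * (+ w * (c * T) * (+ 4) ^ p) + X * (+ 24 * (+ 3) ^ p * (+ w * (c * T)))) ∎))
    where open ≤-Reasoning

  total-upper : S * (W * (+ 4) ^ p) ≤ X * (U * (+ 4) ^ p) + X * (+ 24 * (+ 3) ^ p * W)
  total-upper = subst (λ z → S * (+ w * z * (+ 4) ^ p) ≤ X * (U * (+ 4) ^ p) + X * (+ 24 * (+ 3) ^ p * (+ w * z))) c*T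
    (*-cancelˡ-≤-pos (S * (+ w * (c * T) * (+ 4) ^ p)) (X * (U * (+ 4) ^ p) + X * (+ 24 * (+ 3) ^ p * (+ w * (c * T)))) ((+ 4) ^ L) {{^-positive 4 L}} (begin
      (+ 4) ^ L * (S * (+ w * (c * T) * (+ 4) ^ p)) ≡⟨ lem₄ (+ w) c S T ((+ 4) ^ L) ((+ 4) ^ p) ⟩
      + w * c * (S * (T * ((+ 4) ^ L * (+ 4) ^ p))) ≤⟨ *-monoˡ (+ w * c) 0≤w*c (above near) ⟩
      + w * c * (X * (F * (+ 4) ^ p) + X * (T * (+ 24 * (+ 3) ^ p * (+ 4) ^ L)))
        ≡⟨ lem₅ (+ w) c F T ((+ 4) ^ L) ((+ 4) ^ p) X ((+ 3) ^ p) ⟩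
      X * (+ 4) ^ p * (+ w * (c * F)) + (+ 4) ^ L * (X * (+ 24 * (+ 3) ^ p * (+ w * (c * T))))
        ≤⟨ +-monoˡ-≤ ((+ 4) ^ L * (X * (+ 24 * (+ 3) ^ p * (+ w * (c * T))))) (*-monoˡ (X * (+ 4) ^ p) 0≤Xp ≤U) ⟩
      X * (+ 4) ^ p * ((+ 4) ^ L * U) + (+ 4) ^ L * (X * (+ 24 * (+ 3) ^ p * (+ w * (c * T))))
        ≡⟨ lem₆ ((+ 4) ^ L) X U ((+ 4) ^ p) (X * (+ 24 * (+ 3) ^ p * (+ w * (c * T)))) ⟩
      (+ 4) ^ L * (X * (U * (+ 4) ^ p) + X * (+ 24 * (+ 3) ^ p * (+ w * (c * T)))) ∎))
    where open ≤-Reasoning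

-- The inequalities a/10^6 + 24 (3/4)^p ≤ V/W and U/W + 24 (3/4)^p ≤ b/10^6 without denominators, V
-- and U being the values for `slope` and `rise`.
LowerTest UpperTest : ℕ → ℕ → ℕ → ℕ → List Row → Set
LowerTest a x p w rs = + a * (W * (+ 4) ^ p) + + 24 * (+ 3) ^ p * W * + 1000000 ≤ value slope (suc x) rs * (+ 4) ^ p * + 1000000
  where W = + w * (+ 2) ^ 12
UpperTest b x p w rs = value rise (suc x) rs * (+ 4) ^ p * + 1000000 + + 24 * (+ 3) ^ p * W * + 1000000 ≤ + b * (W * (+ 4) ^ p)
  where W = + w * (+ 2) ^ 12

scale-lower : ∀ X V q S W t a M .{{_ : Positive (W * q)}} → 0ℤ ≤ X → 0ℤ ≤ M →
  X * (V * q) ≤ S * (W * q) + X * (t * W) → a * (W * q) + t * W * M ≤ V * q * M → a * X ≤ S * M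
scale-lower X V q S W t a M 0≤X 0≤M h g = *-cancelʳ-≤-pos (a * X) (S * M) (W * q) (begin
  a * X * (W * q)                                     ≡⟨ lem₁ a X (W * q) (t * W * M) ⟩
  X * (a * (W * q) + t * W * M) - X * (t * W * M)     ≤⟨ +-monoˡ-≤ (- (X * (t * W * M))) (*-monoˡ X 0≤X g) ⟩
  X * (V * q * M) - X * (t * W * M)                   ≡⟨ cong (_- X * (t * W * M)) (lem₂ X (V * q) M) ⟩
  M * (X * (V * q)) - X * (t * W * M)                 ≤⟨ +-monoˡ-≤ (- (X * (t * W * M))) (*-monoˡ M 0≤M h) ⟩
  M * (S * (W * q) + X * (t * W)) - X * (t * W * M)   ≡⟨ lem₃ M S (W * q) X (t * W) ⟩
  S * M * (W * q)                                     ∎)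
  where
  open ≤-Reasoning
  lem₁ : ∀ a x w e → a * x * w ≡ x * (a * w + e) - x * e
  lem₁ = solve-∀
  lem₂ : ∀ x v m → x * (v * m) ≡ m * (x * v)
  lem₂ = solve-∀
  lem₃ : ∀ m s w x e → m * (s * w + x * e) - x * (e * m) ≡ s * m * w
  lem₃ = solve-∀

scale-upper : ∀ X U q S W t b M .{{_ : Positive (W * q)}} → 0ℤ ≤ X → 0ℤ ≤ M →
  S * (W * q) ≤ X * (U * q) + X * (t * W) → U * q * M + t * W * M ≤ b * (W * q) → S * M ≤ b * X
scale-upper X U q S W t b M 0≤X 0≤M h g = *-cancelʳ-≤-pos (S * M) (b * X) (W * q) (begin
  S * M * (W * q)                   ≡⟨ lem₁ S M (W * q) ⟩
  M * (S * (W * q))                 ≤⟨ *-monoˡ M 0≤M h ⟩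
  M * (X * (U * q) + X * (t * W))   ≡⟨ lem₂ M X (U * q) (t * W) ⟩
  X * (U * q * M + t * W * M)       ≤⟨ *-monoˡ X 0≤X g ⟩
  X * (b * (W * q))                 ≡⟨ lem₃ X b (W * q) ⟩
  b * X * (W * q)                   ∎)
  where
  open ≤-Reasoning
  lem₁ : ∀ s m w → s * m * w ≡ m * (s * w)
  lem₁ = solve-∀
  lem₂ : ∀ m x u e → m * (x * u + x * e) ≡ x * (u * m + e * m)
  lem₂ = solve-∀
  lem₃ : ∀ x b w → x * (b * w) ≡ b * x * w
  lem₃ = solve-∀

prob-≥ : ∀ a n k → + a * (+ 2) ^ n ≤ + count n k * + 1000000 → + a ℚ./ 1000000 ℚ.≤ prob n k
prob-≥ a n k h = /-≤ (+ a) (+ count n k) 1000000 (2 ℕ.^ n) {{_}} {{ℕₚ.m^n≢0 2 n}} (subst (λ z → + a * z ≤ + count n k * + 1000000) (sym (pos-^ 2 n)) h)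

prob-≤ : ∀ b n k → + count n k * + 1000000 ≤ + b * (+ 2) ^ n → prob n k ℚ.≤ + b ℚ./ 1000000
prob-≤ b n k h = /-≤ (+ count n k) (+ b) (2 ℕ.^ n) 1000000 {{ℕₚ.m^n≢0 2 n}} {{_}} (subst (λ z → + count n k * + 1000000 ≤ + b * z) (sym (pos-^ 2 n)) h)

between : ∀ l x h a b L p w rs → x ℕ.≤ 10 → suc L ≡ p ℕ.+ p → 1 ℕ.≤ w → Bounds (ii ∷ []) w L (suc x) rs →
  l ℕ.* 1000000 ℕ.< a ℕ.* 100000 → b ℕ.* 100000 ℕ.< h ℕ.* 1000000 → LowerTest a x p w rs → UpperTest b x p w rs → ℓBetween l (2 ℕ.* x) h
between l x h a b L p w rs x≤10 L≡ w≥1 bounds l<a b<h lo hi = + a ℚ./ 1000000 , + b ℚ./ 1000000 ,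
  /-< (+ l) (+ a) 100000 1000000 (scale< l 1000000 a 100000 l<a) ,
  /-< (+ b) (+ h) 1000000 100000 (scale< b 100000 h 1000000 b<h) ,
  N , λ n N≤n → prob-≥ a n (2 ℕ.* x) (from-lower n N≤n) , prob-≤ b n (2 ℕ.* x) (from-upper n N≤n)
  where
  N = L ℕ.* 2 ℕ.+ suc (suc x)
  W = + w * (+ 2) ^ 12
  q = (+ 4) ^ p
  scale< : ∀ u m v m′ → u ℕ.* m ℕ.< v ℕ.* m′ → + u * + m < + v * + m′
  scale< u m v m′ h = subst₂ _<_ (pos-* u m) (pos-* v m′) (+<+ h)
  W*q>0 : Positive (W * q)
  W*q>0 = subst Positive (trans (pos-* (w ℕ.* 2 ℕ.^ 12) (4 ℕ.^ p)) (cong₂ _*_ (pos-* w (2 ℕ.^ 12)) (pos-^ 4 p)))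
    (positive (+<+ (ℕₚ.*-mono-≤ (ℕₚ.*-mono-≤ w≥1 (ℕₚ.m^n>0 2 12)) (ℕₚ.m^n>0 4 p))))
  from-lower : ∀ n → N ℕ.≤ n → + a * (+ 2) ^ n ≤ + count n (2 ℕ.* x) * + 1000000
  from-lower n N≤n = subst₂ (λ X S → + a * X ≤ S * + 1000000) (2^-def n) (sym (count-even n x (ℕₚ.≤-trans (ℕₚ.m≤n+m _ (L ℕ.* 2)) N≤n)))
    (scale-lower (2^ n) (value slope (suc x) rs) q (total n x) W (+ 24 * (+ 3) ^ p) (+ a) (+ 1000000) {{W*q>0}} (0≤2^ n) 0≤+
      (Numeric.total-lower x L p w rs x≤10 L≡ bounds n N≤n) lo)
  from-upper : ∀ n → N ℕ.≤ n → + count n (2 ℕ.* x) * + 1000000 ≤ + b * (+ 2) ^ n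
  from-upper n N≤n = subst₂ (λ X S → S * + 1000000 ≤ + b * X) (2^-def n) (sym (count-even n x (ℕₚ.≤-trans (ℕₚ.m≤n+m _ (L ℕ.* 2)) N≤n)))
    (scale-upper (2^ n) (value rise (suc x) rs) q (total n x) W (+ 24 * (+ 3) ^ p) (+ b) (+ 1000000) {{W*q>0}} (0≤2^ n) 0≤+
      (Numeric.total-upper x L p w rs x≤10 L≡ bounds n N≤n) hi)

-- Boolean verification and the certificate.

verify : ℕ → ℕ → List Row → ℕ × ℕ × ℕ → Bool
verify p w rs (l , x , h) =
  (x ℕ.≤ᵇ 10) ∧ (l ℕ.* 1000000 ℕ.<ᵇ a ℕ.* 100000) ∧ (b ℕ.* 100000 ℕ.<ᵇ h ℕ.* 1000000) ∧
  (+ a * (W * (+ 4) ^ p) + + 24 * (+ 3) ^ p * W * + 1000000 ≤ᵇ value slope (suc x) rs * (+ 4) ^ p * + 1000000) ∧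
  (value rise (suc x) rs * (+ 4) ^ p * + 1000000 + + 24 * (+ 3) ^ p * W * + 1000000 ≤ᵇ + b * (W * (+ 4) ^ p))
  where
  -- `LimitBetween` asks for bounds strictly inside the interval; they are taken 10^-6 inside, a
  -- tenth of the unit of `ranges`.
  a = 10 ℕ.* l ℕ.+ 1
  b = 10 ℕ.* h ∸ 1
  W = + w * (+ 2) ^ 12

verifyAll : ℕ → ℕ → List Row → List (ℕ × ℕ × ℕ) → Bool
verifyAll p w rs [] = true
verifyAll p w rs (s ∷ ss) = verify p w rs s ∧ verifyAll p w rs ss

verifyAll-sound : ∀ p w rs ss → verifyAll p w rs ss ≡ true → All (λ s → verify p w rs s ≡ true) ss
verifyAll-sound p w rs [] h = []
verifyAll-sound p w rs (s ∷ ss) h = proj₁ (∧-true h) ∷ verifyAll-sound p w rs ss (proj₂ (∧-true {verify p w rs s} h))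

verify-sound : ∀ p L w rs l x h → suc L ≡ p ℕ.+ p → 1 ℕ.≤ w → (x ℕ.≤ 10 → Bounds (ii ∷ []) w L (suc x) rs) →
  verify p w rs (l , x , h) ≡ true → ℓBetween l (2 ℕ.* x) h
verify-sound p L w rs l x h L≡ w≥1 bounds e =
  let x≤10 , e₁ = ∧-true {x ℕ.≤ᵇ 10} e
      l<a , e₂ = ∧-true {l ℕ.* 1000000 ℕ.<ᵇ (10 ℕ.* l ℕ.+ 1) ℕ.* 100000} e₁
      b<h , e₃ = ∧-true {(10 ℕ.* h ∸ 1) ℕ.* 100000 ℕ.<ᵇ h ℕ.* 1000000} e₂
      lo , hi = ∧-true e₃
  in between l x h (10 ℕ.* l ℕ.+ 1) (10 ℕ.* h ∸ 1) L p w rs (ℕₚ.≤ᵇ⇒≤ x 10 (T⁺ x≤10)) L≡ w≥1 (bounds (ℕₚ.≤ᵇ⇒≤ x 10 (T⁺ x≤10)))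
       (ℕₚ.<ᵇ⇒< _ _ (T⁺ l<a)) (ℕₚ.<ᵇ⇒< _ _ (T⁺ b<h)) (≤ᵇ⇒≤ (T⁺ lo)) (≤ᵇ⇒≤ (T⁺ hi))
  where
  T⁺ : ∀ {b} → b ≡ true → IsTrue b
  T⁺ = Equivalence.from T-≡

hd-halvings : ∀ n → hd (halvings n) ≡ 2 ℕ.^ n
hd-halvings zero = refl
hd-halvings (suc n) = refl

halving-halvings : ∀ k m → Halving k (halvings (k ℕ.+ m))
halving-halvings zero m = tt
halving-halvings (suc k) m = cong (2 ℕ.*_) (sym (hd-halvings (k ℕ.+ m))) , halving-halvings k m

-- The cap 11 is the largest `suc x`. A digit costs at least 2, so the budget 22 is spent after at
-- most 11 digits and the fuel 12 is never exhausted. From the prefix `ii`, 2 · (1 + 2 · 12) = 50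
-- exact halvings are required, and 60 are available.
table : ℕ → List Row
table b = search 12 11 b (ii ∷ []) [] (halvings 60)

table-bounds : ∀ b L x → 24 ℕ.≤ L → x ℕ.≤ 10 → Bounds (ii ∷ []) (2 ℕ.^ 60) L (suc x) (table b)
table-bounds b L x L≥ x≤10 = search-bounds 12 11 b (ii ∷ []) [] (halvings 60) L (suc x) (s≤s x≤10) refl covers (halving-halvings 50 10) (s≤s L≥)
  where
  covers : Covers (ii ∷ []) []
  covers i = cong not (sym (conv-intro (ii ∷ []) (suc (suc i)) λ
    { zero zero () ; zero (suc y) _ → refl ; (suc x) y _ → refl }))

ranges : List (ℕ × ℕ × ℕ)
ranges = (12165 , 0 , 12255) ∷ (18434 , 1 , 18614) ∷ (18713 , 2 , 18959) ∷ (15728 , 3 , 16019) ∷ (11801 , 4 , 12119)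
  ∷ (8188 , 5 , 8523) ∷ (5355 , 6 , 5700) ∷ (3334 , 7 , 3685) ∷ (1981 , 8 , 2335) ∷ (1115 , 9 , 1471) ∷ (580 , 10 , 937) ∷ []

-- Prefixes of length t with v ones become leaves when 2t + v ≥ 26; at the root 2t + v = 4, which leaves 22.
-- The weights start at 2^60, and 60 is half the length of the window of sums.
certificate : verifyAll 60 (2 ℕ.^ 60) (table 22) ranges ≡ true
certificate = refl

-- With p, L and b as variables the table stays unevaluated here. At the end p = 60, which makes the
-- truncation error 24 (3/4)^60 smaller than 8 · 10^-7.
bounds-from : ∀ p L b → suc L ≡ p ℕ.+ p → 24 ℕ.≤ L → verifyAll p (2 ℕ.^ 60) (table b) ranges ≡ true →
  All (λ { (l , x , h) → ℓBetween l (2 ℕ.* x) h }) ranges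
bounds-from p L b L≡ L≥ e = All.map
  (λ { {l , x , h} → verify-sound p L (2 ℕ.^ 60) (table b) l x h L≡ (ℕₚ.m^n>0 2 60) (table-bounds b L x L≥) })
  (verifyAll-sound p (2 ℕ.^ 60) (table b) ranges e)

theorem3p20 : ((k : ℕ) → Converges (λ n → prob n k))
    × ℓBetween 12165 0 12255
    × ℓBetween 18434 2 18614
    × ℓBetween 18713 4 18959
    × ℓBetween 15728 6 16019
    × ℓBetween 11801 8 12119
    × ℓBetween 8188 10 8523
    × ℓBetween 5355 12 5700
    × ℓBetween 3334 14 3685
    × ℓBetween 1981 16 2335
    × ℓBetween 1115 18 1471
    × ℓBetween 580 20 937
theorem3p20 = prob-converges , unpack (bounds-from 60 119 22 refl (ℕₚ.≤ᵇ⇒≤ 24 119 tt) certificate)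
  where
  unpack : All (λ { (l , x , h) → ℓBetween l (2 ℕ.* x) h }) ranges → _
  unpack (b₀ ∷ b₁ ∷ b₂ ∷ b₃ ∷ b₄ ∷ b₅ ∷ b₆ ∷ b₇ ∷ b₈ ∷ b₉ ∷ b₁₀ ∷ []) =
    b₀ , b₁ , b₂ , b₃ , b₄ , b₅ , b₆ , b₇ , b₈ , b₉ , b₁₀
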